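{- Let $\alpha=(\alpha_1,\ldots,\alpha_n)$ be a composition, $\sigma\in S_n$, and $i\in\{1,\ldots,n-1\}$ with $\alpha_i=\alpha_{i+1}$. Then the pair of maps $P_i:\mathrm{NAF}(\alpha,\sigma)\times\mathrm{NAF}(\alpha,\sigma s_i)\to\mathbb{Q}(q,t)$ and $P_i:\mathrm{NAF}(\alpha,\sigma s_i)\times\mathrm{NAF}(\alpha,\sigma)\to\mathbb{Q}(q,t)$ is a probabilistic bijection between $\mathrm{NAF}(\alpha,\sigma)$ and $\mathrm{NAF}(\alpha,\sigma s_i)$ with respect to the weight $\mathrm{wt}_{q,t}$; that is, for all $T\in\mathrm{NAF}(\alpha,\sigma)$ and $U\in\mathrm{NAF}(\alpha,\sigma s_i)$, $$\mathrm{wt}_{q,t}(U)P_i(U,T)=\mathrm{wt}_{q,t}(T)P_i(T,U).$$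
   Context: Permutations are in one-line notation; $\sigma s_i$ is $\sigma$ with the entries in positions $i,i+1$ exchanged (so $(\sigma s_i)s_i=\sigma$). A composition is a sequence of nonnegative integers. The skyline diagram is $\mathrm{dg}(\alpha)=\{(j,r):1\le j\le n,\ 1\le r\le\alpha_j\}$ ($j$ = column, $r$ = row) and the augmented diagram is $\mathrm{adg}(\alpha)=\mathrm{dg}(\alpha)\cup\{(j,0):1\le j\le n\}$ (row $0$ is the basement). For $u=(j,r)\in\mathrm{dg}(\alpha)$: the box south of $u$ is $\mathrm{south}(u)=(j,r-1)$; $\mathrm{leg}(u)=\alpha_j-r$; the left arm set is $\{(j',r-1)\in\mathrm{adg}(\alpha):j'<j,\ \alpha_{j'}<\alpha_j\}$, the right arm set is $\{(j',r)\in\mathrm{dg}(\alpha):j'>j,\ \alpha_{j'}\le\alpha_j\}$, $\mathrm{Arm}(u)$ is their union and $\mathrm{arm}(u)=|\mathrm{Arm}(u)|$. Two boxes of $\mathrm{adg}(\alpha)$ attack each other if they are in the same row, or in consecutive rows with the box in the higher row strictly to the right of the box in the lower row. A filling of shape $\alpha$ and basement $\tau\in S_n$ is a map $T:\mathrm{adg}(\alpha)\to\{1,\ldots,n\}$ with $T(j,0)=\tau_j$; $\mathrm{F}(\alpha,\tau)$ is the set of these, and $\mathrm{NAF}(\alpha,\tau)$ the subset of non-attacking ones (attacking boxes have distinct entries). For integers $a,b$ let $\chi(a,b)=1$ if $a>b$ and $0$ otherwise, and $\chi(a,b,c)=\chi(a,b)+\chi(b,c)-\chi(a,c)$. For $T\in\mathrm{NAF}(\alpha,\tau)$: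 a descent is $u\in\mathrm{dg}(\alpha)$ with $T(u)>T(\mathrm{south}(u))$, and $\mathrm{maj}(T)=\sum_{u\text{ descent}}(\mathrm{leg}(u)+1)$; a triple is $(u,v,w)$ with $u\in\mathrm{dg}(\alpha)$, $w=\mathrm{south}(u)$, $v\in\mathrm{Arm}(u)$; it is an inversion triple if $\chi(T(u),T(v),T(w))=1$ and a coinversion triple otherwise; $\mathrm{coinv}(T)$ is the number of coinversion triples; and $\mathrm{wt}_{q,t}(T)=q^{\mathrm{maj}(T)}t^{\mathrm{coinv}(T)}\prod_{u\in\mathrm{dg}(\alpha),\,T(u)\ne T(\mathrm{south}(u))}\frac{1-t}{1-q^{1+\mathrm{leg}(u)}t^{1+\mathrm{arm}(u)}}$. Fix $i$ with $\alpha_i=\alpha_{i+1}$. For a filling $T$ and $0\le r\le\alpha_i$, $\mathrm{swap}_r(T)$ exchanges the entries of boxes $(i,r)$ and $(i+1,r)$, and $\Omega_{0,h}=\mathrm{swap}_h\circ\cdots\circ\mathrm{swap}_0$. For $T\in\mathrm{NAF}(\alpha,\tau)$ (any $\tau$) and $0\le r\le\alpha_i-1$, let $a=T(i,r)$, $b=T(i+1,r)$, $c=T(i,r+1)$, $d=T(i+1,r+1)$, $A=\mathrm{arm}(i+1,r+1)$, $\ell=\mathrm{leg}(i+1,r+1)$, and define $\rho_r(T)\in\mathbb{Q}(q,t)$: if $a,b,c,d$ are distinct, $\rho_r(T)=0$ when $\chi(c,d,a)=\chi(c,d,b)$ and $\rho_r(T)=1$ when $\chi(c,d,a)=\chi(d,c,b)$;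 if exactly three of them are distinct, then $\rho_r(T)=0$ if $b=c$, $\rho_r(T)=1$ if $b=d$, and $\rho_r(T)=t^{1-\chi(d,a,b)}\frac{1-q^{\ell+1}t^{A+1}}{1-q^{\ell+1}t^{A+2}}$ if $a=c$; if $a=c$ and $b=d$, $\rho_r(T)=1$. Also set $\rho_{\alpha_i}(T)=0$. For $T\in\mathrm{NAF}(\alpha,\tau)$ and a filling $U$ of shape $\alpha$ and basement $\tau s_i$, $P_i(T,U)=\left(\prod_{r=0}^{h-1}\rho_r(T)\right)(1-\rho_h(T))$ if $U=\Omega_{0,h}(T)$ for some $h\in\{0,\ldots,\alpha_i\}$, and $P_i(T,U)=0$ otherwise. This is applied both with $\tau=\sigma$ and with $\tau=\sigma s_i$. A probabilistic bijection between $(\mathbf{T},\mathrm{wt})$ and $(\mathbf{U},\mathrm{wt})$ is a pair $P_{\mathbf{T}}:\mathbf{T}\times\mathbf{U}\to A$, $P_{\mathbf{U}}:\mathbf{U}\times\mathbf{T}\to A$ with $\sum_{U}P_{\mathbf{T}}(T,U)=1$, $\sum_TP_{\mathbf{U}}(U,T)=1$, and $\mathrm{wt}(T)P_{\mathbf{T}}(T,U)=\mathrm{wt}(U)P_{\mathbf{U}}(U,T)$ for all $T,U$. -}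

module Defs where

open import Level using (Level; 0ℓ; _⊔_) renaming (suc to lsuc)
open import Algebra.Bundles using (CommutativeRing; CommutativeSemiring)
import Algebra.Properties.Semiring.Exp as Exp
open import Algebra.Structures using (IsCommutativeRing)
import Algebra.Properties.AbelianGroup as AbelianGroupProperties
import Algebra.Properties.CommutativeSemigroup as CommutativeSemigroupProperties
import Algebra.Properties.Ring as RingProperties
import Algebra.Solver.Ring.NaturalCoefficients.Default as NaturalSolver
open import Data.Bool.Base using (if_then_else_)
open import Data.Empty using (⊥-elim; ⊥-elim-irr)
open import Data.Fin.Base as Fin using (Fin; toℕ; fromℕ<; inject₁)
import Data.Fin.Properties as Fin
open import Data.Fin.Permutation as Perm using (Permutation′; _⟨$⟩ʳ_; _∘ₚ_)
open import Data.Irrelevant using ([_])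
open import Data.List.Base as List using (List; []; _∷_; allFin; upTo; filter; length; cartesianProductWith)
open import Data.List.Membership.Propositional using (_∈_)
open import Data.List.Membership.Propositional.Properties using (∈-map⁺; ∈-concat⁺′; ∈-allFin; ∈-cartesianProductWith⁺)
import Data.List.Relation.Unary.All as ListAll
open import Data.List.Relation.Unary.Any using (here; there)
open import Data.List.Relation.Unary.AllPairs using ([]; _∷_)
open import Data.List.Relation.Unary.Unique.Propositional using (Unique)
import Data.List.Relation.Unary.Unique.Propositional.Properties as Unique
open import Data.Nat.ListAction using (sum)
open import Data.Nat.Base as ℕ using (ℕ; zero; suc; _≤_; _<_; z≤n; s≤s; pred; _∸_)
import Data.Nat.Properties as ℕ
open import Data.Product.Base using (∃; _×_; _,_; uncurry)
open import Data.Rational.Base as ℚ using (ℚ; 0ℚ; 1ℚ)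
import Data.Rational.Properties as ℚ
open import Data.Refinement.Base as Refinement using (Refinement; value)
open import Data.Sum.Base using (_⊎_)
open import Data.Vec.Base as Vec using (Vec; []; _∷_)
import Data.Vec.Properties as Vec
open import Data.Vec.Relation.Unary.All as VecAll using ([]; _∷_)
open import Data.Vec.Relation.Unary.All.Properties using (lookup⁺; lookup⁻)
open import Relation.Binary.Bundles using (Setoid)
open import Relation.Binary.Definitions using (DecidableEquality)
open import Relation.Binary.PropositionalEquality as ≡ using (_≡_; _≢_; _≗_; refl; cong; cong₂)
import Relation.Binary.Reasoning.Setoid as SetoidReasoning
open import Relation.Nullary.Decidable.Core using (Dec; does; yes; no; _×-dec_; _⊎-dec_; _→-dec_; ¬?; map′)
open import Relation.Nullary.Negation.Core using (¬_)
open import Relation.Unary using (Pred; Decidable)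

-- Throughout, the proofs of ring laws are abstract: they occur as module
-- parameters in the type of rational functions, whose normal form would
-- otherwise be enormous.

record IntegralDomain (c ℓ : Level) : Set (lsuc (c ⊔ ℓ)) where
  field
    commutativeRing : CommutativeRing c ℓ
  open CommutativeRing commutativeRing public
  field
    _≈0?  : ∀ x → Dec (x ≈ 0#)
    1≉0   : 1# ≉ 0#
    x*y≉0 : ∀ {x y} → x ≉ 0# → y ≉ 0# → (x * y) ≉ 0#

-- Polynomials in one variable are lists of coefficients, constant term
-- first, identified when all their coefficients agree (so trailing zeros are
-- irrelevant).

module Polynomial {c ℓ : Level} (D : IntegralDomain c ℓ) where

  private
    module R = IntegralDomain D
    module R≈ = SetoidReasoning R.setoid
  open RingProperties R.ring using (-0#≈0#)
  open CommutativeSemigroupProperties (CommutativeSemiring.+-commutativeSemigroup R.commutativeSemiring) using ()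
    renaming (interchange to R-interchange)

  Poly : Set c
  Poly = List R.Carrier

  coeff : Poly → ℕ → R.Carrier
  coeff []      _       = R.0#
  coeff (a ∷ p) zero    = a
  coeff (a ∷ p) (suc k) = coeff p k

  infix 4 _≈_
  record _≈_ (p p′ : Poly) : Set ℓ where
    constructor mk≈
    field at : ∀ k → coeff p k R.≈ coeff p′ k
  open _≈_ public

  infixl 6 _+_
  infixl 7 _*_
  infix  8 -_

  _+_ : Poly → Poly → Poly
  []      + p′       = p′
  (a ∷ p) + []       = a ∷ p
  (a ∷ p) + (b ∷ p′) = (a R.+ b) ∷ (p + p′)

  -_ : Poly → Poly
  -_ = List.map (λ a → R.- a)

  scale : R.Carrier → Poly → Poly
  scale a = List.map (a R.*_)

  _*_ : Poly → Poly → Poly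
  []      * p′ = []
  (a ∷ p) * p′ = scale a p′ + (R.0# ∷ p * p′)

  constant : R.Carrier → Poly
  constant a = a ∷ []

  0ₚ 1ₚ X : Poly
  0ₚ = []
  1ₚ = constant R.1#
  X  = R.0# ∷ R.1# ∷ []

  coeff-+ : ∀ p p′ k → coeff (p + p′) k R.≈ coeff p k R.+ coeff p′ k
  coeff-+ []      p′       k       = R.sym (R.+-identityˡ _)
  coeff-+ (a ∷ p) []       k       = R.sym (R.+-identityʳ _)
  coeff-+ (a ∷ p) (b ∷ p′) zero    = R.refl
  coeff-+ (a ∷ p) (b ∷ p′) (suc k) = coeff-+ p p′ k

  coeff-neg : ∀ p k → coeff (- p) k R.≈ R.- coeff p k
  coeff-neg []      k       = R.sym -0#≈0#
  coeff-neg (a ∷ p) zero    = R.refl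
  coeff-neg (a ∷ p) (suc k) = coeff-neg p k

  coeff-scale : ∀ a p k → coeff (scale a p) k R.≈ a R.* coeff p k
  coeff-scale a []      k       = R.sym (R.zeroʳ a)
  coeff-scale a (b ∷ p) zero    = R.refl
  coeff-scale a (b ∷ p) (suc k) = coeff-scale a p k

  ≈-refl : ∀ {p} → p ≈ p
  ≈-refl .at k = R.refl

  ≈-sym : ∀ {p p′} → p ≈ p′ → p′ ≈ p
  ≈-sym e .at k = R.sym (at e k)

  ≈-trans : ∀ {p p′ p″} → p ≈ p′ → p′ ≈ p″ → p ≈ p″
  ≈-trans e e′ .at k = R.trans (at e k) (at e′ k)

  ≈-setoid : Setoid c ℓ
  ≈-setoid = record
    { Carrier = Poly ; _≈_ = _≈_
    ; isEquivalence = record { refl = ≈-refl ; sym = ≈-sym ; trans = ≈-trans } }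

  private module P≈ = SetoidReasoning ≈-setoid

  ∷-cong : ∀ {a b p p′} → a R.≈ b → p ≈ p′ → a ∷ p ≈ b ∷ p′
  ∷-cong e e′ .at zero    = e
  ∷-cong e e′ .at (suc k) = at e′ k

  0∷0≈0 : R.0# ∷ [] ≈ []
  0∷0≈0 .at zero    = R.refl
  0∷0≈0 .at (suc k) = R.refl

  +-cong : ∀ {p p′ r r′} → p ≈ p′ → r ≈ r′ → p + r ≈ p′ + r′
  +-cong {p} {p′} {r} {r′} e e′ .at k = R≈.begin
    coeff (p + r) k            R≈.≈⟨ coeff-+ p r k ⟩
    coeff p k R.+ coeff r k    R≈.≈⟨ R.+-cong (at e k) (at e′ k) ⟩
    coeff p′ k R.+ coeff r′ k  R≈.≈⟨ coeff-+ p′ r′ k ⟨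
    coeff (p′ + r′) k          R≈.∎

  +-assoc : ∀ p r s → (p + r) + s ≈ p + (r + s)
  +-assoc p r s .at k = R≈.begin
    coeff (p + r + s) k                      R≈.≈⟨ coeff-+ (p + r) s k ⟩
    coeff (p + r) k R.+ coeff s k            R≈.≈⟨ R.+-congʳ (coeff-+ p r k) ⟩
    coeff p k R.+ coeff r k R.+ coeff s k    R≈.≈⟨ R.+-assoc _ _ _ ⟩
    coeff p k R.+ (coeff r k R.+ coeff s k)  R≈.≈⟨ R.+-congˡ (coeff-+ r s k) ⟨
    coeff p k R.+ coeff (r + s) k            R≈.≈⟨ coeff-+ p (r + s) k ⟨
    coeff (p + (r + s)) k                    R≈.∎

  +-comm : ∀ p r → p + r ≈ r + p
  +-comm p r .at k = R≈.begin
    coeff (p + r) k          R≈.≈⟨ coeff-+ p r k ⟩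
    coeff p k R.+ coeff r k  R≈.≈⟨ R.+-comm _ _ ⟩
    coeff r k R.+ coeff p k  R≈.≈⟨ coeff-+ r p k ⟨
    coeff (r + p) k          R≈.∎

  +-identityʳ : ∀ p → p + 0ₚ ≈ p
  +-identityʳ p = +-comm p 0ₚ

  neg-cong : ∀ {p p′} → p ≈ p′ → - p ≈ - p′
  neg-cong {p} {p′} e .at k =
    R.trans (coeff-neg p k) (R.trans (R.-‿cong (at e k)) (R.sym (coeff-neg p′ k)))

  neg-inverseˡ : ∀ p → - p + p ≈ 0ₚ
  neg-inverseˡ p .at k =
    R.trans (coeff-+ (- p) p k) (R.trans (R.+-congʳ (coeff-neg p k)) (R.-‿inverseˡ _))

  +-interchange : ∀ p r s u → (p + r) + (s + u) ≈ (p + s) + (r + u)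
  +-interchange p r s u .at k = R≈.begin
    coeff (p + r + (s + u)) k
      R≈.≈⟨ coeff-+ (p + r) (s + u) k ⟩
    coeff (p + r) k R.+ coeff (s + u) k
      R≈.≈⟨ R.+-cong (coeff-+ p r k) (coeff-+ s u k) ⟩
    (coeff p k R.+ coeff r k) R.+ (coeff s k R.+ coeff u k)
      R≈.≈⟨ R-interchange _ _ _ _ ⟩
    (coeff p k R.+ coeff s k) R.+ (coeff r k R.+ coeff u k)
      R≈.≈⟨ R.+-cong (coeff-+ p s k) (coeff-+ r u k) ⟨
    coeff (p + s) k R.+ coeff (r + u) k
      R≈.≈⟨ coeff-+ (p + s) (r + u) k ⟨
    coeff (p + s + (r + u)) k
      R≈.∎

  scale-cong : ∀ {a b p p′} → a R.≈ b → p ≈ p′ → scale a p ≈ scale b p′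
  scale-cong {a} {b} {p} {p′} e e′ .at k =
    R.trans (coeff-scale a p k) (R.trans (R.*-cong e (at e′ k)) (R.sym (coeff-scale b p′ k)))

  scale-+ : ∀ a p r → scale a (p + r) ≈ scale a p + scale a r
  scale-+ a p r .at k = R≈.begin
    coeff (scale a (p + r)) k                      R≈.≈⟨ coeff-scale a (p + r) k ⟩
    a R.* coeff (p + r) k                          R≈.≈⟨ R.*-congˡ (coeff-+ p r k) ⟩
    a R.* (coeff p k R.+ coeff r k)                R≈.≈⟨ R.distribˡ _ _ _ ⟩
    a R.* coeff p k R.+ a R.* coeff r k            R≈.≈⟨ R.+-cong (coeff-scale a p k) (coeff-scale a r k) ⟨
    coeff (scale a p) k R.+ coeff (scale a r) k    R≈.≈⟨ coeff-+ (scale a p) (scale a r) k ⟨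
    coeff (scale a p + scale a r) k                R≈.∎

  scale-scale : ∀ a b p → scale (a R.* b) p ≈ scale a (scale b p)
  scale-scale a b p .at k = R≈.begin
    coeff (scale (a R.* b) p) k    R≈.≈⟨ coeff-scale _ p k ⟩
    a R.* b R.* coeff p k          R≈.≈⟨ R.*-assoc _ _ _ ⟩
    a R.* (b R.* coeff p k)        R≈.≈⟨ R.*-congˡ (coeff-scale b p k) ⟨
    a R.* coeff (scale b p) k      R≈.≈⟨ coeff-scale a (scale b p) k ⟨
    coeff (scale a (scale b p)) k  R≈.∎

  scale-0 : ∀ p → scale R.0# p ≈ 0ₚ
  scale-0 p .at k = R.trans (coeff-scale _ p k) (R.zeroˡ _)

  scale-1 : ∀ p → scale R.1# p ≈ p
  scale-1 p .at k = R.trans (coeff-scale _ p k) (R.*-identityˡ _)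

  *-congˡ : ∀ p {r r′} → r ≈ r′ → p * r ≈ p * r′
  *-congˡ []      e = ≈-refl
  *-congˡ (a ∷ p) e = +-cong (scale-cong R.refl e) (∷-cong R.refl (*-congˡ p e))

  *-zeroʳ : ∀ p → p * [] ≈ []
  *-zeroʳ []      = ≈-refl
  *-zeroʳ (a ∷ p) = ≈-trans (∷-cong R.refl (*-zeroʳ p)) 0∷0≈0

  *-∷ : ∀ p b r → p * (b ∷ r) ≈ scale b p + (R.0# ∷ p * r)
  *-∷ []      b r = ≈-sym 0∷0≈0
  *-∷ (a ∷ p) b r = ∷-cong (R.+-congʳ (R.*-comm a b)) (P≈.begin
    scale a r + p * (b ∷ r)                    P≈.≈⟨ +-cong ≈-refl (*-∷ p b r) ⟩
    scale a r + (scale b p + (R.0# ∷ p * r))   P≈.≈⟨ +-assoc (scale a r) (scale b p) _ ⟨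
    scale a r + scale b p + (R.0# ∷ p * r)     P≈.≈⟨ +-cong (+-comm (scale a r) (scale b p)) ≈-refl ⟩
    scale b p + scale a r + (R.0# ∷ p * r)     P≈.≈⟨ +-assoc (scale b p) (scale a r) _ ⟩
    scale b p + (scale a r + (R.0# ∷ p * r))   P≈.∎)

  *-comm : ∀ p r → p * r ≈ r * p
  *-comm []      r = ≈-sym (*-zeroʳ r)
  *-comm (a ∷ p) r =
    ≈-trans (+-cong ≈-refl (∷-cong R.refl (*-comm p r))) (≈-sym (*-∷ r a p))

  *-cong : ∀ {p p′ r r′} → p ≈ p′ → r ≈ r′ → p * r ≈ p′ * r′
  *-cong {p} {p′} {r} {r′} e e′ = P≈.begin
    p * r    P≈.≈⟨ *-congˡ p e′ ⟩
    p * r′   P≈.≈⟨ *-comm p r′ ⟩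
    r′ * p   P≈.≈⟨ *-congˡ r′ e ⟩
    r′ * p′  P≈.≈⟨ *-comm r′ p′ ⟩
    p′ * r′  P≈.∎

  0∷-+ : ∀ p r → R.0# ∷ (p + r) ≈ (R.0# ∷ p) + (R.0# ∷ r)
  0∷-+ p r = ∷-cong (R.sym (R.+-identityˡ _)) ≈-refl

  distribˡ : ∀ p r s → p * (r + s) ≈ p * r + p * s
  distribˡ []      r s = ≈-refl
  distribˡ (a ∷ p) r s = P≈.begin
    scale a (r + s) + (R.0# ∷ p * (r + s))
      P≈.≈⟨ +-cong (scale-+ a r s) (≈-trans (∷-cong R.refl (distribˡ p r s)) (0∷-+ (p * r) (p * s))) ⟩
    scale a r + scale a s + ((R.0# ∷ p * r) + (R.0# ∷ p * s))
      P≈.≈⟨ +-interchange (scale a r) (scale a s) (R.0# ∷ p * r) (R.0# ∷ p * s) ⟩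
    (a ∷ p) * r + (a ∷ p) * s
      P≈.∎

  distribʳ : ∀ p r s → (r + s) * p ≈ r * p + s * p
  distribʳ p r s = P≈.begin
    (r + s) * p    P≈.≈⟨ *-comm (r + s) p ⟩
    p * (r + s)    P≈.≈⟨ distribˡ p r s ⟩
    p * r + p * s  P≈.≈⟨ +-cong (*-comm p r) (*-comm p s) ⟩
    r * p + s * p  P≈.∎

  scale-* : ∀ a p r → scale a p * r ≈ scale a (p * r)
  scale-* a []      r = ≈-refl
  scale-* a (b ∷ p) r = P≈.begin
    scale (a R.* b) r + (R.0# ∷ scale a p * r)
      P≈.≈⟨ +-cong (scale-scale a b r) (∷-cong (R.sym (R.zeroʳ a)) (scale-* a p r)) ⟩
    scale a (scale b r) + scale a (R.0# ∷ p * r)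
      P≈.≈⟨ scale-+ a (scale b r) (R.0# ∷ p * r) ⟨
    scale a (scale b r + (R.0# ∷ p * r))
      P≈.∎

  0∷-* : ∀ p r → (R.0# ∷ p) * r ≈ R.0# ∷ p * r
  0∷-* p r = +-cong (scale-0 r) ≈-refl

  *-assoc : ∀ p r s → (p * r) * s ≈ p * (r * s)
  *-assoc []      r s = ≈-refl
  *-assoc (a ∷ p) r s = P≈.begin
    (scale a r + (R.0# ∷ p * r)) * s
      P≈.≈⟨ distribʳ s (scale a r) (R.0# ∷ p * r) ⟩
    scale a r * s + (R.0# ∷ p * r) * s
      P≈.≈⟨ +-cong (scale-* a r s) (≈-trans (0∷-* (p * r) s) (∷-cong R.refl (*-assoc p r s))) ⟩
    scale a (r * s) + (R.0# ∷ p * (r * s))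
      P≈.∎

  *-identityˡ : ∀ p → 1ₚ * p ≈ p
  *-identityˡ p = ≈-trans (+-cong (scale-1 p) 0∷0≈0) (+-identityʳ p)

  abstract
    isCommutativeRing : IsCommutativeRing _≈_ _+_ _*_ -_ 0ₚ 1ₚ
    isCommutativeRing = record
      { isRing = record
        { +-isAbelianGroup = record
          { isGroup = record
            { isMonoid = record
              { isSemigroup = record
                { isMagma = record { isEquivalence = Setoid.isEquivalence ≈-setoid ; ∙-cong = +-cong }
                ; assoc = +-assoc }
              ; identity = (λ _ → ≈-refl) , +-identityʳ }
            ; inverse = neg-inverseˡ , (λ p → ≈-trans (+-comm p (- p)) (neg-inverseˡ p))
            ; ⁻¹-cong = neg-cong }
          ; comm = +-comm }
        ; *-cong = *-cong
        ; *-assoc = *-assoc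
        ; *-identity = *-identityˡ , (λ p → ≈-trans (*-comm p 1ₚ) (*-identityˡ p))
        ; distrib = distribˡ , distribʳ }
      ; *-comm = *-comm }

  polynomialRing : CommutativeRing c ℓ
  polynomialRing = record
    { Carrier = Poly ; _≈_ = _≈_ ; _+_ = _+_ ; _*_ = _*_ ; -_ = -_ ; 0# = 0ₚ ; 1# = 1ₚ
    ; isCommutativeRing = isCommutativeRing }

  coeff₀-* : ∀ p r → coeff (p * r) 0 R.≈ coeff p 0 R.* coeff r 0
  coeff₀-* []      r = R.sym (R.zeroˡ _)
  coeff₀-* (a ∷ p) r =
    R.trans (coeff-+ (scale a r) _ 0) (R.trans (R.+-identityʳ _) (coeff-scale a r 0))

  abstract
    zero? : ∀ p → Dec (p ≈ 0ₚ)
    zero? []      = yes ≈-refl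
    zero? (a ∷ p) = map′
      (λ (e , e′) → ≈-trans (∷-cong e e′) 0∷0≈0)
      (λ e → at e 0 , mk≈ (λ k → at e (suc k)))
      (a R.≈0? ×-dec zero? p)

    a∷p*r≉0 : ∀ {a} p r → a R.≉ R.0# → ¬ (r ≈ 0ₚ) → ¬ ((a ∷ p) * r ≈ 0ₚ)
    a∷p*r≉0     p []      a≉0 r≉0 e = r≉0 ≈-refl
    a∷p*r≉0 {a} p (b ∷ r) a≉0 r≉0 e with b R.≈0?
    ... | no  b≉0 = R.x*y≉0 a≉0 b≉0 (R.trans (R.sym (coeff₀-* (a ∷ p) (b ∷ r))) (at e 0))
    ... | yes b≈0 = a∷p*r≉0 p r a≉0
      (λ r≈0 → r≉0 (≈-trans (∷-cong b≈0 r≈0) 0∷0≈0))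
      (mk≈ (λ k → at shifted (suc k)))
      where
      shifted : R.0# ∷ (a ∷ p) * r ≈ 0ₚ
      shifted = P≈.begin
        R.0# ∷ (a ∷ p) * r                         P≈.≈⟨ +-cong (scale-0 (a ∷ p)) (≈-refl {R.0# ∷ (a ∷ p) * r}) ⟨
        scale R.0# (a ∷ p) + (R.0# ∷ (a ∷ p) * r)  P≈.≈⟨ +-cong (scale-cong {b} {R.0#} {a ∷ p} b≈0 ≈-refl) (≈-refl {R.0# ∷ (a ∷ p) * r}) ⟨
        scale b (a ∷ p) + (R.0# ∷ (a ∷ p) * r)     P≈.≈⟨ *-∷ (a ∷ p) b r ⟨
        (a ∷ p) * (b ∷ r)                          P≈.≈⟨ e ⟩
        0ₚ                                         P≈.∎

    p*r≉0 : ∀ p r → ¬ (p ≈ 0ₚ) → ¬ (r ≈ 0ₚ) → ¬ (p * r ≈ 0ₚ)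
    p*r≉0 []      r p≉0 r≉0 e = p≉0 ≈-refl
    p*r≉0 (a ∷ p) r p≉0 r≉0 e with a R.≈0?
    ... | no  a≉0 = a∷p*r≉0 p r a≉0 r≉0 e
    ... | yes a≈0 = p*r≉0 p r
      (λ p≈0 → p≉0 (≈-trans (∷-cong a≈0 p≈0) 0∷0≈0)) r≉0
      (mk≈ (λ k → at shifted (suc k)))
      where
      shifted : R.0# ∷ p * r ≈ 0ₚ
      shifted = P≈.begin
        R.0# ∷ p * r    P≈.≈⟨ 0∷-* p r ⟨
        (R.0# ∷ p) * r  P≈.≈⟨ *-cong {R.0# ∷ p} {a ∷ p} {r} (∷-cong (R.sym a≈0) ≈-refl) ≈-refl ⟩
        (a ∷ p) * r     P≈.≈⟨ e ⟩
        0ₚ              P≈.∎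

    1≉0 : ¬ (1ₚ ≈ 0ₚ)
    1≉0 e = R.1≉0 (at e 0)

  polynomialDomain : IntegralDomain c ℓ
  polynomialDomain = record
    { commutativeRing = polynomialRing
    ; _≈0?  = zero?
    ; 1≉0   = 1≉0
    ; x*y≉0 = λ {p} {r} → p*r≉0 p r }

module FractionField {c ℓ : Level} (D : IntegralDomain c ℓ) where

  private
    module R = IntegralDomain D
    module R≈ = SetoidReasoning R.setoid
  open RingProperties R.ring using (-‿distribˡ-*; x[y-z]≈xy-xz)
  open AbelianGroupProperties R.+-abelianGroup using (x∙y⁻¹≈ε⇒x≈y)
  open NaturalSolver R.commutativeSemiring using (solve; _:+_; _:*_; _:=_; con)

  record Fraction : Set (c ⊔ ℓ) where
    constructor _/_⟨_⟩
    field
      num   : R.Carrier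
      den   : R.Carrier
      den≉0 : den R.≉ R.0#
  open Fraction public

  infix 4 _≈_
  record _≈_ (x y : Fraction) : Set ℓ where
    constructor mk≈
    field cross : num x R.* den y R.≈ num y R.* den x
  open _≈_ public

  infixl 6 _+_
  infixl 7 _*_
  infix  8 -_

  _+_ : Fraction → Fraction → Fraction
  x + y = (num x R.* den y R.+ num y R.* den x) / den x R.* den y ⟨ R.x*y≉0 (den≉0 x) (den≉0 y) ⟩

  _*_ : Fraction → Fraction → Fraction
  x * y = (num x R.* num y) / den x R.* den y ⟨ R.x*y≉0 (den≉0 x) (den≉0 y) ⟩

  -_ : Fraction → Fraction
  - x = (R.- num x) / den x ⟨ den≉0 x ⟩

  fromRing : R.Carrier → Fraction
  fromRing a = a / R.1# ⟨ R.1≉0 ⟩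

  *-cancelʳ : ∀ {x y z} → z R.≉ R.0# → x R.* z R.≈ y R.* z → x R.≈ y
  *-cancelʳ {x} {y} {z} z≉0 e with (x R.- y) R.≈0?
  ... | yes x-y≈0 = x∙y⁻¹≈ε⇒x≈y x y x-y≈0
  ... | no  x-y≉0 = ⊥-elim (R.x*y≉0 z≉0 x-y≉0 (R≈.begin
    z R.* (x R.- y)          R≈.≈⟨ x[y-z]≈xy-xz z x y ⟩
    z R.* x R.- z R.* y      R≈.≈⟨ R.+-cong (R.*-comm z x) (R.-‿cong (R.*-comm z y)) ⟩
    x R.* z R.- y R.* z      R≈.≈⟨ R.+-congʳ e ⟩
    y R.* z R.- y R.* z      R≈.≈⟨ R.-‿inverseʳ _ ⟩
    R.0#                     R≈.∎))

  ≈-refl : ∀ {x} → x ≈ x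
  ≈-refl .cross = R.refl

  ≈-sym : ∀ {x y} → x ≈ y → y ≈ x
  ≈-sym e .cross = R.sym (cross e)

  ≈-trans : ∀ {x y z} → x ≈ y → y ≈ z → x ≈ z
  ≈-trans {x} {y} {z} e e′ .cross = *-cancelʳ (den≉0 y) (R≈.begin
    num x R.* den z R.* den y    R≈.≈⟨ solve 3 (λ a b c → a :* b :* c := a :* c :* b) R.refl _ _ _ ⟩
    num x R.* den y R.* den z    R≈.≈⟨ R.*-congʳ (cross e) ⟩
    num y R.* den x R.* den z    R≈.≈⟨ solve 3 (λ a b c → a :* b :* c := a :* c :* b) R.refl _ _ _ ⟩
    num y R.* den z R.* den x    R≈.≈⟨ R.*-congʳ (cross e′) ⟩
    num z R.* den y R.* den x    R≈.≈⟨ solve 3 (λ a b c → a :* b :* c := a :* c :* b) R.refl _ _ _ ⟩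
    num z R.* den x R.* den y    R≈.∎)

  +-cong : ∀ {x x′ y y′} → x ≈ x′ → y ≈ y′ → x + y ≈ x′ + y′
  +-cong {x} {x′} {y} {y′} e e′ .cross = R≈.begin
    (num x R.* den y R.+ num y R.* den x) R.* (den x′ R.* den y′)
      R≈.≈⟨ solve 6 (λ a b c d u v → (a :* d :+ c :* b) :* (u :* v) := a :* u :* (d :* v) :+ c :* v :* (b :* u))
            R.refl (num x) (den x) (num y) (den y) (den x′) (den y′) ⟩
    num x R.* den x′ R.* (den y R.* den y′) R.+ num y R.* den y′ R.* (den x R.* den x′)
      R≈.≈⟨ R.+-cong (R.*-congʳ (cross e)) (R.*-congʳ (cross e′)) ⟩
    num x′ R.* den x R.* (den y R.* den y′) R.+ num y′ R.* den y R.* (den x R.* den x′)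
      R≈.≈⟨ solve 6 (λ a b c d u v → (a :* v :+ c :* u) :* (b :* d) := a :* b :* (d :* v) :+ c :* d :* (b :* u))
            R.refl (num x′) (den x) (num y′) (den y) (den x′) (den y′) ⟨
    (num x′ R.* den y′ R.+ num y′ R.* den x′) R.* (den x R.* den y)
      R≈.∎

  *-cong : ∀ {x x′ y y′} → x ≈ x′ → y ≈ y′ → x * y ≈ x′ * y′
  *-cong {x} {x′} {y} {y′} e e′ .cross = R≈.begin
    num x R.* num y R.* (den x′ R.* den y′)
      R≈.≈⟨ solve 4 (λ a b c d → a :* b :* (c :* d) := a :* c :* (b :* d)) R.refl _ _ _ _ ⟩
    num x R.* den x′ R.* (num y R.* den y′)
      R≈.≈⟨ R.*-cong (cross e) (cross e′) ⟩
    num x′ R.* den x R.* (num y′ R.* den y)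
      R≈.≈⟨ solve 4 (λ a b c d → a :* b :* (c :* d) := a :* c :* (b :* d)) R.refl _ _ _ _ ⟩
    num x′ R.* num y′ R.* (den x R.* den y)
      R≈.∎

  neg-cong : ∀ {x x′} → x ≈ x′ → - x ≈ - x′
  neg-cong {x} {x′} e .cross = R≈.begin
    R.- num x R.* den x′     R≈.≈⟨ -‿distribˡ-* _ _ ⟨
    R.- (num x R.* den x′)   R≈.≈⟨ R.-‿cong (cross e) ⟩
    R.- (num x′ R.* den x)   R≈.≈⟨ -‿distribˡ-* _ _ ⟩
    R.- num x′ R.* den x     R≈.∎

  +-comm : ∀ x y → x + y ≈ y + x
  +-comm x y .cross =
    solve 4 (λ a b c d → (a :* d :+ c :* b) :* (d :* b) := (c :* b :+ a :* d) :* (b :* d))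
      R.refl (num x) (den x) (num y) (den y)

  +-assoc : ∀ x y z → (x + y) + z ≈ x + (y + z)
  +-assoc x y z .cross =
    solve 6 (λ a b c d e f → ((a :* d :+ c :* b) :* f :+ e :* (b :* d)) :* (b :* (d :* f))
                          := (a :* (d :* f) :+ (c :* f :+ e :* d) :* b) :* (b :* d :* f))
      R.refl (num x) (den x) (num y) (den y) (num z) (den z)

  +-identityˡ : ∀ x → fromRing R.0# + x ≈ x
  +-identityˡ x .cross = R.*-cong
    (R.trans (R.+-cong (R.zeroˡ _) (R.*-identityʳ _)) (R.+-identityˡ _))
    (R.sym (R.*-identityˡ _))

  neg-inverseˡ : ∀ x → - x + x ≈ fromRing R.0#
  neg-inverseˡ x .cross = R≈.begin
    (R.- num x R.* den x R.+ num x R.* den x) R.* R.1#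
      R≈.≈⟨ R.*-identityʳ _ ⟩
    R.- num x R.* den x R.+ num x R.* den x
      R≈.≈⟨ R.+-congʳ (-‿distribˡ-* _ _) ⟨
    R.- (num x R.* den x) R.+ num x R.* den x
      R≈.≈⟨ R.-‿inverseˡ _ ⟩
    R.0#
      R≈.≈⟨ R.zeroˡ _ ⟨
    R.0# R.* (den x R.* den x)
      R≈.∎

  *-comm : ∀ x y → x * y ≈ y * x
  *-comm x y .cross = R.*-cong (R.*-comm _ _) (R.*-comm _ _)

  *-assoc : ∀ x y z → (x * y) * z ≈ x * (y * z)
  *-assoc x y z .cross = R.*-cong (R.*-assoc _ _ _) (R.sym (R.*-assoc _ _ _))

  *-identityˡ : ∀ x → fromRing R.1# * x ≈ x
  *-identityˡ x .cross = R.*-cong (R.*-identityˡ _) (R.sym (R.*-identityˡ _))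

  distribˡ : ∀ x y z → x * (y + z) ≈ x * y + x * z
  distribˡ x y z .cross =
    solve 6 (λ a b c d e f → a :* (c :* f :+ e :* d) :* (b :* d :* (b :* f))
                          := (a :* c :* (b :* f) :+ a :* e :* (b :* d)) :* (b :* (d :* f)))
      R.refl (num x) (den x) (num y) (den y) (num z) (den z)

  abstract
    isCommutativeRing : IsCommutativeRing _≈_ _+_ _*_ -_ (fromRing R.0#) (fromRing R.1#)
    isCommutativeRing = record
      { isRing = record
        { +-isAbelianGroup = record
          { isGroup = record
            { isMonoid = record
              { isSemigroup = record
                { isMagma = record
                  { isEquivalence = record { refl = ≈-refl ; sym = ≈-sym ; trans = ≈-trans }
                  ; ∙-cong = +-cong }
                ; assoc = +-assoc }
              ; identity = +-identityˡ , (λ x → ≈-trans (+-comm x (fromRing R.0#)) (+-identityˡ x)) }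
            ; inverse = neg-inverseˡ , (λ x → ≈-trans (+-comm x (- x)) (neg-inverseˡ x))
            ; ⁻¹-cong = neg-cong }
          ; comm = +-comm }
        ; *-cong = *-cong
        ; *-assoc = *-assoc
        ; *-identity = *-identityˡ , (λ x → ≈-trans (*-comm x (fromRing R.1#)) (*-identityˡ x))
        ; distrib = distribˡ , (λ x y z → ≈-trans (*-comm (y + z) x)
            (≈-trans (distribˡ x y z) (+-cong (*-comm x y) (*-comm x z)))) }
      ; *-comm = *-comm }

  fractionField : CommutativeRing (c ⊔ ℓ) ℓ
  fractionField = record
    { Carrier = Fraction ; _≈_ = _≈_ ; _+_ = _+_ ; _*_ = _*_ ; -_ = -_
    ; 0# = fromRing R.0# ; 1# = fromRing R.1#
    ; isCommutativeRing = isCommutativeRing }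

  *-inverse : ∀ x → ¬ (x ≈ fromRing R.0#) → ∃ λ y → x * y ≈ fromRing R.1#
  *-inverse x x≉0 = (den x / num x ⟨ num≉0 ⟩) , mk≈ (R≈.begin
    num x R.* den x R.* R.1#      R≈.≈⟨ R.*-comm _ _ ⟩
    R.1# R.* (num x R.* den x)    R≈.≈⟨ R.*-congˡ (R.*-comm _ _) ⟩
    R.1# R.* (den x R.* num x)    R≈.∎)
    where
    num≉0 : num x R.≉ R.0#
    num≉0 e = x≉0 (mk≈ (R.trans (R.*-identityʳ _) (R.trans e (R.sym (R.zeroˡ _)))))

abstract
  ℚ-isCommutativeRing : IsCommutativeRing _≡_ ℚ._+_ ℚ._*_ ℚ.-_ 0ℚ 1ℚ
  ℚ-isCommutativeRing = ℚ.+-*-isCommutativeRing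

  1ℚ≢0ℚ : 1ℚ ≢ 0ℚ
  1ℚ≢0ℚ ()

  ℚ-x*y≢0 : ∀ x y → x ≢ 0ℚ → y ≢ 0ℚ → x ℚ.* y ≢ 0ℚ
  ℚ-x*y≢0 x y x≢0 y≢0 xy≡0 = x≢0 (begin
    x                               ≡⟨ ℚ.*-identityʳ x ⟨
    x ℚ.* 1ℚ                        ≡⟨ cong (x ℚ.*_) (ℚ.*-inverseʳ y {{y≠0}}) ⟨
    x ℚ.* (y ℚ.* (ℚ.1/ y) {{y≠0}})  ≡⟨ ℚ.*-assoc x y _ ⟨
    x ℚ.* y ℚ.* (ℚ.1/ y) {{y≠0}}    ≡⟨ cong (ℚ._* (ℚ.1/ y) {{y≠0}}) xy≡0 ⟩
    0ℚ ℚ.* (ℚ.1/ y) {{y≠0}}         ≡⟨ ℚ.*-zeroˡ ((ℚ.1/ y) {{y≠0}}) ⟩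
    0ℚ                              ∎)
    where
    open ≡.≡-Reasoning
    y≠0 : ℚ.NonZero y
    y≠0 = ℚ.≢-nonZero y≢0

ℚ-domain : IntegralDomain 0ℓ 0ℓ
ℚ-domain = record
  { commutativeRing = record { isCommutativeRing = ℚ-isCommutativeRing }
  ; _≈0?  = ℚ._≟ 0ℚ
  ; 1≉0   = 1ℚ≢0ℚ
  ; x*y≉0 = λ {x} {y} → ℚ-x*y≢0 x y }

module ℚ[q] = Polynomial ℚ-domain
module ℚ[q,t] = Polynomial ℚ[q].polynomialDomain
module ℚ⟨q,t⟩ = FractionField ℚ[q,t].polynomialDomain
open ℚ⟨q,t⟩ public using (_/_⟨_⟩)

ℚ[q,t]-ring ℚ⟨q,t⟩-field : CommutativeRing 0ℓ 0ℓ
ℚ[q,t]-ring   = ℚ[q,t].polynomialRing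
ℚ⟨q,t⟩-field = ℚ⟨q,t⟩.fractionField

module 𝕂 = CommutativeRing ℚ⟨q,t⟩-field

𝕂 : Set
𝕂 = 𝕂.Carrier

open Exp 𝕂.semiring public using (_^_)

∑ ∏ : List 𝕂 → 𝕂
∑ = List.foldr 𝕂._+_ 𝕂.0#
∏ = List.foldr 𝕂._*_ 𝕂.1#

private
  module A = CommutativeRing ℚ[q,t]-ring
  module A^ = Exp A.semiring

qₚ tₚ : A.Carrier
qₚ = ℚ[q,t].constant ℚ[q].X
tₚ = ℚ[q,t].X

q t : 𝕂
q = ℚ⟨q,t⟩.fromRing qₚ
t = ℚ⟨q,t⟩.fromRing tₚ

1-q^_t^_ : ℕ → ℕ → A.Carrier
1-q^ a t^ b = A.1# A.- (qₚ A^.^ a) A.* (tₚ A^.^ b)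

private
  constantTerm : A.Carrier → ℚ
  constantTerm p = ℚ[q].coeff (ℚ[q,t].coeff p 0) 0

  constantTerm-cong : ∀ {p r} → p A.≈ r → constantTerm p ≡ constantTerm r
  constantTerm-cong e = ℚ[q].at (ℚ[q,t].at e 0) 0

  constantTerm-* : ∀ p r → constantTerm (p A.* r) ≡ constantTerm p ℚ.* constantTerm r
  constantTerm-* p r = ≡.trans
    (ℚ[q].at (ℚ[q,t].coeff₀-* p r) 0)
    (ℚ[q].coeff₀-* (ℚ[q,t].coeff p 0) (ℚ[q,t].coeff r 0))

  constantTerm-1- : ∀ p → constantTerm (A.1# A.- p) ≡ 1ℚ ℚ.- constantTerm p
  constantTerm-1- p = begin
    constantTerm (A.1# A.- p)
      ≡⟨ ℚ[q].at (ℚ[q,t].coeff-+ A.1# (A.- p) 0) 0 ⟩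
    ℚ[q].coeff (ℚ[q,t].coeff A.1# 0 ℚ[q].+ ℚ[q,t].coeff (A.- p) 0) 0
      ≡⟨ ℚ[q].coeff-+ (ℚ[q,t].coeff A.1# 0) (ℚ[q,t].coeff (A.- p) 0) 0 ⟩
    1ℚ ℚ.+ constantTerm (A.- p)
      ≡⟨ cong (1ℚ ℚ.+_) (ℚ[q].at (ℚ[q,t].coeff-neg p 0) 0) ⟩
    1ℚ ℚ.+ ℚ[q].coeff (ℚ[q].- (ℚ[q,t].coeff p 0)) 0
      ≡⟨ cong (1ℚ ℚ.+_) (ℚ[q].coeff-neg (ℚ[q,t].coeff p 0) 0) ⟩
    1ℚ ℚ.- constantTerm p
      ∎
    where open ≡.≡-Reasoning

abstract
  1-q^t^≉0 : ∀ a b → 1-q^ suc a t^ b A.≉ A.0#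
  1-q^t^≉0 a b e = 1ℚ≢0ℚ 1≡0
    where
    open ≡.≡-Reasoning
    y z : A.Carrier
    y = qₚ A^.^ a
    z = (qₚ A.* y) A.* (tₚ A^.^ b)
    z≡0 : constantTerm z ≡ 0ℚ
    z≡0 = begin
      constantTerm z
        ≡⟨ constantTerm-* (qₚ A.* y) (tₚ A^.^ b) ⟩
      constantTerm (qₚ A.* y) ℚ.* constantTerm (tₚ A^.^ b)
        ≡⟨ cong (ℚ._* constantTerm (tₚ A^.^ b)) (constantTerm-* qₚ y) ⟩
      0ℚ ℚ.* constantTerm y ℚ.* constantTerm (tₚ A^.^ b)
        ≡⟨ cong (ℚ._* constantTerm (tₚ A^.^ b)) (ℚ.*-zeroˡ (constantTerm y)) ⟩
      0ℚ ℚ.* constantTerm (tₚ A^.^ b)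
        ≡⟨ ℚ.*-zeroˡ (constantTerm (tₚ A^.^ b)) ⟩
      0ℚ
        ∎
    1≡0 : 1ℚ ≡ 0ℚ
    1≡0 = begin
      1ℚ ℚ.- 0ℚ                ≡⟨ cong (λ x → 1ℚ ℚ.- x) z≡0 ⟨
      1ℚ ℚ.- constantTerm z    ≡⟨ constantTerm-1- z ⟨
      constantTerm (A.1# A.- z)  ≡⟨ constantTerm-cong e ⟩
      0ℚ                         ∎

record Enumeration (A : Set) : Set where
  field
    elements : List A
    complete : ∀ x → x ∈ elements
    unique   : Unique elements
open Enumeration public

∑[_] : {A : Set} → Enumeration A → (A → 𝕂) → 𝕂
∑[ 𝐀 ] f = ∑ (List.map f (elements 𝐀))

record IsProbabilisticBijection {𝐓 𝐔 : Set} (enum𝐓 : Enumeration 𝐓) (enum𝐔 : Enumeration 𝐔)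
  (wt𝐓 : 𝐓 → 𝕂) (wt𝐔 : 𝐔 → 𝕂) (P𝐓 : 𝐓 → 𝐔 → 𝕂) (P𝐔 : 𝐔 → 𝐓 → 𝕂) : Set where
  field
    ∑P𝐓≈1    : ∀ T → ∑[ enum𝐔 ] (P𝐓 T) 𝕂.≈ 𝕂.1#
    ∑P𝐔≈1    : ∀ U → ∑[ enum𝐓 ] (P𝐔 U) 𝕂.≈ 𝕂.1#
    balanced : ∀ T U → wt𝐓 T 𝕂.* P𝐓 T U 𝕂.≈ wt𝐔 U 𝕂.* P𝐔 U T

enumerateFin : ∀ n → Enumeration (Fin n)
enumerateFin n = record
  { elements = allFin n ; complete = ∈-allFin ; unique = Unique.allFin⁺ n }

enumerateSingleton : {A : Set} (a : A) → (∀ x → x ≡ a) → Enumeration A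
enumerateSingleton a only = record
  { elements = a ∷ [] ; complete = λ x → here (only x) ; unique = ListAll.[] ∷ [] }

enumerateProduct : {A B C : Set} → Enumeration A → Enumeration B → (f : A → B → C) →
                   (∀ {w x y z} → f w y ≡ f x z → w ≡ x × y ≡ z) →
                   (∀ c → ∃ λ a → ∃ λ b → c ≡ f a b) → Enumeration C
enumerateProduct 𝐀 𝐁 f injective surjective = record
  { elements = cartesianProductWith f (elements 𝐀) (elements 𝐁)
  ; complete = λ c → let a , b , c≡fab = surjective c in
      ≡.subst (_∈ _) (≡.sym c≡fab) (∈-cartesianProductWith⁺ f (complete 𝐀 a) (complete 𝐁 b))
  ; unique   = Unique.cartesianProductWith⁺ f injective (unique 𝐀) (unique 𝐁) }

module _ {A : Set} {P : Pred A 0ℓ} (P? : Decidable P) where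

  restrict : List A → List (Refinement A P)
  restrict []       = []
  restrict (x ∷ xs) with P? x
  ... | yes p = (x Refinement., [ p ]) ∷ restrict xs
  ... | no  _ = restrict xs

  ∈-restrict⁺ : ∀ {xs} (y : Refinement A P) → value y ∈ xs → y ∈ restrict xs
  ∈-restrict⁺ {x ∷ xs} (y Refinement., [ p ]) (here refl) with P? x
  ... | yes _ = here refl
  ... | no ¬p = ⊥-elim-irr (¬p p)
  ∈-restrict⁺ {x ∷ xs} y (there y∈xs) with P? x
  ... | yes _ = there (∈-restrict⁺ y y∈xs)
  ... | no  _ = ∈-restrict⁺ y y∈xs

  ∈-restrict⁻ : ∀ xs {y : Refinement A P} → y ∈ restrict xs → value y ∈ xs
  ∈-restrict⁻ (x ∷ xs) y∈ with P? x
  ∈-restrict⁻ (x ∷ xs) (here refl) | yes _ = here refl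
  ∈-restrict⁻ (x ∷ xs) (there y∈)  | yes _ = there (∈-restrict⁻ xs y∈)
  ∈-restrict⁻ (x ∷ xs) y∈          | no  _ = there (∈-restrict⁻ xs y∈)

  restrict-unique : ∀ {xs} → Unique xs → Unique (restrict xs)
  restrict-unique {[]}     []            = []
  restrict-unique {x ∷ xs} (x∉xs ∷ xs!) with P? x
  ... | yes _ = ListAll.tabulate (λ y∈ x≡y → ListAll.lookup x∉xs (∈-restrict⁻ xs y∈) (cong value x≡y))
              ∷ restrict-unique xs!
  ... | no  _ = restrict-unique xs!

enumerateRefinement : {A : Set} {P : Pred A 0ℓ} → Enumeration A → Decidable P → Enumeration (Refinement A P)
enumerateRefinement 𝐀 P? = record
  { elements = restrict P? (elements 𝐀)
  ; complete = λ y → ∈-restrict⁺ P? y (complete 𝐀 (value y))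
  ; unique   = restrict-unique P? (unique 𝐀) }

-- The columns, entries and positions 1, …, n are represented by Fin n, so that
-- i : Fin n stands for toℕ i + 1. Rows are natural numbers, with row 0 the
-- basement, exactly as in adg(α).

record Box {n : ℕ} (α : Vec ℕ n) : Set where
  constructor box
  field
    col  : Fin n
    row  : ℕ
    .row≤ : row ≤ Vec.lookup α col
open Box public

-- A filling is stored as the tuple of its columns, read upwards from the
-- basement, so that equality of fillings is propositional equality.

Column : ℕ → ℕ → Set
Column n a = Vec (Fin n) (suc a)

Filling : {n : ℕ} → Vec ℕ n → Set
Filling {n} α = VecAll.All (Column n) α

module _ {n : ℕ} {α : Vec ℕ n} where

  infix 10 _⟦_⟧
  _⟦_⟧ : Filling α → Box α → Fin n
  T ⟦ box j r r≤ ⟧ = Vec.lookup (lookup⁺ T j) (fromℕ< (s≤s r≤))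

  tabulate : (Box α → Fin n) → Filling α
  tabulate f = lookup⁻ (λ j → Vec.tabulate (λ k → f (box j (toℕ k) (Fin.toℕ≤pred[n] k))))

private
  lookup⁺∘lookup⁻ : ∀ {n k} {α : Vec ℕ k} (f : ∀ j → Column n (Vec.lookup α j)) j →
                    lookup⁺ {P = Column n} {xs = α} (lookup⁻ f) j ≡ f j
  lookup⁺∘lookup⁻ {α = a ∷ α} f Fin.zero    = refl
  lookup⁺∘lookup⁻ {α = a ∷ α} f (Fin.suc j) = lookup⁺∘lookup⁻ {α = α} (λ j → f (Fin.suc j)) j

  lookup⁺-injective : ∀ {n k} {α : Vec ℕ k} {T U : VecAll.All (Column n) α} →
                      (∀ j → lookup⁺ T j ≡ lookup⁺ U j) → T ≡ U
  lookup⁺-injective {T = []}    {[]}    e = refl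
  lookup⁺-injective {T = c ∷ T} {d ∷ U} e = cong₂ _∷_ (e Fin.zero) (lookup⁺-injective (λ j → e (Fin.suc j)))

  lookup-injective : ∀ {A : Set} {k} {xs ys : Vec A k} → Vec.lookup xs ≗ Vec.lookup ys → xs ≡ ys
  lookup-injective {xs = []}     {[]}     e = refl
  lookup-injective {xs = x ∷ xs} {y ∷ ys} e = cong₂ _∷_ (e Fin.zero) (lookup-injective (λ j → e (Fin.suc j)))

module _ {n : ℕ} {α : Vec ℕ n} where

  box-cong : ∀ {j r s} .{r≤ : r ≤ Vec.lookup α j} .{s≤ : s ≤ Vec.lookup α j} → r ≡ s →
             box {α = α} j r r≤ ≡ box j s s≤
  box-cong refl = refl

  tabulate-⟦⟧ : ∀ (f : Box α → Fin n) u → tabulate f ⟦ u ⟧ ≡ f u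
  tabulate-⟦⟧ f (box j r r≤) = begin
    Vec.lookup (lookup⁺ (tabulate f) j) (fromℕ< (s≤s r≤))
      ≡⟨ cong (λ c → Vec.lookup c (fromℕ< (s≤s r≤))) (lookup⁺∘lookup⁻ {α = α} (λ j → Vec.tabulate (entry j)) j) ⟩
    Vec.lookup (Vec.tabulate (entry j)) (fromℕ< (s≤s r≤))
      ≡⟨ Vec.lookup∘tabulate (entry j) (fromℕ< (s≤s r≤)) ⟩
    f (box j (toℕ (fromℕ< (s≤s r≤))) _)
      ≡⟨ cong f (box-cong (Fin.toℕ-fromℕ< (s≤s r≤))) ⟩
    f (box j r r≤)
      ∎
    where
    open ≡.≡-Reasoning
    entry : ∀ j → Fin (suc (Vec.lookup α j)) → Fin n
    entry j k = f (box j (toℕ k) (Fin.toℕ≤pred[n] k))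

  filling-ext : ∀ {T U : Filling α} → (∀ u → T ⟦ u ⟧ ≡ U ⟦ u ⟧) → T ≡ U
  filling-ext {T} {U} e = lookup⁺-injective (λ j → lookup-injective (λ k →
    ≡.subst (λ k → Vec.lookup (lookup⁺ T j) k ≡ Vec.lookup (lookup⁺ U j) k)
      (Fin.fromℕ<-toℕ k (s≤s (Fin.toℕ≤pred[n] k)))
      (e (box j (toℕ k) (Fin.toℕ≤pred[n] k)))))

_≟ᶠ_ : ∀ {n k} {α : Vec ℕ k} → DecidableEquality (VecAll.All (Column n) α)
[]      ≟ᶠ []      = yes refl
(c ∷ T) ≟ᶠ (d ∷ U) = map′ (uncurry (cong₂ _∷_)) (λ { refl → refl , refl })
                          (Vec.≡-dec Fin._≟_ c d ×-dec T ≟ᶠ U)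

enumerateVec : ∀ n k → Enumeration (Vec (Fin n) k)
enumerateVec n zero    = enumerateSingleton [] (λ { [] → refl })
enumerateVec n (suc k) = enumerateProduct (enumerateFin n) (enumerateVec n k) _∷_
  (λ { refl → refl , refl }) (λ { (x ∷ xs) → x , xs , refl })

enumerateFilling : ∀ {n k} (α : Vec ℕ k) → Enumeration (VecAll.All (Column n) α)
enumerateFilling     []      = enumerateSingleton [] (λ { [] → refl })
enumerateFilling {n} (a ∷ α) = enumerateProduct (enumerateVec n (suc a)) (enumerateFilling α) _∷_
  (λ { refl → refl , refl }) (λ { (c ∷ T) → c , T , refl })

module _ {n : ℕ} (α : Vec ℕ n) where

  column : ∀ j → List (Box α)
  column j = List.map (λ k → box j (toℕ k) (Fin.toℕ≤pred[n] k)) (allFin (suc (Vec.lookup α j)))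

  adg : List (Box α)
  adg = List.concatMap column (allFin n)

  dg : List (Box α)
  dg = filter (λ u → 1 ℕ.≤? row u) adg

  ∈-adg : ∀ u → u ∈ adg
  ∈-adg (box j r r≤) = ∈-concat⁺′
    (≡.subst (_∈ column j) (box-cong (Fin.toℕ-fromℕ< (s≤s r≤)))
      (∈-map⁺ (λ k → box j (toℕ k) (Fin.toℕ≤pred[n] k)) (∈-allFin (fromℕ< (s≤s r≤)))))
    (∈-map⁺ column (∈-allFin j))

  all-boxes? : {P : Pred (Box α) 0ℓ} → Decidable P → Dec (∀ u → P u)
  all-boxes? P? = map′ (λ Ps u → ListAll.lookup Ps (∈-adg u)) (λ Ps → ListAll.tabulate (λ {u} _ → Ps u))
                       (ListAll.all? P? adg)

module _ {n : ℕ} {α : Vec ℕ n} where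

  -- Only meaningful for boxes of dg(α): a basement box is sent to itself.
  south : Box α → Box α
  south (box j r r≤) = box j (pred r) (ℕ.≤-trans ℕ.pred[n]≤n r≤)

  leg : Box α → ℕ
  leg u = Vec.lookup α (col u) ∸ row u

  InLeftArm InRightArm InArm : Box α → Box α → Set
  InLeftArm u v =
    suc (row v) ≡ row u × col v Fin.< col u × Vec.lookup α (col v) < Vec.lookup α (col u)
  InRightArm u v =
    row v ≡ row u × col u Fin.< col v × Vec.lookup α (col v) ≤ Vec.lookup α (col u)
  InArm u v = InLeftArm u v ⊎ InRightArm u v

  inArm? : ∀ u → Decidable (InArm u)
  inArm? u v =
    (suc (row v) ℕ.≟ row u ×-dec col v Fin.<? col u ×-dec Vec.lookup α (col v) ℕ.<? Vec.lookup α (col u))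
    ⊎-dec
    (row v ℕ.≟ row u ×-dec col u Fin.<? col v ×-dec Vec.lookup α (col v) ℕ.≤? Vec.lookup α (col u))

  Arm : Box α → List (Box α)
  Arm u = filter (inArm? u) (adg α)

  arm : Box α → ℕ
  arm u = length (Arm u)

  SameRow HigherRight Attacking : Box α → Box α → Set
  SameRow u v     = row u ≡ row v × col u ≢ col v
  HigherRight u v = row u ≡ suc (row v) × col v Fin.< col u
  Attacking u v   = SameRow u v ⊎ HigherRight u v ⊎ HigherRight v u

  attacking? : ∀ u v → Dec (Attacking u v)
  attacking? u v = (row u ℕ.≟ row v ×-dec ¬? (col u Fin.≟ col v))
             ⊎-dec higherRight? u v ⊎-dec higherRight? v u
    where
    higherRight? : ∀ u v → Dec (HigherRight u v)
    higherRight? u v = row u ℕ.≟ suc (row v) ×-dec col v Fin.<? col u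

  NonAttacking : Filling α → Set
  NonAttacking T = ∀ u v → Attacking u v → T ⟦ u ⟧ ≢ T ⟦ v ⟧

  nonAttacking? : Decidable NonAttacking
  nonAttacking? T = all-boxes? α (λ u → all-boxes? α (λ v →
    attacking? u v →-dec ¬? (T ⟦ u ⟧ Fin.≟ T ⟦ v ⟧)))

  HasBasement : Permutation′ n → Filling α → Set
  HasBasement τ T = ∀ j → T ⟦ box j 0 z≤n ⟧ ≡ τ ⟨$⟩ʳ j

  hasBasement? : ∀ τ → Decidable (HasBasement τ)
  hasBasement? τ T = Fin.all? (λ j → T ⟦ box j 0 z≤n ⟧ Fin.≟ τ ⟨$⟩ʳ j)

NAF : {n : ℕ} → Vec ℕ n → Permutation′ n → Set
NAF α τ = Refinement (Filling α) (λ T → HasBasement τ T × NonAttacking T)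

enumerateNAF : {n : ℕ} (α : Vec ℕ n) (τ : Permutation′ n) → Enumeration (NAF α τ)
enumerateNAF α τ = enumerateRefinement (enumerateFilling α) (λ T → hasBasement? τ T ×-dec nonAttacking? T)

χ : {n : ℕ} → Fin n → Fin n → ℕ
χ a b = if does (b Fin.<? a) then 1 else 0

-- Always 0 or 1: a > c forces a > b or b > c, so the subtraction never truncates.
χ₃ : {n : ℕ} → Fin n → Fin n → Fin n → ℕ
χ₃ a b c = (χ a b ℕ.+ χ b c) ∸ χ a c

module _ {n : ℕ} {α : Vec ℕ n} where

  maj : Filling α → ℕ
  maj T = sum (List.map (λ u → leg u ℕ.+ 1) (filter (λ u → T ⟦ south u ⟧ Fin.<? T ⟦ u ⟧) (dg α)))

  coinv : Filling α → ℕ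
  coinv T = sum (List.map coinversionsAt (dg α))
    where
    coinversionsAt : Box α → ℕ
    coinversionsAt u = length (filter (λ v → ¬? (χ₃ (T ⟦ u ⟧) (T ⟦ v ⟧) (T ⟦ south u ⟧) ℕ.≟ 1)) (Arm u))

  wt : Filling α → 𝕂
  wt T = q ^ maj T 𝕂.* t ^ coinv T 𝕂.*
    ∏ (List.map factor (filter (λ u → ¬? (T ⟦ u ⟧ Fin.≟ T ⟦ south u ⟧)) (dg α)))
    where
    factor : Box α → 𝕂
    factor u = (A.1# A.- tₚ) / (1-q^ suc (leg u) t^ suc (arm u)) ⟨ 1-q^t^≉0 (leg u) (suc (arm u)) ⟩

sᵢ : {m : ℕ} → Fin m → Permutation′ (suc m)
sᵢ i = Perm.transpose (inject₁ i) (Fin.suc i)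

-- ∘ₚ composes from left to right, so (σ ·s i) ⟨$⟩ʳ j = σ ⟨$⟩ʳ (sᵢ i ⟨$⟩ʳ j): positions are exchanged.
_·s_ : {m : ℕ} → Permutation′ (suc m) → Fin m → Permutation′ (suc m)
σ ·s i = sᵢ i ∘ₚ σ

armLegRatio : (A ℓ : ℕ) → 𝕂
armLegRatio A ℓ = (1-q^ suc ℓ t^ suc A) / (1-q^ suc ℓ t^ suc (suc A)) ⟨ 1-q^t^≉0 ℓ (suc (suc A)) ⟩

-- The value of ρ_r with a, b the entries in row r and c, d those in row r + 1.
-- For a non-attacking filling a ≠ b, c ≠ d and a ≠ d, so the only possible
-- coincidences are a = c, b = d and b = c, and the last excludes the other two.
-- If all four are distinct then χ₃ d c b = 1 - χ₃ c d b, so χ₃ c d a equals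
-- either χ₃ c d b (value 0) or χ₃ d c b (value 1).
rate : {n : ℕ} (a b c d : Fin n) (A ℓ : ℕ) → 𝕂
rate a b c d A ℓ with a Fin.≟ c | b Fin.≟ d | b Fin.≟ c
... | yes _ | yes _ | _     = 𝕂.1#
... | yes _ | no  _ | _     = t ^ (1 ∸ χ₃ d a b) 𝕂.* armLegRatio A ℓ
... | no  _ | yes _ | _     = 𝕂.1#
... | no  _ | no  _ | yes _ = 𝕂.0#
... | no  _ | no  _ | no  _ = if does (χ₃ c d a ℕ.≟ χ₃ c d b) then 𝕂.0# else 𝕂.1#

module Swapping {m : ℕ} (α : Vec ℕ (suc m)) (i : Fin m)
  (αᵢ≡αᵢ₊₁ : Vec.lookup α (inject₁ i) ≡ Vec.lookup α (Fin.suc i)) where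

  αᵢ : ℕ
  αᵢ = Vec.lookup α (inject₁ i)

  lookup-sᵢ : ∀ j → Vec.lookup α (sᵢ i ⟨$⟩ʳ j) ≡ Vec.lookup α j
  lookup-sᵢ j with j Fin.≟ inject₁ i
  ... | yes refl = ≡.sym αᵢ≡αᵢ₊₁
  ... | no  _ with j Fin.≟ Fin.suc i
  ...   | yes refl = αᵢ≡αᵢ₊₁
  ...   | no  _    = refl

  swapBox : ℕ → Box α → Box α
  swapBox r u@(box j r′ r′≤) with r′ ℕ.≟ r
  ... | yes _ = box (sᵢ i ⟨$⟩ʳ j) r′ (ℕ.≤-trans r′≤ (ℕ.≤-reflexive (≡.sym (lookup-sᵢ j))))
  ... | no  _ = u

  swap : ℕ → Filling α → Filling α
  swap r T = tabulate (λ u → T ⟦ swapBox r u ⟧)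

  Ω₀ : ℕ → Filling α → Filling α
  Ω₀ zero    T = swap 0 T
  Ω₀ (suc h) T = swap (suc h) (Ω₀ h T)

  leftBox rightBox : (r : ℕ) → .(r ≤ αᵢ) → Box α
  leftBox  r r≤ = box (inject₁ i) r r≤
  rightBox r r≤ = box (Fin.suc i) r (ℕ.≤-trans r≤ (ℕ.≤-reflexive αᵢ≡αᵢ₊₁))

  -- The last clause is the convention ρ_{αᵢ} = 0; no row above αᵢ is ever used.
  ρ : Filling α → ℕ → 𝕂
  ρ T r with r ℕ.<? αᵢ
  ... | yes r<αᵢ = rate
    (T ⟦ leftBox r (ℕ.<⇒≤ r<αᵢ) ⟧) (T ⟦ rightBox r (ℕ.<⇒≤ r<αᵢ) ⟧)
    (T ⟦ leftBox (suc r) r<αᵢ ⟧) (T ⟦ rightBox (suc r) r<αᵢ ⟧)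
    (arm (rightBox (suc r) r<αᵢ)) (leg (rightBox (suc r) r<αᵢ))
  ... | no  _    = 𝕂.0#

  -- The fillings Ω₀ h T with 0 ≤ h ≤ αᵢ have basement τ ·s i, and as T is
  -- non-attacking they are distinct (the two entries exchanged in each row
  -- differ), so at most one h is found below.
  P : {τ : Permutation′ (suc m)} → NAF α τ → Filling α → 𝕂
  P T U with ℕ.anyUpTo? (λ h → U ≟ᶠ Ω₀ h (value T)) (suc αᵢ)
  ... | yes (h , _) = ∏ (List.map (ρ (value T)) (upTo h)) 𝕂.* (𝕂.1# 𝕂.- ρ (value T) h)
  ... | no  _       = 𝕂.0#

{-# OPTIONS --safe #-}

-- Let U = Ω₀ h T with T and U non-attacking. The weight is a product over the
-- boxes of dg(α). A box outside columns i and i+1 contributes equally to T and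
-- U, as its arm contains both or neither of the two boxes exchanged in a row.
-- The two boxes of columns i and i+1 in row k + 1 have a joint contribution that
-- depends on their entries c, d, on the entries a, b below them, and on their
-- common arm; summing χ(c,v,a) + χ(d,v,b) over that arm, the terms involving v
-- are symmetric in a and b, so exchanging a and b changes the sum by a multiple
-- of the size of the arm. Hence the balance equation splits into one identity
-- per row: for k < h both rows are exchanged and the factor is ρ_k, for k = h
-- only the lower one is and the factor is 1 - ρ_h, and above nothing changes.
-- The probabilities add up to 1 by telescoping, and a summand for which Ω₀ h T
-- is attacking vanishes: either some ρ_k with k < h is 0, or ρ_h is 1.

module Submission where

open import Defs hiding (_^_; q; t; 1-q^t^≉0; _/_⟨_⟩; rate)
open import Level using (_⊔_)
open import Algebra.Bundles using (CommutativeMonoid; CommutativeRing)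
import Algebra.Properties.CommutativeSemigroup as CommutativeSemigroupProperties
import Algebra.Properties.Group as GroupProperties
import Algebra.Properties.Ring as RingProperties
import Algebra.Properties.Semiring.Exp as Exp
import Algebra.Solver.Ring.NaturalCoefficients.Default as NaturalSolver
open import Data.Bool.Base using (if_then_else_; true; false)
open import Data.Empty using (⊥; ⊥-elim)
open import Data.Fin.Base as Fin using (Fin; toℕ; inject₁; fromℕ<)
import Data.Fin.Properties as Fin
open import Data.Fin.Permutation using (Permutation′; _⟨$⟩ʳ_)
open import Data.Irrelevant using ([_])
open import Data.List.Base as List using (List; []; _∷_; _++_; map; filter; foldr; length; allFin; upTo; applyUpTo)
import Data.List.Properties as List
open import Data.List.Membership.Propositional using (_∈_)
open import Data.List.Membership.Propositional.Properties
  using (∈-map⁺; ∈-map⁻; ∈-filter⁺; ∈-filter⁻; ∈-++⁺ˡ; ∈-++⁺ʳ; ∈-++⁻; ∈-allFin; ∈-upTo⁺; ∈-upTo⁻)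
open import Data.List.Membership.Propositional.Properties.WithK using (unique∧set⇒bag)
open import Data.List.Relation.Binary.BagAndSetEquality using (∼bag⇒↭)
open import Data.List.Relation.Binary.Permutation.Propositional as ↭ using (_↭_)
open import Data.List.Relation.Binary.Permutation.Propositional.Properties using (↭-length)
open import Data.List.Relation.Unary.All as All using ([]; _∷_)
import Data.List.Relation.Unary.All.Properties as All
open import Data.List.Relation.Unary.AllPairs as AllPairs using ([]; _∷_)
import Data.List.Relation.Unary.AllPairs.Properties as AllPairs
open import Data.List.Relation.Unary.Any using (here; there)
open import Data.List.Relation.Unary.Unique.Propositional using (Unique)
import Data.List.Relation.Unary.Unique.Propositional.Properties as Unique
open import Data.Nat.Base as ℕ using (ℕ; zero; suc; _∸_; _≤_; _<_; z≤n; s≤s)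
import Data.Nat.Properties as ℕ
open import Data.Nat.Solver using (module +-*-Solver)
open import Data.Product.Base using (∃; _×_; _,_; proj₁; proj₂)
open import Data.Refinement.Base as Refinement using (value)
open import Data.Sum.Base using (_⊎_; inj₁; inj₂; [_,_]′)
open import Data.Vec.Base using (Vec; lookup)
open import Function.Base using (_∘_)
open import Function.Bundles using (mk⇔)
open import Relation.Binary.Definitions using (tri<; tri≈; tri>)
open import Relation.Binary.PropositionalEquality as ≡ using (_≡_; _≢_; refl; cong; cong₂; sym; trans; subst)
import Relation.Binary.Reasoning.Setoid as SetoidReasoning
open import Relation.Nullary.Decidable using (Dec; does; yes; no; ¬?; _×-dec_; map′; recompute; dec-true; dec-false)
open import Relation.Nullary.Negation using (¬_)
open import Relation.Unary using (Pred; Decidable)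

-- Sums over lists

-- The exponents A+1 and A+2 in ρ come from the arms: the right box of a row lies in the arm of the
-- left one and the arms agree otherwise, so a factor with t^(A+1) on the right has a counterpart
-- with t^(A+2) on the left. If a = c and b, d differ, only the right box has such a factor.
-- Exchanging both rows mirrors the block and moves the factor to the left; the ratio in ρ is the
-- quotient of the two factors, and the power of t pays for the triple of the two boxes. Exchanging
-- only the lower row gives both boxes a factor, and 1 - ρ is the new factor times the change of
-- q^maj t^coinv. That U is non-attacking is used as much as that T is: it excludes b = c below row
-- h and b = d at row h, the coincidences at which a factor of the probability is 0. As `Ω₀ h` is an
-- involution, T arises from U with the same h, so both probabilities are products over the same
-- rows. The value 0 of ρ at the top accounts for the row that is missing when h = αᵢ.

cong₅ : ∀ {b} {A : Set} {B : Set b} (f : List A → A → A → A → A → B) {vs vs′ w w′ x x′ y y′ z z′} →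
        vs ≡ vs′ → w ≡ w′ → x ≡ x′ → y ≡ y′ → z ≡ z′ → f vs w x y z ≡ f vs′ w′ x′ y′ z′
cong₅ f refl refl refl refl refl = refl

-- Lets arms and diagrams be compared by membership alone, whatever the order in which they are
-- listed.
unique-↭ : {A : Set} {xs ys : List A} → Unique xs → Unique ys →
           (∀ {x} → x ∈ xs → x ∈ ys) → (∀ {x} → x ∈ ys → x ∈ xs) → xs ↭ ys
unique-↭ xs! ys! f g = ∼bag⇒↭ (unique∧set⇒bag xs! ys! (mk⇔ f g))

-- Serves addition in ℕ (exponents) as well as multiplication (weights) and addition (probabilities)
-- in the ring.
module Fold {c ℓ} (M : CommutativeMonoid c ℓ) where

  open CommutativeMonoid M renaming (refl to ≈-refl; sym to ≈-sym; trans to ≈-trans)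
  open import Algebra.Properties.CommutativeSemigroup commutativeSemigroup using (interchange; x∙yz≈y∙xz)

  module _ {A : Set} where

    ⨁ : List A → (A → Carrier) → Carrier
    ⨁ xs f = foldr _∙_ ε (map f xs)

    ⨁-cong-∈ : ∀ xs {f g : A → Carrier} → (∀ {x} → x ∈ xs → f x ≈ g x) → ⨁ xs f ≈ ⨁ xs g
    ⨁-cong-∈ []       e = ≈-refl
    ⨁-cong-∈ (x ∷ xs) e = ∙-cong (e (here refl)) (⨁-cong-∈ xs (λ x∈ → e (there x∈)))

    ⨁-cong : ∀ xs {f g : A → Carrier} → (∀ x → f x ≈ g x) → ⨁ xs f ≈ ⨁ xs g
    ⨁-cong xs e = ⨁-cong-∈ xs (λ {x} _ → e x)

    ⨁-ε : ∀ xs {f : A → Carrier} → (∀ {x} → x ∈ xs → f x ≈ ε) → ⨁ xs f ≈ ε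
    ⨁-ε []       e = ≈-refl
    ⨁-ε (x ∷ xs) e = ≈-trans (∙-cong (e (here refl)) (⨁-ε xs (λ x∈ → e (there x∈)))) (identityˡ ε)

    ⨁-∙ : ∀ xs (f g : A → Carrier) → ⨁ xs (λ x → f x ∙ g x) ≈ ⨁ xs f ∙ ⨁ xs g
    ⨁-∙ []       f g = ≈-sym (identityˡ ε)
    ⨁-∙ (x ∷ xs) f g = ≈-trans (∙-congˡ (⨁-∙ xs f g)) (interchange _ _ _ _)

    ⨁-++ : ∀ xs ys (f : A → Carrier) → ⨁ (xs ++ ys) f ≈ ⨁ xs f ∙ ⨁ ys f
    ⨁-++ []       ys f = ≈-sym (identityˡ _)
    ⨁-++ (x ∷ xs) ys f = ≈-trans (∙-congˡ (⨁-++ xs ys f)) (≈-sym (assoc _ _ _))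

    ⨁-↭ : ∀ {xs ys} (f : A → Carrier) → xs ↭ ys → ⨁ xs f ≈ ⨁ ys f
    ⨁-↭ f ↭.refl         = ≈-refl
    ⨁-↭ f (↭.prep x p)   = ∙-congˡ (⨁-↭ f p)
    ⨁-↭ f (↭.swap x y p) = ≈-trans (x∙yz≈y∙xz _ _ _) (∙-congˡ (∙-congˡ (⨁-↭ f p)))
    ⨁-↭ f (↭.trans p p′) = ≈-trans (⨁-↭ f p) (⨁-↭ f p′)

    ⨁-filter : ∀ {p} {P : Pred A p} (P? : Decidable P) xs (f : A → Carrier) →
               ⨁ (filter P? xs) f ≈ ⨁ xs (λ x → if does (P? x) then f x else ε)
    ⨁-filter P? []       f = ≈-refl
    ⨁-filter P? (x ∷ xs) f with does (P? x)
    ... | true  = ∙-congˡ (⨁-filter P? xs f)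
    ... | false = ≈-trans (⨁-filter P? xs f) (≈-sym (identityˡ _))

    ⨁-unique : ∀ {xs y} {f : A → Carrier} → Unique xs → y ∈ xs →
               (∀ {x} → x ∈ xs → x ≢ y → f x ≈ ε) → ⨁ xs f ≈ f y
    ⨁-unique {x ∷ xs} (x∉ ∷ xs!) (here refl) e = ≈-trans
      (∙-congˡ (⨁-ε xs (λ z∈ → e (there z∈) (λ { refl → All.lookup x∉ z∈ refl }))))
      (identityʳ _)
    ⨁-unique {x ∷ xs} (x∉ ∷ xs!) (there y∈) e = ≈-trans
      (∙-cong (e (here refl) (All.lookup x∉ y∈)) (⨁-unique xs! y∈ (λ x∈ → e (there x∈))))
      (identityˡ _)

  ⨁-map : {A B : Set} (g : A → B) (xs : List A) (f : B → Carrier) → ⨁ (map g xs) f ≡ ⨁ xs (λ x → f (g x))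
  ⨁-map g []       f = refl
  ⨁-map g (x ∷ xs) f rewrite ⨁-map g xs f = refl

  ⨁-comm : {A B : Set} (xs : List A) (ys : List B) (f : A → B → Carrier) →
           ⨁ xs (λ x → ⨁ ys (f x)) ≈ ⨁ ys (λ y → ⨁ xs (λ x → f x y))
  ⨁-comm []       ys f = ≈-sym (⨁-ε ys (λ _ → ≈-refl))
  ⨁-comm (x ∷ xs) ys f = ≈-trans (∙-congˡ (⨁-comm xs ys f)) (≈-sym (⨁-∙ ys _ _))

-- Inversions of triples

module _ {n : ℕ} where

  χ-> : {a b : Fin n} → b Fin.< a → χ a b ≡ 1
  χ-> {a} {b} b<a = cong (if_then 1 else 0) (dec-true (b Fin.<? a) b<a)

  χ-≤ : {a b : Fin n} → a Fin.≤ b → χ a b ≡ 0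
  χ-≤ {a} {b} a≤b = cong (if_then 1 else 0) (dec-false (b Fin.<? a) (ℕ.≤⇒≯ a≤b))

  χ-irrefl : (a : Fin n) → χ a a ≡ 0
  χ-irrefl a = χ-≤ {a} ℕ.≤-refl

  χ-total : {a b : Fin n} → a ≢ b → χ a b ℕ.+ χ b a ≡ 1
  χ-total {a} {b} a≢b with Fin.<-cmp a b
  ... | tri< a<b _ _ = cong₂ ℕ._+_ (χ-≤ {a} {b} (ℕ.<⇒≤ a<b)) (χ-> {b} {a} a<b)
  ... | tri≈ _ a≡b _ = ⊥-elim (a≢b a≡b)
  ... | tri> _ _ b<a = cong₂ ℕ._+_ (χ-> {a} {b} b<a) (χ-≤ {b} {a} (ℕ.<⇒≤ b<a))

  -- Of the eight outcomes of the comparisons, two contradict transitivity. The bounds make the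
  -- truncated subtraction in `χ₃` exact and its value a bit.
  χ₃-bounds : (a b c : Fin n) → χ a c ≤ χ a b ℕ.+ χ b c × χ a b ℕ.+ χ b c ≤ suc (χ a c)
  χ₃-bounds a b c with ℕ.<-≤-connex (toℕ b) (toℕ a) | ℕ.<-≤-connex (toℕ c) (toℕ b) | ℕ.<-≤-connex (toℕ c) (toℕ a)
  ... | inj₁ p | inj₁ r | inj₁ s rewrite χ-> {a} {b} p | χ-> {b} {c} r | χ-> {a} {c} s = s≤s z≤n , s≤s (s≤s z≤n)
  ... | inj₁ p | inj₁ r | inj₂ s = ⊥-elim (ℕ.<⇒≱ (ℕ.<-trans r p) s)
  ... | inj₁ p | inj₂ r | inj₁ s rewrite χ-> {a} {b} p | χ-≤ {b} {c} r | χ-> {a} {c} s = s≤s z≤n , s≤s z≤n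
  ... | inj₁ p | inj₂ r | inj₂ s rewrite χ-> {a} {b} p | χ-≤ {b} {c} r | χ-≤ {a} {c} s = z≤n , s≤s z≤n
  ... | inj₂ p | inj₁ r | inj₁ s rewrite χ-≤ {a} {b} p | χ-> {b} {c} r | χ-> {a} {c} s = s≤s z≤n , s≤s z≤n
  ... | inj₂ p | inj₁ r | inj₂ s rewrite χ-≤ {a} {b} p | χ-> {b} {c} r | χ-≤ {a} {c} s = z≤n , s≤s z≤n
  ... | inj₂ p | inj₂ r | inj₁ s = ⊥-elim (ℕ.<⇒≱ s (ℕ.≤-trans p r))
  ... | inj₂ p | inj₂ r | inj₂ s rewrite χ-≤ {a} {b} p | χ-≤ {b} {c} r | χ-≤ {a} {c} s = z≤n , z≤n

  χ₃-+ : (a b c : Fin n) → χ₃ a b c ℕ.+ χ a c ≡ χ a b ℕ.+ χ b c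
  χ₃-+ a b c = ℕ.m∸n+n≡m (proj₁ (χ₃-bounds a b c))

  χ₃≤1 : (a b c : Fin n) → χ₃ a b c ≤ 1
  χ₃≤1 a b c = ℕ.+-cancelʳ-≤ (χ a c) _ _
    (ℕ.≤-trans (ℕ.≤-reflexive (χ₃-+ a b c)) (proj₂ (χ₃-bounds a b c)))

  -- Once `χ a c` and `χ b c` are added on both sides, what remains is that exactly one of a > b and
  -- b > a holds.
  χ₃-swap : {a b : Fin n} (c : Fin n) → a ≢ b → χ₃ a b c ℕ.+ χ₃ b a c ≡ 1
  χ₃-swap {a} {b} c a≢b = ℕ.+-cancelʳ-≡ (χ a c ℕ.+ χ b c) _ _ (begin
    (χ₃ a b c ℕ.+ χ₃ b a c) ℕ.+ (χ a c ℕ.+ χ b c)    ≡⟨ interchange (χ₃ a b c) _ _ _ ⟩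
    (χ₃ a b c ℕ.+ χ a c) ℕ.+ (χ₃ b a c ℕ.+ χ b c)    ≡⟨ cong₂ ℕ._+_ (χ₃-+ a b c) (χ₃-+ b a c) ⟩
    (χ a b ℕ.+ χ b c) ℕ.+ (χ b a ℕ.+ χ a c)          ≡⟨ interchange (χ a b) _ _ _ ⟩
    (χ a b ℕ.+ χ b a) ℕ.+ (χ b c ℕ.+ χ a c)          ≡⟨ cong₂ ℕ._+_ (χ-total a≢b) (ℕ.+-comm (χ b c) _) ⟩
    1 ℕ.+ (χ a c ℕ.+ χ b c)                          ∎)
    where
    open ≡.≡-Reasoning
    open CommutativeSemigroupProperties ℕ.+-commutativeSemigroup using (interchange)

  -- 1 for a coinversion triple and 0 for an inversion triple.
  co : Fin n → Fin n → Fin n → ℕ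
  co a b c = 1 ∸ χ₃ a b c

  co+χ₃ : (a b c : Fin n) → co a b c ℕ.+ χ₃ a b c ≡ 1
  co+χ₃ a b c = ℕ.m∸n+n≡m (χ₃≤1 a b c)

  co-swap : {a b : Fin n} (c : Fin n) → a ≢ b → co a b c ≡ χ₃ b a c
  co-swap {a} {b} c a≢b = ℕ.+-cancelʳ-≡ (χ₃ a b c) _ _
    (trans (co+χ₃ a b c) (sym (trans (ℕ.+-comm (χ₃ b a c) _) (χ₃-swap c a≢b))))

  -- As `χ a a` is 0, `χ₃ a b a` counts exactly one of a > b and b > a. Thus the triple formed with
  -- the right box costs nothing when the left box repeats the entry below it.
  co-refl : {a b : Fin n} → a ≢ b → co a b a ≡ 0
  co-refl {a} {b} a≢b = cong (1 ∸_) (trans (sym (ℕ.+-identityʳ _))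
    (trans (cong (χ₃ a b a ℕ.+_) (sym (χ-irrefl a))) (trans (χ₃-+ a b a) (χ-total a≢b))))

  -- A form of `co` without subtraction, accessible to the semiring solver.
  co+χ+χ : (a b c : Fin n) → co a b c ℕ.+ (χ a b ℕ.+ χ b c) ≡ suc (χ a c)
  co+χ+χ a b c = trans (cong (co a b c ℕ.+_) (sym (χ₃-+ a b c)))
    (trans (sym (ℕ.+-assoc (co a b c) _ _)) (cong (ℕ._+ χ a c) (co+χ₃ a b c)))

  -- The terms of χ₃ that involve v are symmetric in a and b, and cancel.
  co-exchange : (a b c d v : Fin n) →
    (co c v b ℕ.+ co d v a) ℕ.+ (χ c a ℕ.+ χ d b) ≡ (co c v a ℕ.+ co d v b) ℕ.+ (χ c b ℕ.+ χ d a)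
  co-exchange a b c d v = ℕ.suc-injective (ℕ.suc-injective (ℕ.+-cancelʳ-≡
    ((χ c v ℕ.+ χ v a) ℕ.+ (χ d v ℕ.+ χ v b)) _ _
    (begin
      suc (suc ((x ℕ.+ y) ℕ.+ (χ c a ℕ.+ χ d b))) ℕ.+ S
        ≡⟨ +-*-Solver.solve 5 (λ x y z w s → con 2 :+ ((x :+ y) :+ (z :+ w)) :+ s
             := (x :+ y) :+ ((con 1 :+ z) :+ (con 1 :+ w)) :+ s) refl x y (χ c a) (χ d b) S ⟩
      (x ℕ.+ y) ℕ.+ (suc (χ c a) ℕ.+ suc (χ d b)) ℕ.+ S
        ≡⟨ cong (λ e → (x ℕ.+ y) ℕ.+ e ℕ.+ S) (cong₂ ℕ._+_ (co+χ+χ c v a) (co+χ+χ d v b)) ⟨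
      (x ℕ.+ y) ℕ.+ ((z ℕ.+ (χ c v ℕ.+ χ v a)) ℕ.+ (w ℕ.+ (χ d v ℕ.+ χ v b))) ℕ.+ S
        ≡⟨ +-*-Solver.solve 8 (λ x y z w e f g h → (x :+ y) :+ ((z :+ (e :+ f)) :+ (w :+ (g :+ h))) :+ ((e :+ f) :+ (g :+ h))
             := (z :+ w) :+ ((x :+ (e :+ h)) :+ (y :+ (g :+ f))) :+ ((e :+ f) :+ (g :+ h))) refl
             x y z w (χ c v) (χ v a) (χ d v) (χ v b) ⟩
      (z ℕ.+ w) ℕ.+ ((x ℕ.+ (χ c v ℕ.+ χ v b)) ℕ.+ (y ℕ.+ (χ d v ℕ.+ χ v a))) ℕ.+ S
        ≡⟨ cong (λ e → (z ℕ.+ w) ℕ.+ e ℕ.+ S) (cong₂ ℕ._+_ (co+χ+χ c v b) (co+χ+χ d v a)) ⟩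
      (z ℕ.+ w) ℕ.+ (suc (χ c b) ℕ.+ suc (χ d a)) ℕ.+ S
        ≡⟨ +-*-Solver.solve 5 (λ x y z w s → con 2 :+ ((x :+ y) :+ (z :+ w)) :+ s
             := (x :+ y) :+ ((con 1 :+ z) :+ (con 1 :+ w)) :+ s) refl z w (χ c b) (χ d a) S ⟨
      suc (suc ((z ℕ.+ w) ℕ.+ (χ c b ℕ.+ χ d a))) ℕ.+ S ∎)))
    where
    open ≡.≡-Reasoning
    open +-*-Solver using (_:+_; _:=_; con)
    x y z w S : ℕ
    x = co c v b
    y = co d v a
    z = co c v a
    w = co d v b
    S = (χ c v ℕ.+ χ v a) ℕ.+ (χ d v ℕ.+ χ v b)

module ℕ+ = Fold ℕ.+-0-commutativeMonoid

module _ {n : ℕ} where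

  -- Counts the coinversion triples of two boxes carrying c and d, above a and b, whose third box
  -- runs through an arm with entries `vs`.
  ∑co : List (Fin n) → (a b c d : Fin n) → ℕ
  ∑co vs a b c d = ℕ+.⨁ vs (λ v → co c v a ℕ.+ co d v b)

  ∑co-comm : ∀ vs (a b c d : Fin n) → ∑co vs a b c d ≡ ∑co vs b a d c
  ∑co-comm vs a b c d = ℕ+.⨁-cong vs (λ v → ℕ.+-comm (co c v a) _)

  ∑co-exchange : ∀ vs (a b c d : Fin n) →
    ∑co vs b a c d ℕ.+ length vs ℕ.* (χ c a ℕ.+ χ d b) ≡ ∑co vs a b c d ℕ.+ length vs ℕ.* (χ c b ℕ.+ χ d a)
  ∑co-exchange []       a b c d = refl
  ∑co-exchange (v ∷ vs) a b c d = begin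
    _ ≡⟨ interchange (co c v b ℕ.+ co d v a) _ _ _ ⟩
    _ ≡⟨ cong₂ ℕ._+_ (co-exchange a b c d v) (∑co-exchange vs a b c d) ⟩
    _ ≡⟨ interchange (co c v a ℕ.+ co d v b) _ _ _ ⟩
    _ ∎
    where
    open ≡.≡-Reasoning
    open CommutativeSemigroupProperties ℕ.+-commutativeSemigroup using (interchange)

-- The factors of the weight in the field of fractions

module RingIdentities {c ℓ} (R : CommutativeRing c ℓ) where
  open CommutativeRing R renaming (refl to ≈-refl; sym to ≈-sym; trans to ≈-trans)
  open SetoidReasoning setoid
  open GroupProperties +-group using (∙-cancelʳ)
  open NaturalSolver commutativeSemiring using (solve; _:+_; _:*_; _:=_)

  x-y+y≈x : ∀ x y → (x - y) + y ≈ x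
  x-y+y≈x x y = ≈-trans (+-assoc _ _ _) (≈-trans (+-congˡ (-‿inverseˡ y)) (+-identityʳ x))

  x+y≈1⇒1-y≈x : ∀ {x y} → x + y ≈ 1# → 1# - y ≈ x
  x+y≈1⇒1-y≈x {x} {y} e = ∙-cancelʳ y _ _ (≈-trans (x-y+y≈x 1# y) (≈-sym e))

  [1-t]+t[1-y]≈1-yt : ∀ y t → (1# - t) + t * (1# - y) ≈ 1# - y * t
  [1-t]+t[1-y]≈1-yt y t = ≈-sym (x+y≈1⇒1-y≈x (begin
    (1# - t) + t * (1# - y) + y * t    ≈⟨ solve 4 (λ u t d y → u :+ t :* d :+ y :* t := u :+ t :* (d :+ y)) ≈-refl _ _ _ _ ⟩
    (1# - t) + t * ((1# - y) + y)      ≈⟨ +-congˡ (≈-trans (*-congˡ (x-y+y≈x 1# y)) (*-identityʳ t)) ⟩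
    (1# - t) + t                       ≈⟨ x-y+y≈x 1# t ⟩
    1#                                 ∎))

  y[1-t]+[1-y]≈1-yt : ∀ y t → y * (1# - t) + (1# - y) ≈ 1# - y * t
  y[1-t]+[1-y]≈1-yt y t = ≈-sym (x+y≈1⇒1-y≈x (begin
    y * (1# - t) + (1# - y) + y * t    ≈⟨ solve 4 (λ u t d y → y :* u :+ d :+ y :* t := d :+ y :* (u :+ t)) ≈-refl _ _ _ _ ⟩
    (1# - y) + y * ((1# - t) + t)      ≈⟨ +-congˡ (≈-trans (*-congˡ (x-y+y≈x 1# t)) (*-identityʳ y)) ⟩
    (1# - y) + y                       ≈⟨ x-y+y≈x 1# y ⟩
    1#                                 ∎))

  module _ {y t i : Carrier} (inverse : (1# - y * t) * i ≈ 1#) where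

    -- With y = q^(ℓ+1) t^(A+1), the product (1 - y) i is the ratio in ρ. This identity and the next
    -- give 1 - ρ in the case a = c, for the two possible exponents of t.
    1-t[1-y]i : 1# - t * ((1# - y) * i) ≈ (1# - t) * i
    1-t[1-y]i = x+y≈1⇒1-y≈x (begin
      (1# - t) * i + t * ((1# - y) * i)   ≈⟨ solve 4 (λ u t d i → u :* i :+ t :* (d :* i) := (u :+ t :* d) :* i) ≈-refl _ _ _ _ ⟩
      ((1# - t) + t * (1# - y)) * i       ≈⟨ *-congʳ ([1-t]+t[1-y]≈1-yt y t) ⟩
      (1# - y * t) * i                    ≈⟨ inverse ⟩
      1#                                  ∎)

    1-[1-y]i : 1# - (1# - y) * i ≈ y * ((1# - t) * i)
    1-[1-y]i = x+y≈1⇒1-y≈x (begin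
      y * ((1# - t) * i) + (1# - y) * i   ≈⟨ solve 4 (λ u y d i → y :* (u :* i) :+ d :* i := (y :* u :+ d) :* i) ≈-refl _ _ _ _ ⟩
      (y * (1# - t) + (1# - y)) * i       ≈⟨ *-congʳ (y[1-t]+[1-y]≈1-yt y t) ⟩
      (1# - y * t) * i                    ≈⟨ inverse ⟩
      1#                                  ∎)

    u[1-y]⁻¹[1-y]i : ∀ {u j} → (1# - y) * j ≈ 1# → (u * j) * ((1# - y) * i) ≈ u * i
    u[1-y]⁻¹[1-y]i {u} {j} e = begin
      (u * j) * ((1# - y) * i)   ≈⟨ solve 4 (λ u j d i → (u :* j) :* (d :* i) := (d :* j) :* (u :* i)) ≈-refl _ _ _ _ ⟩
      ((1# - y) * j) * (u * i)   ≈⟨ *-congʳ e ⟩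
      1# * (u * i)               ≈⟨ *-identityˡ _ ⟩
      u * i                      ∎

module FractionWeights {c ℓ} (D : IntegralDomain c ℓ)
  (qₐ tₐ : IntegralDomain.Carrier D) where

  private
    module A = CommutativeRing (IntegralDomain.commutativeRing D)
    module A^ = Exp A.semiring
  open FractionField D using (fractionField; fromRing; mk≈; _/_⟨_⟩)
  open RingIdentities fractionField
  module F = CommutativeRing fractionField
  open Exp F.semiring using (_^_)
  open SetoidReasoning F.setoid

  q t : F.Carrier
  q = fromRing qₐ
  t = fromRing tₐ

  1-q^_t^ₐ_ : ℕ → ℕ → A.Carrier
  1-q^ a t^ₐ b = A.1# A.- (qₐ A^.^ a) A.* (tₐ A^.^ b)

  fromRing-+ : ∀ x y → fromRing (x A.+ y) F.≈ fromRing x F.+ fromRing y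
  fromRing-+ x y = mk≈ (A.trans (A.*-congˡ (A.*-identityˡ A.1#))
    (A.*-congʳ (A.+-cong (A.sym (A.*-identityʳ x)) (A.sym (A.*-identityʳ y)))))

  fromRing-* : ∀ x y → fromRing (x A.* y) F.≈ fromRing x F.* fromRing y
  fromRing-* x y = mk≈ (A.*-congˡ (A.*-identityˡ A.1#))

  fromRing-^ : ∀ x n → fromRing (x A^.^ n) F.≈ fromRing x ^ n
  fromRing-^ x zero    = F.refl
  fromRing-^ x (suc n) = F.trans (fromRing-* x (x A^.^ n)) (F.*-congˡ {fromRing x} (fromRing-^ x n))

  fromRing-1-q^t^ : ∀ a b → fromRing (1-q^ a t^ₐ b) F.≈ F.1# F.- q ^ a F.* t ^ b
  fromRing-1-q^t^ a b = F.trans (fromRing-+ A.1# (A.- ((qₐ A^.^ a) A.* (tₐ A^.^ b))))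
    (F.+-congˡ {F.1#} (F.-‿cong {fromRing ((qₐ A^.^ a) A.* (tₐ A^.^ b))} (F.trans (fromRing-* (qₐ A^.^ a) (tₐ A^.^ b))
      (F.*-cong (fromRing-^ qₐ a) (fromRing-^ tₐ b)))))

  module _ (1-q^t^≉0 : ∀ a b → 1-q^ suc a t^ₐ b A.≉ A.0#) where

    fac : ℕ → ℕ → F.Carrier
    fac ℓ A = (A.1# A.- tₐ) / (1-q^ suc ℓ t^ₐ suc A) ⟨ 1-q^t^≉0 ℓ (suc A) ⟩

    ratio : ℕ → ℕ → F.Carrier
    ratio A ℓ = (1-q^ suc ℓ t^ₐ suc A) / (1-q^ suc ℓ t^ₐ suc (suc A)) ⟨ 1-q^t^≉0 ℓ (suc (suc A)) ⟩

    1/1-q^t^ : ℕ → ℕ → F.Carrier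
    1/1-q^t^ ℓ b = A.1# / (1-q^ suc ℓ t^ₐ b) ⟨ 1-q^t^≉0 ℓ b ⟩

    /≈ : ∀ x ℓ b → x / (1-q^ suc ℓ t^ₐ b) ⟨ 1-q^t^≉0 ℓ b ⟩ F.≈ fromRing x F.* 1/1-q^t^ ℓ b
    /≈ x ℓ b = mk≈ (A.*-cong (A.sym (A.*-identityʳ x)) (A.*-identityˡ _))

    inverse : ∀ ℓ b → (F.1# F.- q ^ suc ℓ F.* t ^ b) F.* 1/1-q^t^ ℓ b F.≈ F.1#
    inverse ℓ b = begin
      (F.1# F.- q ^ suc ℓ F.* t ^ b) F.* 1/1-q^t^ ℓ b     ≈⟨ F.*-congʳ {1/1-q^t^ ℓ b} (fromRing-1-q^t^ (suc ℓ) b) ⟨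
      fromRing (1-q^ suc ℓ t^ₐ b) F.* 1/1-q^t^ ℓ b          ≈⟨ mk≈ (A.trans (A.*-comm _ _) (A.*-congˡ (A.*-comm _ _))) ⟩
      F.1#                                                  ∎

    -- The last factor t is split off on the right to match the shape 1 - y t required by
    -- `RingIdentities`.
    inverse′ : ∀ ℓ b → (F.1# F.- q ^ suc ℓ F.* t ^ b F.* t) F.* 1/1-q^t^ ℓ (suc b) F.≈ F.1#
    inverse′ ℓ b = begin
      (F.1# F.- q ^ suc ℓ F.* t ^ b F.* t) F.* 1/1-q^t^ ℓ (suc b)
        ≈⟨ F.*-congʳ {1/1-q^t^ ℓ (suc b)} (F.+-congˡ {F.1#} (F.-‿cong {q ^ suc ℓ F.* t ^ b F.* t}
             (F.*-assoc (q ^ suc ℓ) (t ^ b) t))) ⟩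
      (F.1# F.- q ^ suc ℓ F.* (t ^ b F.* t)) F.* 1/1-q^t^ ℓ (suc b)
        ≈⟨ F.*-congʳ {1/1-q^t^ ℓ (suc b)} (F.+-congˡ {F.1#} (F.-‿cong {q ^ suc ℓ F.* (t ^ b F.* t)}
             (F.*-congˡ {q ^ suc ℓ} (F.*-comm (t ^ b) t)))) ⟩
      (F.1# F.- q ^ suc ℓ F.* (t F.* t ^ b)) F.* 1/1-q^t^ ℓ (suc b)
        ≈⟨ inverse ℓ (suc b) ⟩
      F.1# ∎

    fac≈ : ∀ ℓ A → fac ℓ A F.≈ (F.1# F.- t) F.* 1/1-q^t^ ℓ (suc A)
    fac≈ ℓ A = F.trans (/≈ _ ℓ (suc A)) (F.*-congʳ {1/1-q^t^ ℓ (suc A)} (fromRing-+ A.1# (A.- tₐ)))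

    ratio≈ : ∀ A ℓ → ratio A ℓ F.≈ (F.1# F.- q ^ suc ℓ F.* t ^ suc A) F.* 1/1-q^t^ ℓ (suc (suc A))
    ratio≈ A ℓ = F.trans (/≈ _ ℓ (suc (suc A)))
      (F.*-congʳ {1/1-q^t^ ℓ (suc (suc A))} (fromRing-1-q^t^ (suc ℓ) (suc A)))

    -- The denominator of the first factor cancels the numerator of the ratio, which is thus the
    -- quotient of the factors of two boxes whose arms differ by one.
    fac*ratio : ∀ ℓ A → fac ℓ A F.* ratio A ℓ F.≈ fac ℓ (suc A)
    fac*ratio ℓ A = begin
      fac ℓ A F.* ratio A ℓ
        ≈⟨ F.*-cong (fac≈ ℓ A) (ratio≈ A ℓ) ⟩
      (F.1# F.- t) F.* 1/1-q^t^ ℓ (suc A) F.* ((F.1# F.- q ^ suc ℓ F.* t ^ suc A) F.* 1/1-q^t^ ℓ (suc (suc A)))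
        ≈⟨ u[1-y]⁻¹[1-y]i {q ^ suc ℓ F.* t ^ suc A} {t} {1/1-q^t^ ℓ (suc (suc A))} (inverse′ ℓ (suc A))
             {F.1# F.- t} {1/1-q^t^ ℓ (suc A)} (inverse ℓ (suc A)) ⟩
      (F.1# F.- t) F.* 1/1-q^t^ ℓ (suc (suc A))
        ≈⟨ fac≈ ℓ (suc A) ⟨
      fac ℓ (suc A) ∎

    1-t*ratio : ∀ A ℓ → F.1# F.- t F.* ratio A ℓ F.≈ fac ℓ (suc A)
    1-t*ratio A ℓ = begin
      F.1# F.- t F.* ratio A ℓ
        ≈⟨ F.+-congˡ {F.1#} (F.-‿cong {t F.* ratio A ℓ} (F.*-congˡ {t} (ratio≈ A ℓ))) ⟩
      F.1# F.- t F.* ((F.1# F.- q ^ suc ℓ F.* t ^ suc A) F.* 1/1-q^t^ ℓ (suc (suc A)))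
        ≈⟨ 1-t[1-y]i {q ^ suc ℓ F.* t ^ suc A} {t} {1/1-q^t^ ℓ (suc (suc A))} (inverse′ ℓ (suc A)) ⟩
      (F.1# F.- t) F.* 1/1-q^t^ ℓ (suc (suc A))
        ≈⟨ fac≈ ℓ (suc A) ⟨
      fac ℓ (suc A) ∎

    1-ratio : ∀ A ℓ → F.1# F.- ratio A ℓ F.≈ (q ^ suc ℓ F.* t ^ suc A) F.* fac ℓ (suc A)
    1-ratio A ℓ = begin
      F.1# F.- ratio A ℓ
        ≈⟨ F.+-congˡ {F.1#} (F.-‿cong {ratio A ℓ} (ratio≈ A ℓ)) ⟩
      F.1# F.- (F.1# F.- q ^ suc ℓ F.* t ^ suc A) F.* 1/1-q^t^ ℓ (suc (suc A))
        ≈⟨ 1-[1-y]i {q ^ suc ℓ F.* t ^ suc A} {t} {1/1-q^t^ ℓ (suc (suc A))} (inverse′ ℓ (suc A)) ⟩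
      (q ^ suc ℓ F.* t ^ suc A) F.* ((F.1# F.- t) F.* 1/1-q^t^ ℓ (suc (suc A)))
        ≈⟨ F.*-congˡ {q ^ suc ℓ F.* t ^ suc A} (fac≈ ℓ (suc A)) ⟨
      (q ^ suc ℓ F.* t ^ suc A) F.* fac ℓ (suc A) ∎

-- The balance identities of a single row

-- What the argument uses of ℚ(q,t). In ℚ(q,t) itself the field operations unfold
-- to polynomial arithmetic, so the proofs are carried out over an abstract ring.

record Rates {c ℓ} (R : CommutativeRing c ℓ) : Set (c ⊔ ℓ) where
  open CommutativeRing R
  open Exp semiring using (_^_)
  field
    q t       : Carrier
    fac ratio : ℕ → ℕ → Carrier
    fac*ratio : ∀ ℓ A → fac ℓ A * ratio A ℓ ≈ fac ℓ (suc A)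
    1-t*ratio : ∀ A ℓ → 1# - t * ratio A ℓ ≈ fac ℓ (suc A)
    1-ratio   : ∀ A ℓ → 1# - ratio A ℓ ≈ (q ^ suc ℓ * t ^ suc A) * fac ℓ (suc A)
    rate      : ∀ {n} (a b c d : Fin n) (A ℓ : ℕ) → Carrier
    rate-b≡d  : ∀ {n} {a b c d : Fin n} {A ℓ} → b ≡ d → rate a b c d A ℓ ≈ 1#
    rate-a≡c  : ∀ {n} {a b c d : Fin n} {A ℓ} → a ≡ c → b ≢ d →
                rate a b c d A ℓ ≈ t ^ (1 ∸ χ₃ d a b) * ratio A ℓ
    rate-b≡c  : ∀ {n} {a b c d : Fin n} {A ℓ} → a ≢ c → b ≢ d → b ≡ c → rate a b c d A ℓ ≈ 0#
    rate-χ₃≡  : ∀ {n} {a b c d : Fin n} {A ℓ} → a ≢ c → b ≢ d → b ≢ c →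
                χ₃ c d a ≡ χ₃ c d b → rate a b c d A ℓ ≈ 0#
    rate-χ₃≢  : ∀ {n} {a b c d : Fin n} {A ℓ} → a ≢ c → b ≢ d → b ≢ c →
                χ₃ c d a ≢ χ₃ c d b → rate a b c d A ℓ ≈ 1#

module LocalBalance {c ℓ} {R : CommutativeRing c ℓ} (W : Rates R) where

  open CommutativeRing R renaming (refl to ≈-refl; sym to ≈-sym; trans to ≈-trans)
  open Exp semiring using (_^_; ^-homo-*; ^-congʳ)
  open Rates W
  open RingProperties ring using (-0#≈0#)
  open SetoidReasoning setoid
  open NaturalSolver commutativeSemiring using (solve; _:+_; _:*_; _:=_)

  1-0≈1 : ∀ {x} → x ≈ 0# → 1# - x ≈ 1#
  1-0≈1 e = ≈-trans (+-congˡ (≈-trans (-‿cong e) -0#≈0#)) (+-identityʳ 1#)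

  1-1≈0 : ∀ {x} → x ≈ 1# → 1# - x ≈ 0#
  1-1≈0 e = ≈-trans (+-congˡ (-‿cong e)) (-‿inverseʳ 1#)

  -- Treats both values of the bit s at once. The monomial is the change of q^maj t^coinv when only
  -- the lower row is exchanged: s more descents, and s more coinversion triples for each of the A +
  -- 1 arm boxes involved.
  1-t^*ratio : ∀ A ℓ s → s ≤ 1 →
    1# - t ^ (1 ∸ s) * ratio A ℓ ≈ (q ^ (s ℕ.* suc ℓ) * t ^ (s ℕ.* suc A)) * fac ℓ (suc A)
  1-t^*ratio A ℓ zero _ = begin
    1# - t ^ 1 * ratio A ℓ        ≈⟨ +-congˡ (-‿cong (*-congʳ (*-identityʳ t))) ⟩
    1# - t * ratio A ℓ            ≈⟨ 1-t*ratio A ℓ ⟩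
    fac ℓ (suc A)                 ≈⟨ *-identityˡ _ ⟨
    1# * fac ℓ (suc A)            ≈⟨ *-congʳ (*-identityˡ 1#) ⟨
    (1# * 1#) * fac ℓ (suc A)     ∎
  1-t^*ratio A ℓ (suc zero) _ = begin
    1# - 1# * ratio A ℓ
      ≈⟨ +-congˡ (-‿cong (*-identityˡ _)) ⟩
    1# - ratio A ℓ
      ≈⟨ 1-ratio A ℓ ⟩
    (q ^ suc ℓ * t ^ suc A) * fac ℓ (suc A)
      ≈⟨ *-congʳ (*-cong (^-congʳ q (ℕ.*-identityˡ (suc ℓ))) (^-congʳ t (ℕ.*-identityˡ (suc A)))) ⟨
    (q ^ (1 ℕ.* suc ℓ) * t ^ (1 ℕ.* suc A)) * fac ℓ (suc A) ∎
  1-t^*ratio A ℓ (suc (suc s)) (s≤s ())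

  -- `X` descents in boxes of leg ℓ add X (ℓ + 1) to maj.
  monomial : ℕ → ℕ → ℕ → Carrier
  monomial ℓ X N = q ^ (X ℕ.* suc ℓ) * t ^ N

  monomial-+ : ∀ ℓ X N X′ N′ → monomial ℓ (X ℕ.+ X′) (N ℕ.+ N′) ≈ monomial ℓ X N * monomial ℓ X′ N′
  monomial-+ ℓ X N X′ N′ = begin
    q ^ ((X ℕ.+ X′) ℕ.* suc ℓ) * t ^ (N ℕ.+ N′)
      ≈⟨ *-cong (≈-trans (^-congʳ q (ℕ.*-distribʳ-+ (suc ℓ) X X′)) (^-homo-* q (X ℕ.* suc ℓ) (X′ ℕ.* suc ℓ))) (^-homo-* t N N′) ⟩
    (q ^ (X ℕ.* suc ℓ) * q ^ (X′ ℕ.* suc ℓ)) * (t ^ N * t ^ N′)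
      ≈⟨ solve 4 (λ a b c d → (a :* b) :* (c :* d) := (a :* c) :* (b :* d)) ≈-refl _ _ _ _ ⟩
    monomial ℓ X N * monomial ℓ X′ N′ ∎

  module _ {n : ℕ} where

    φ : Fin n → Fin n → ℕ → ℕ → Carrier
    φ x y ℓ A = if does (¬? (x Fin.≟ y)) then fac ℓ A else 1#

    φ-≡ : ∀ {x y ℓ A} → x ≡ y → φ x y ℓ A ≡ 1#
    φ-≡ {x} {y} {ℓ} {A} e = cong (λ b → if b then fac ℓ A else 1#) (dec-false (¬? (x Fin.≟ y)) (λ ¬e → ¬e e))

    φ-≢ : ∀ {x y ℓ A} → x ≢ y → φ x y ℓ A ≡ fac ℓ A
    φ-≢ {x} {y} {ℓ} {A} ne = cong (λ b → if b then fac ℓ A else 1#) (dec-true (¬? (x Fin.≟ y)) ne)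

    -- The contribution to the weight of the boxes carrying c and d, which lie
    -- above boxes carrying a and b; vs are the entries of their common arm.
    pairWt : List (Fin n) → ℕ → (a b c d : Fin n) → Carrier
    pairWt vs ℓ a b c d =
      monomial ℓ (χ c a ℕ.+ χ d b) (co c d a ℕ.+ ∑co vs a b c d) * (φ c a ℓ (suc (length vs)) * φ d b ℓ (length vs))

    pairWt-≈ : ∀ {vs ℓ a b c d X N f g} → χ c a ℕ.+ χ d b ≡ X → co c d a ℕ.+ ∑co vs a b c d ≡ N →
      φ c a ℓ (suc (length vs)) ≡ f → φ d b ℓ (length vs) ≡ g → pairWt vs ℓ a b c d ≈ monomial ℓ X N * (f * g)
    pairWt-≈ refl refl refl refl = ≈-refl

    module _ (vs : List (Fin n)) (ℓ : ℕ) where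

      private
        A : ℕ
        A = length vs

      -- On the left side only the right box has a factor, with arm A; on the other side only the
      -- left box has one, with arm A + 1. The ratio turns one into the other, and the power of t in
      -- the rate is the coinversion triple `co d a b` that appears. The mirrored block falls under
      -- b = d, where the rate is 1.
      swapBoth-a≡c : ∀ {a b d} → a ≢ b → a ≢ d → b ≢ d →
        pairWt vs ℓ a b a d * rate a b a d A ℓ ≈ pairWt vs ℓ b a d a * rate b a d a A ℓ
      swapBoth-a≡c {a} {b} {d} a≢b a≢d b≢d = begin
        pairWt vs ℓ a b a d * rate a b a d A ℓ
          ≈⟨ *-cong (pairWt-≈ {vs} {ℓ} {a} {b} {a} {d} refl
               (cong (ℕ._+ ∑co vs a b a d) (co-refl a≢d)) (φ-≡ {a} refl) (φ-≢ (b≢d ∘ sym))) (rate-a≡c refl b≢d) ⟩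
        (Q * t ^ M) * (1# * fac ℓ A) * (t ^ e * ratio A ℓ)
          ≈⟨ solve 6 (λ x y o f z r → (x :* y) :* (o :* f) :* (z :* r) := (x :* (z :* y)) :* ((f :* r) :* o)) ≈-refl _ _ _ _ _ _ ⟩
        (Q * (t ^ e * t ^ M)) * ((fac ℓ A * ratio A ℓ) * 1#)
          ≈⟨ *-cong (*-congˡ (≈-sym (^-homo-* t e M))) (*-congʳ (fac*ratio ℓ A)) ⟩
        (Q * t ^ (e ℕ.+ M)) * (fac ℓ (suc A) * 1#)
          ≈⟨ pairWt-≈ {vs} {ℓ} {b} {a} {d} {a} (ℕ.+-comm (χ d b) _)
               (cong (e ℕ.+_) (∑co-comm vs b a d a)) (φ-≢ (b≢d ∘ sym)) (φ-≡ {a} refl) ⟨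
        pairWt vs ℓ b a d a
          ≈⟨ *-identityʳ _ ⟨
        pairWt vs ℓ b a d a * 1#
          ≈⟨ *-congˡ (rate-b≡d refl) ⟨
        pairWt vs ℓ b a d a * rate b a d a A ℓ ∎
        where
        Q : Carrier
        Q = q ^ ((χ a a ℕ.+ χ d b) ℕ.* suc ℓ)
        e M : ℕ
        e = 1 ∸ χ₃ d a b
        M = ∑co vs a b a d

      -- Mirroring the block keeps the descents and the triples with the common arm. Only the triple
      -- of the two upper boxes and the place of a missing factor can change.
      swapBoth : ∀ {a b c d} → a ≢ b → c ≢ d → a ≢ d → b ≢ c →
        pairWt vs ℓ a b c d * rate a b c d A ℓ ≈ pairWt vs ℓ b a d c * rate b a d c A ℓ
      swapBoth {a} {b} {c} {d} a≢b c≢d a≢d b≢c with a Fin.≟ c | b Fin.≟ d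
      ... | yes refl | yes refl = *-cong
        (*-cong
          (reflexive (cong₂ (monomial ℓ) (ℕ.+-comm (χ a a) _)
            (cong₂ ℕ._+_ (trans (co-refl a≢b) (sym (co-refl b≢c))) (∑co-comm vs a b a b))))
          (*-cong (reflexive (trans (φ-≡ {a} refl) (sym (φ-≡ {b} refl))))
                  (reflexive (trans (φ-≡ {b} refl) (sym (φ-≡ {a} refl))))))
        (≈-trans (rate-b≡d refl) (≈-sym (rate-b≡d refl)))
      ... | yes refl | no b≢d   = swapBoth-a≡c a≢b a≢d b≢d
      ... | no a≢c   | yes refl = ≈-sym (swapBoth-a≡c (a≢b ∘ sym) b≢c a≢c)
      ... | no a≢c   | no b≢d   with χ₃ c d a ℕ.≟ χ₃ c d b
      -- Exchanging c and d complements both values of `χ₃`, so their equality persists and both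
      -- rates are 0.
      ...   | yes e = ≈-trans (*-congˡ (rate-χ₃≡ a≢c b≢d b≢c e))
        (≈-trans (zeroʳ _) (≈-sym (≈-trans (*-congˡ (rate-χ₃≡ b≢d a≢c a≢d
          (trans (sym (co-swap b c≢d)) (trans (cong (1 ∸_) (sym e)) (co-swap a c≢d))))) (zeroʳ _))))
      ...   | no ne = *-cong
        (*-cong
          (reflexive (cong₂ (monomial ℓ) (ℕ.+-comm (χ c a) _)
            (cong₂ ℕ._+_ co≡ (∑co-comm vs a b c d))))
          (≈-trans (*-cong (reflexive (φ-≢ (a≢c ∘ sym))) (reflexive (φ-≢ (b≢d ∘ sym))))
            (≈-sym (*-cong (reflexive (φ-≢ (b≢d ∘ sym))) (reflexive (φ-≢ (a≢c ∘ sym)))))))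
        (≈-trans (rate-χ₃≢ a≢c b≢d b≢c ne) (≈-sym (rate-χ₃≢ b≢d a≢c a≢d (λ e → ne (χ₃≡ e)))))
        where
        χ₃≡ : χ₃ d c b ≡ χ₃ d c a → χ₃ c d a ≡ χ₃ c d b
        χ₃≡ e = trans (sym (co-swap a (c≢d ∘ sym))) (trans (cong (1 ∸_) (sym e)) (co-swap b (c≢d ∘ sym)))
        bits : ∀ {x y} → x ≤ 1 → y ≤ 1 → x ≢ y → 1 ∸ x ≡ y
        bits z≤n       z≤n       x≢y = ⊥-elim (x≢y refl)
        bits z≤n       (s≤s z≤n) x≢y = refl
        bits (s≤s z≤n) z≤n       x≢y = refl
        bits (s≤s z≤n) (s≤s z≤n) x≢y = ⊥-elim (x≢y refl)
        -- Two different bits are complementary, so the triple of the two upper boxes has the same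
        -- type before and after.
        co≡ : co c d a ≡ co d c b
        co≡ = trans (bits (χ₃≤1 c d a) (χ₃≤1 c d b) ne) (sym (co-swap b (c≢d ∘ sym)))

      -- After the exchange the right lower and left upper entries coincide, so the rate is 0 and
      -- its complement 1. Both boxes now carry a factor; the new one, with the change of the
      -- monomial, is what `1-t^*ratio` extracts from the other rate.
      swapLower-a≡c : ∀ {a b d} → a ≢ b → a ≢ d → b ≢ d →
        pairWt vs ℓ a b a d * (1# - rate a b a d A ℓ) ≈ pairWt vs ℓ b a a d * (1# - rate b a a d A ℓ)
      swapLower-a≡c {a} {b} {d} a≢b a≢d b≢d = begin
        pairWt vs ℓ a b a d * (1# - rate a b a d A ℓ)
          ≈⟨ *-cong (pairWt-≈ {vs} {ℓ} {a} {b} {a} {d} (cong (ℕ._+ χ d b) (χ-irrefl a))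
               (cong (ℕ._+ ∑co vs a b a d) (co-refl a≢d)) (φ-≡ {a} refl) (φ-≢ (b≢d ∘ sym)))
               (≈-trans (+-congˡ (-‿cong (rate-a≡c refl b≢d))) (1-t^*ratio A ℓ s (χ₃≤1 d a b))) ⟩
        (monomial ℓ (χ d b) M * (1# * fac ℓ A)) * (monomial ℓ s (s ℕ.* suc A) * fac ℓ (suc A))
          ≈⟨ solve 5 (λ x o f y g → (x :* (o :* f)) :* (y :* g) := (x :* y) :* (g :* f) :* o) ≈-refl _ _ _ _ _ ⟩
        (monomial ℓ (χ d b) M * monomial ℓ s (s ℕ.* suc A)) * (fac ℓ (suc A) * fac ℓ A) * 1#
          ≈⟨ *-cong (*-congʳ (≈-sym (monomial-+ ℓ (χ d b) M s (s ℕ.* suc A)))) (≈-sym (1-0≈1 (rate-b≡c b≢a a≢d refl))) ⟩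
        monomial ℓ (χ d b ℕ.+ s) (M ℕ.+ s ℕ.* suc A) * (fac ℓ (suc A) * fac ℓ A) * (1# - rate b a a d A ℓ)
          ≈⟨ *-congʳ (pairWt-≈ {vs} {ℓ} {b} {a} {a} {d} X≡ N≡ (φ-≢ a≢b) (φ-≢ (a≢d ∘ sym))) ⟨
        pairWt vs ℓ b a a d * (1# - rate b a a d A ℓ) ∎
        where
        b≢a : b ≢ a
        b≢a = a≢b ∘ sym
        s M : ℕ
        s = χ₃ d a b
        M = ∑co vs a b a d
        -- The defining relation of `χ₃ d a b` says that the exchange adds s descents.
        X≡ : χ a b ℕ.+ χ d a ≡ χ d b ℕ.+ s
        X≡ = trans (ℕ.+-comm (χ a b) _) (trans (sym (χ₃-+ d a b)) (ℕ.+-comm s _))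
        M≡ : ∑co vs b a a d ≡ M ℕ.+ A ℕ.* s
        M≡ = ℕ.+-cancelʳ-≡ (A ℕ.* χ d b) _ _ (Eq.begin
          ∑co vs b a a d ℕ.+ A ℕ.* χ d b               Eq.≡⟨ cong (λ x → ∑co vs b a a d ℕ.+ A ℕ.* (x ℕ.+ χ d b)) (χ-irrefl a) ⟨
          ∑co vs b a a d ℕ.+ A ℕ.* (χ a a ℕ.+ χ d b)   Eq.≡⟨ ∑co-exchange vs a b a d ⟩
          M ℕ.+ A ℕ.* (χ a b ℕ.+ χ d a)                Eq.≡⟨ cong (λ x → M ℕ.+ A ℕ.* x) (trans X≡ (ℕ.+-comm (χ d b) s)) ⟩
          M ℕ.+ A ℕ.* (s ℕ.+ χ d b)                    Eq.≡⟨ cong (M ℕ.+_) (ℕ.*-distribˡ-+ A s (χ d b)) ⟩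
          M ℕ.+ (A ℕ.* s ℕ.+ A ℕ.* χ d b)              Eq.≡⟨ ℕ.+-assoc M _ _ ⟨
          M ℕ.+ A ℕ.* s ℕ.+ A ℕ.* χ d b                Eq.∎)
          where module Eq = ≡.≡-Reasoning
        -- The triple of the two upper boxes gives one s and each of the A arm entries another,
        -- whence the exponent s (A + 1).
        N≡ : co a d b ℕ.+ ∑co vs b a a d ≡ M ℕ.+ s ℕ.* suc A
        N≡ = trans (cong₂ ℕ._+_ (co-swap b a≢d) M≡)
          (+-*-Solver.solve 3 (λ s m a → s +-*-Solver.:+ (m +-*-Solver.:+ a +-*-Solver.:* s)
            +-*-Solver.:= m +-*-Solver.:+ s +-*-Solver.:* (+-*-Solver.con 1 +-*-Solver.:+ a)) refl s M A)

      -- For distinct entries the rate depends on whether `χ₃ c d a` and `χ₃ c d b` agree, a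
      -- condition symmetric in a and b. If they differ, both complements vanish; if they agree, the
      -- number of descents is unchanged, and by `∑co-exchange` so are the triples with the arm.
      swapLower : ∀ {a b c d} → a ≢ b → c ≢ d → a ≢ d → b ≢ d →
        pairWt vs ℓ a b c d * (1# - rate a b c d A ℓ) ≈ pairWt vs ℓ b a c d * (1# - rate b a c d A ℓ)
      swapLower {a} {b} {c} {d} a≢b c≢d a≢d b≢d with a Fin.≟ c | b Fin.≟ c
      ... | yes refl | _        = swapLower-a≡c a≢b a≢d b≢d
      ... | no  _    | yes refl = ≈-sym (swapLower-a≡c (a≢b ∘ sym) b≢d a≢d)
      ... | no  a≢c  | no  b≢c with χ₃ c d a ℕ.≟ χ₃ c d b
      ...   | no ne = ≈-trans (*-congˡ (1-1≈0 (rate-χ₃≢ a≢c b≢d b≢c ne)))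
        (≈-trans (zeroʳ _) (≈-sym (≈-trans (*-congˡ (1-1≈0 (rate-χ₃≢ b≢c a≢d a≢c (ne ∘ sym)))) (zeroʳ _))))
      ...   | yes e = *-cong
        (*-cong (reflexive (cong₂ (monomial ℓ) X≡ (cong₂ ℕ._+_ (cong (1 ∸_) e) M≡)))
          (*-cong (reflexive (trans (φ-≢ (a≢c ∘ sym)) (sym (φ-≢ (b≢c ∘ sym)))))
            (reflexive (trans (φ-≢ (b≢d ∘ sym)) (sym (φ-≢ (a≢d ∘ sym)))))))
        (+-congˡ (-‿cong (≈-trans (rate-χ₃≡ a≢c b≢d b≢c e) (≈-sym (rate-χ₃≡ b≢c a≢d a≢c (sym e))))))
        where
        X≡ : χ c a ℕ.+ χ d b ≡ χ c b ℕ.+ χ d a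
        X≡ = ℕ.+-cancelˡ-≡ (χ₃ c d a ℕ.+ χ c d) _ _ (Eq.begin
          χ₃ c d a ℕ.+ χ c d ℕ.+ (χ c a ℕ.+ χ d b)    Eq.≡⟨ interchange (χ₃ c d a) _ _ _ ⟩
          (χ₃ c d a ℕ.+ χ c a) ℕ.+ (χ c d ℕ.+ χ d b)  Eq.≡⟨ cong₂ ℕ._+_ (χ₃-+ c d a) (sym (χ₃-+ c d b)) ⟩
          (χ c d ℕ.+ χ d a) ℕ.+ (χ₃ c d b ℕ.+ χ c b)  Eq.≡⟨ interchange (χ c d) _ _ _ ⟩
          (χ c d ℕ.+ χ₃ c d b) ℕ.+ (χ d a ℕ.+ χ c b)
            Eq.≡⟨ cong₂ ℕ._+_ (trans (ℕ.+-comm (χ c d) _) (cong (ℕ._+ χ c d) (sym e))) (ℕ.+-comm (χ d a) _) ⟩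
          χ₃ c d a ℕ.+ χ c d ℕ.+ (χ c b ℕ.+ χ d a)    Eq.∎)
          where
          module Eq = ≡.≡-Reasoning
          open CommutativeSemigroupProperties ℕ.+-commutativeSemigroup using (interchange)
        M≡ : ∑co vs a b c d ≡ ∑co vs b a c d
        M≡ = ℕ.+-cancelʳ-≡ (A ℕ.* (χ c b ℕ.+ χ d a)) _ _
          (trans (sym (∑co-exchange vs a b c d)) (cong (λ x → ∑co vs b a c d ℕ.+ A ℕ.* x) X≡))

-- Exchanging columns i and i + 1

module _ {n : ℕ} {α : Vec ℕ n} where

  box-≡ : {u v : Box α} → col u ≡ col v → row u ≡ row v → u ≡ v
  box-≡ refl refl = refl

  adg-unique : Unique (adg α)
  adg-unique = Unique.concat⁺
    (All.map⁺ (All.universal (λ j → Unique.map⁺ (λ e → Fin.toℕ-injective (cong row e)) (Unique.allFin⁺ _)) (allFin n)))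
    (AllPairs.map⁺ (AllPairs.map (λ j≢k {u} (u∈j , u∈k) → j≢k (trans (sym (column-col u∈j)) (column-col u∈k)))
      (Unique.allFin⁺ n)))
    where
    column-col : ∀ {j u} → u ∈ column α j → col u ≡ j
    column-col u∈ with _ , _ , refl ← ∈-map⁻ _ u∈ = refl

  dg-unique : Unique (dg α)
  dg-unique = Unique.filter⁺ (λ u → 1 ℕ.≤? row u) adg-unique

  Arm-unique : ∀ (u : Box α) → Unique (Arm u)
  Arm-unique u = Unique.filter⁺ (inArm? u) adg-unique

  ∈-Arm⁺ : ∀ {u v : Box α} → InArm u v → v ∈ Arm u
  ∈-Arm⁺ {u} {v} = ∈-filter⁺ (inArm? u) (∈-adg α v)

  ∈-Arm⁻ : ∀ {u v : Box α} → v ∈ Arm u → InArm u v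
  ∈-Arm⁻ {u} v∈ = proj₂ (∈-filter⁻ (inArm? u) {xs = adg α} v∈)

module _ {n : ℕ} {α : Vec ℕ n} (τ : Permutation′ n) where

  -- The proof stored in an element of `NAF` is irrelevant; decidability yields one that may be
  -- used.
  nonAttacking : (T : NAF α τ) → NonAttacking (value T)
  nonAttacking (T Refinement., [ p ]) = recompute (nonAttacking? T) (proj₂ p)

  hasBasement : (T : NAF α τ) → HasBasement τ (value T)
  hasBasement (T Refinement., [ p ]) = recompute (hasBasement? τ T) (proj₁ p)

module SwapGeometry {m : ℕ} (α : Vec ℕ (suc m)) (i : Fin m)
  (αᵢ≡αᵢ₊₁ : lookup α (inject₁ i) ≡ lookup α (Fin.suc i)) where

  open Swapping α i αᵢ≡αᵢ₊₁ using (αᵢ; lookup-sᵢ; swapBox; swap; Ω₀; leftBox; rightBox)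

  s : Fin (suc m) → Fin (suc m)
  s = sᵢ i ⟨$⟩ʳ_

  l r : Fin (suc m)
  l = inject₁ i
  r = Fin.suc i

  toℕ-r : toℕ r ≡ suc (toℕ l)
  toℕ-r = cong suc (sym (Fin.toℕ-inject₁ i))

  l<r : l Fin.< r
  l<r = ℕ.≤-reflexive (sym toℕ-r)

  l≢r : l ≢ r
  l≢r e = ℕ.<-irrefl (cong toℕ e) l<r

  s-l : s l ≡ r
  s-l rewrite dec-true (l Fin.≟ l) refl = refl

  s-r : s r ≡ l
  s-r rewrite dec-false (r Fin.≟ l) (l≢r ∘ sym) | dec-true (r Fin.≟ r) refl = refl

  s-other : ∀ {j} → j ≢ l → j ≢ r → s j ≡ j
  s-other {j} j≢l j≢r rewrite dec-false (j Fin.≟ l) j≢l | dec-false (j Fin.≟ r) j≢r = refl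

  data View : Fin (suc m) → Set where
    left  : View l
    right : View r
    other : ∀ {j} → j ≢ l → j ≢ r → View j

  view : ∀ j → View j
  view j with j Fin.≟ l | j Fin.≟ r
  ... | yes refl | _        = left
  ... | no  _    | yes refl = right
  ... | no  j≢l  | no  j≢r  = other j≢l j≢r

  s-involutive : ∀ j → s (s j) ≡ j
  s-involutive j with view j
  ... | left            = trans (cong s s-l) s-r
  ... | right           = trans (cong s s-r) s-l
  ... | other j≢l j≢r = trans (cong s (s-other j≢l j≢r)) (s-other j≢l j≢r)

  s-injective : ∀ {j k} → s j ≡ s k → j ≡ k
  s-injective {j} {k} e = trans (sym (s-involutive j)) (trans (cong s e) (s-involutive k))

  -- No position lies between l and r, so moving j across the exchange can spoil j < k only for the
  -- pair (l , r) itself.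
  s-<ˡ : ∀ {j k} → j Fin.< k → s j Fin.< k ⊎ (j ≡ l × k ≡ r)
  s-<ˡ {j} {k} j<k with view j
  ... | left with k Fin.≟ r
  ...   | yes k≡r = inj₂ (refl , k≡r)
  ...   | no  k≢r = inj₁ (subst (Fin._< k) (sym s-l) (ℕ.≤∧≢⇒< (subst (ℕ._≤ toℕ k) (sym toℕ-r) j<k)
                      (λ e → k≢r (Fin.toℕ-injective (sym e)))))
  s-<ˡ {j} {k} j<k | right           = inj₁ (subst (Fin._< k) (sym s-r) (ℕ.<-trans l<r j<k))
  s-<ˡ {j} {k} j<k | other j≢l j≢r = inj₁ (subst (Fin._< k) (sym (s-other j≢l j≢r)) j<k)

  s-< : ∀ {j k} → j Fin.< k → s j Fin.< s k ⊎ (j ≡ l × k ≡ r)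
  s-< {j} {k} j<k with s-<ˡ j<k
  ... | inj₂ e = inj₂ e
  ... | inj₁ sj<k with view k
  ...   | left            = inj₁ (subst (s j Fin.<_) (sym s-l) (ℕ.<-trans sj<k l<r))
  ...   | other k≢l k≢r = inj₁ (subst (s j Fin.<_) (sym (s-other k≢l k≢r)) sj<k)
  ...   | right           = inj₁ (subst (s j Fin.<_) (sym s-r)
    (ℕ.≤∧≢⇒< (ℕ.≤-pred (subst (toℕ (s j) ℕ.<_) toℕ-r sj<k))
      (λ e → ℕ.<-irrefl (cong toℕ (trans (sym (s-involutive j)) (trans (cong s (Fin.toℕ-injective e)) s-l))) j<k)))

  flip : Box α → Box α
  flip (box j k k≤) = box (s j) k (ℕ.≤-trans k≤ (ℕ.≤-reflexive (sym (lookup-sᵢ j))))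

  flip-involutive : ∀ u → flip (flip u) ≡ u
  flip-involutive u = box-≡ (s-involutive (col u)) refl

  flip-left : ∀ {k} .(k≤ : k ≤ αᵢ) → flip (leftBox k k≤) ≡ rightBox k k≤
  flip-left k≤ = box-≡ s-l refl

  flip-right : ∀ {k} .(k≤ : k ≤ αᵢ) → flip (rightBox k k≤) ≡ leftBox k k≤
  flip-right k≤ = box-≡ s-r refl

  flip-other : ∀ {u} → col u ≢ l → col u ≢ r → flip u ≡ u
  flip-other u≢l u≢r = box-≡ (s-other u≢l u≢r) refl

  swapBox-≡ : ∀ {k} u → row u ≡ k → swapBox k u ≡ flip u
  swapBox-≡ {k} (box j k′ k′≤) e with k′ ℕ.≟ k
  ... | yes _ = refl
  ... | no ne = ⊥-elim (ne e)

  swapBox-≢ : ∀ {k} u → row u ≢ k → swapBox k u ≡ u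
  swapBox-≢ {k} (box j k′ k′≤) ne with k′ ℕ.≟ k
  ... | yes e = ⊥-elim (ne e)
  ... | no  _ = refl

  swap-≡ : ∀ {k} T u → row u ≡ k → swap k T ⟦ u ⟧ ≡ T ⟦ flip u ⟧
  swap-≡ {k} T u e = trans (tabulate-⟦⟧ (λ v → T ⟦ swapBox k v ⟧) u) (cong (T ⟦_⟧) (swapBox-≡ u e))

  swap-≢ : ∀ {k} T u → row u ≢ k → swap k T ⟦ u ⟧ ≡ T ⟦ u ⟧
  swap-≢ {k} T u ne = trans (tabulate-⟦⟧ (λ v → T ⟦ swapBox k v ⟧) u) (cong (T ⟦_⟧) (swapBox-≢ u ne))

  Ω-> : ∀ h T u → h < row u → Ω₀ h T ⟦ u ⟧ ≡ T ⟦ u ⟧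
  Ω-> zero    T u h< = swap-≢ T u (λ e → ℕ.<-irrefl (sym e) h<)
  Ω-> (suc h) T u h< = trans (swap-≢ (Ω₀ h T) u (λ e → ℕ.<-irrefl (sym e) h<)) (Ω-> h T u (ℕ.<-trans (ℕ.n<1+n h) h<))

  Ω-≤ : ∀ h T u → row u ≤ h → Ω₀ h T ⟦ u ⟧ ≡ T ⟦ flip u ⟧
  Ω-≤ zero    T u ≤h = swap-≡ T u (ℕ.n≤0⇒n≡0 ≤h)
  Ω-≤ (suc h) T u ≤h with row u ℕ.≟ suc h
  ... | yes e = trans (swap-≡ (Ω₀ h T) u e) (Ω-> h T (flip u) (ℕ.≤-reflexive (sym e)))
  ... | no ne = trans (swap-≢ (Ω₀ h T) u ne) (Ω-≤ h T u (ℕ.≤-pred (ℕ.≤∧≢⇒< ≤h ne)))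

  Ω-involutive : ∀ h T → Ω₀ h (Ω₀ h T) ≡ T
  Ω-involutive h T = filling-ext entry
    where
    entry : ∀ u → Ω₀ h (Ω₀ h T) ⟦ u ⟧ ≡ T ⟦ u ⟧
    entry u with row u ℕ.≤? h
    ... | yes ≤h = trans (Ω-≤ h (Ω₀ h T) u ≤h) (trans (Ω-≤ h T (flip u) ≤h) (cong (T ⟦_⟧) (flip-involutive u)))
    ... | no  ≰h = trans (Ω-> h (Ω₀ h T) u (ℕ.≰⇒> ≰h)) (Ω-> h T u (ℕ.≰⇒> ≰h))

  Ω-other : ∀ h T u → col u ≢ l → col u ≢ r → Ω₀ h T ⟦ u ⟧ ≡ T ⟦ u ⟧
  Ω-other h T u u≢l u≢r with row u ℕ.≤? h
  ... | yes ≤h = trans (Ω-≤ h T u ≤h) (cong (T ⟦_⟧) (flip-other {u} u≢l u≢r))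
  ... | no  ≰h = Ω-> h T u (ℕ.≰⇒> ≰h)

  left≢right : ∀ {T} → NonAttacking T → ∀ {k} .(k≤ : k ≤ αᵢ) → T ⟦ leftBox k k≤ ⟧ ≢ T ⟦ rightBox k k≤ ⟧
  left≢right naf {k} k≤ = naf (leftBox k k≤) (rightBox k k≤) (inj₁ (refl , l≢r))

  left≢upperRight : ∀ {T} → NonAttacking T → ∀ {k} .(k< : k < αᵢ) →
                    T ⟦ leftBox k (ℕ.<⇒≤ k<) ⟧ ≢ T ⟦ rightBox (suc k) k< ⟧
  left≢upperRight naf {k} k< = naf (leftBox k (ℕ.<⇒≤ k<)) (rightBox (suc k) k<) (inj₂ (inj₂ (refl , l<r)))

  -- For different stopping rows, the higher one is exchanged in only one of the two fillings, and
  -- its entries in columns l and r differ.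
  Ω-injective : ∀ {T} → NonAttacking T → ∀ {h h′} → h ≤ αᵢ → h′ ≤ αᵢ → Ω₀ h T ≡ Ω₀ h′ T → h ≡ h′
  Ω-injective {T} naf {h} {h′} h≤ h′≤ e with ℕ.<-cmp h h′
  ... | tri≈ _ h≡h′ _ = h≡h′
  ... | tri< h<h′ _ _ = ⊥-elim (left≢right {T} naf h′≤ (trans (sym (Ω-> h T (leftBox h′ h′≤) h<h′))
    (trans (cong (_⟦ leftBox h′ h′≤ ⟧) e) (trans (Ω-≤ h′ T (leftBox h′ h′≤) ℕ.≤-refl) (cong (T ⟦_⟧) (flip-left h′≤))))))
  ... | tri> _ _ h′<h = ⊥-elim (left≢right {T} naf h≤ (trans (sym (Ω-> h′ T (leftBox h h≤) h′<h))
    (trans (cong (_⟦ leftBox h h≤ ⟧) (sym e)) (trans (Ω-≤ h T (leftBox h h≤) ℕ.≤-refl) (cong (T ⟦_⟧) (flip-left h≤))))))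

  -- All attacking pairs are carried to attacking pairs, except column l in one row against column r
  -- in the next. After the exchange this pair holds b and c if both rows lie at or below h, and b
  -- and d if the lower one is row h; these are the two hypotheses.
  Ω-nonAttacking : ∀ {T h} → NonAttacking T →
    (∀ {k} (k< : k < αᵢ) → k < h → T ⟦ rightBox k (ℕ.<⇒≤ k<) ⟧ ≢ T ⟦ leftBox (suc k) k< ⟧) →
    ((h< : h < αᵢ) → T ⟦ rightBox h (ℕ.<⇒≤ h<) ⟧ ≢ T ⟦ rightBox (suc h) h< ⟧) →
    NonAttacking (Ω₀ h T)
  Ω-nonAttacking {T} {h} naf below across u v att e = go att
    where
    higherRight : ∀ u v → HigherRight u v → Ω₀ h T ⟦ u ⟧ ≢ Ω₀ h T ⟦ v ⟧
    higherRight u@(box j _ k≤) v@(box j′ k _) (refl , j′<j) e with k ℕ.≤? h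
    ... | no  k≰h = naf u v (inj₂ (inj₁ (refl , j′<j)))
      (trans (sym (Ω-> h T u (ℕ.m<n⇒m<1+n (ℕ.≰⇒> k≰h)))) (trans e (Ω-> h T v (ℕ.≰⇒> k≰h))))
    ... | yes k≤h with suc k ℕ.≤? h
    ...   | yes k<h = both (s-< j′<j)
      where
      e′ : T ⟦ flip u ⟧ ≡ T ⟦ flip v ⟧
      e′ = trans (sym (Ω-≤ h T u k<h)) (trans e (Ω-≤ h T v k≤h))
      both : s j′ Fin.< s j ⊎ (j′ ≡ l × j ≡ r) → ⊥
      both (inj₁ <)             = naf (flip u) (flip v) (inj₂ (inj₁ (refl , <))) e′
      both (inj₂ (refl , refl)) = below k< k<h
        (trans (cong (T ⟦_⟧) (sym (flip-left (ℕ.<⇒≤ k<)))) (trans (sym e′) (cong (T ⟦_⟧) (flip-right k<))))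
        where
        -- The bound inside a box is irrelevant, and `recompute` turns it into a usable proof.
        k< : k < αᵢ
        k< = recompute (_ ℕ.≤? _) (ℕ.≤-trans k≤ (ℕ.≤-reflexive (sym αᵢ≡αᵢ₊₁)))
    ...   | no  k≮h = one (s-<ˡ j′<j)
      where
      k≡h : k ≡ h
      k≡h = ℕ.≤-antisym k≤h (ℕ.≤-pred (ℕ.≰⇒> k≮h))
      e′ : T ⟦ u ⟧ ≡ T ⟦ flip v ⟧
      e′ = trans (sym (Ω-> h T u (ℕ.≰⇒> k≮h))) (trans e (Ω-≤ h T v k≤h))
      one : s j′ Fin.< j ⊎ (j′ ≡ l × j ≡ r) → ⊥
      one (inj₁ <)             = naf u (flip v) (inj₂ (inj₁ (refl , <))) e′
      one (inj₂ (refl , refl)) with refl ← k≡h = across k<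
        (trans (cong (T ⟦_⟧) (sym (flip-left (ℕ.<⇒≤ k<)))) (sym e′))
        where
        k< : k < αᵢ
        k< = recompute (_ ℕ.≤? _) (ℕ.≤-trans k≤ (ℕ.≤-reflexive (sym αᵢ≡αᵢ₊₁)))
    sameRow : SameRow u v → ⊥
    sameRow (refl , ne) with row u ℕ.≤? h
    ... | yes ≤h = naf (flip u) (flip v) (inj₁ (refl , λ e → ne (s-injective e)))
      (trans (sym (Ω-≤ h T u ≤h)) (trans e (Ω-≤ h T v ≤h)))
    ... | no  ≰h = naf u v (inj₁ (refl , ne))
      (trans (sym (Ω-> h T u (ℕ.≰⇒> ≰h))) (trans e (Ω-> h T v (ℕ.≰⇒> ≰h))))
    go : Attacking u v → ⊥
    go (inj₁ same)        = sameRow same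
    go (inj₂ (inj₁ u>v)) = higherRight u v u>v e
    go (inj₂ (inj₂ v>u)) = higherRight v u v>u (sym e)

  Ω-basement : ∀ {τ τ′ : Permutation′ (suc m)} {T} h → (∀ j → τ′ ⟨$⟩ʳ j ≡ τ ⟨$⟩ʳ s j) →
               HasBasement τ T → HasBasement τ′ (Ω₀ h T)
  Ω-basement {T = T} h e base j = trans (Ω-≤ h T (box j 0 z≤n) z≤n) (trans (base (s j)) (sym (e j)))

-- Arms under the exchange, and the splitting of the diagram

module ArmGeometry {m : ℕ} (α : Vec ℕ (suc m)) (i : Fin m)
  (αᵢ≡αᵢ₊₁ : lookup α (inject₁ i) ≡ lookup α (Fin.suc i)) where

  open Swapping α i αᵢ≡αᵢ₊₁ using (αᵢ; lookup-sᵢ; Ω₀; leftBox; rightBox)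
  open SwapGeometry α i αᵢ≡αᵢ₊₁

  -- The permutation of boxes through which `Ω₀ h` acts, used to reindex sums over arms.
  φ : ℕ → Box α → Box α
  φ h u with row u ℕ.≤? h
  ... | yes _ = flip u
  ... | no  _ = u

  Ω-φ : ∀ h T u → Ω₀ h T ⟦ u ⟧ ≡ T ⟦ φ h u ⟧
  Ω-φ h T u with row u ℕ.≤? h
  ... | yes ≤h = Ω-≤ h T u ≤h
  ... | no  ≰h = Ω-> h T u (ℕ.≰⇒> ≰h)

  φ-involutive : ∀ h u → φ h (φ h u) ≡ u
  φ-involutive h u with row u ℕ.≤? h in eq
  ... | yes _ rewrite eq = flip-involutive u
  ... | no  _ rewrite eq = refl

  φ-injective : ∀ h {u v} → φ h u ≡ φ h v → u ≡ v
  φ-injective h {u} {v} e = trans (sym (φ-involutive h u)) (trans (cong (φ h) e) (φ-involutive h v))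

  InArm-flip : ∀ {u v : Box α} → col u ≢ l → col u ≢ r → InArm u v → InArm u (flip v)
  InArm-flip {u} {v} u≢l u≢r (inj₁ (e , v<u , αv<αu)) =
    inj₁ (e , [ (λ < → <) , (λ (_ , u≡r) → ⊥-elim (u≢r u≡r)) ]′ (s-<ˡ v<u)
         , subst (_< lookup α (col u)) (sym (lookup-sᵢ (col v))) αv<αu)
  InArm-flip {u} {v} u≢l u≢r (inj₂ (e , u<v , αv≤αu)) =
    inj₂ (e , [ subst (Fin._< s (col v)) (s-other u≢l u≢r) , (λ (u≡l , _) → ⊥-elim (u≢l u≡l)) ]′ (s-< u<v)
         , subst (_≤ lookup α (col u)) (sym (lookup-sᵢ (col v))) αv≤αu)

  InArm-φ : ∀ h {u v : Box α} → col u ≢ l → col u ≢ r → InArm u v → InArm u (φ h v)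
  InArm-φ h {u} {v} u≢l u≢r v∈ with row v ℕ.≤? h
  ... | yes _ = InArm-flip {u} {v} u≢l u≢r v∈
  ... | no  _ = v∈

  Arm-φ : ∀ h (u : Box α) → col u ≢ l → col u ≢ r → map (φ h) (Arm u) ↭ Arm u
  Arm-φ h u u≢l u≢r = unique-↭ (Unique.map⁺ (φ-injective h) (Arm-unique u)) (Arm-unique u) to from
    where
    φ∈ : ∀ {v} → v ∈ Arm u → φ h v ∈ Arm u
    φ∈ {v} v∈ = ∈-Arm⁺ {u = u} (InArm-φ h {u} {v} u≢l u≢r (∈-Arm⁻ {u = u} v∈))
    to : ∀ {v} → v ∈ map (φ h) (Arm u) → v ∈ Arm u
    to v∈ with w , w∈ , refl ← ∈-map⁻ (φ h) v∈ = φ∈ w∈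
    from : ∀ {v} → v ∈ Arm u → v ∈ map (φ h) (Arm u)
    from {v} v∈ = subst (_∈ map (φ h) (Arm u)) (φ-involutive h v) (∈-map⁺ (φ h) (φ∈ v∈))

  -- Column l lies to the left of r but is not strictly shorter, which a left arm requires. Hence
  -- the exchange never touches an entry in the arm of the right box.
  InArm-right-other : ∀ {k} .(k≤ : k ≤ αᵢ) {v : Box α} → InArm (rightBox k k≤) v → col v ≢ l × col v ≢ r
  InArm-right-other k≤ (inj₁ (_ , v<r , αv<αr)) =
    (λ { refl → ℕ.<-irrefl αᵢ≡αᵢ₊₁ αv<αr }) , (λ { refl → ℕ.<-irrefl refl v<r })
  InArm-right-other k≤ (inj₂ (_ , r<v , _)) =
    (λ { refl → ℕ.<-asym r<v l<r }) , (λ { refl → ℕ.<-irrefl refl r<v })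

  InArm-left⁻ : ∀ {k} .(k≤ : k ≤ αᵢ) {v : Box α} → InArm (leftBox k k≤) v →
                v ≡ rightBox k k≤ ⊎ InArm (rightBox k k≤) v
  InArm-left⁻ k≤ {v} (inj₁ (e , v<l , αv<αl)) =
    inj₂ (inj₁ (e , ℕ.<-trans v<l l<r , subst (lookup α (col v) <_) αᵢ≡αᵢ₊₁ αv<αl))
  InArm-left⁻ k≤ {v} (inj₂ (e , l<v , αv≤αl)) with col v Fin.≟ r
  ... | yes v≡r = inj₁ (box-≡ v≡r e)
  ... | no  v≢r = inj₂ (inj₂ (e
    , ℕ.≤∧≢⇒< (subst (ℕ._≤ toℕ (col v)) (sym toℕ-r) l<v) (λ e → v≢r (Fin.toℕ-injective (sym e)))
    , subst (lookup α (col v) ≤_) αᵢ≡αᵢ₊₁ αv≤αl))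

  InArm-left⁺ : ∀ {k} .(k≤ : k ≤ αᵢ) {v : Box α} → InArm (rightBox k k≤) v → InArm (leftBox k k≤) v
  InArm-left⁺ k≤ {v} v∈@(inj₁ (e , v<r , αv<αr)) =
    inj₁ (e , ℕ.≤∧≢⇒< (ℕ.≤-pred (subst (toℕ (col v) ℕ.<_) toℕ-r v<r))
                (λ e → proj₁ (InArm-right-other k≤ {v} v∈) (Fin.toℕ-injective e))
           , subst (lookup α (col v) <_) (sym αᵢ≡αᵢ₊₁) αv<αr)
  InArm-left⁺ k≤ {v} (inj₂ (e , r<v , αv≤αr)) =
    inj₂ (e , ℕ.<-trans l<r r<v , subst (lookup α (col v) ≤_) (sym αᵢ≡αᵢ₊₁) αv≤αr)

  -- Left arms ask for strictly shorter columns and right arms for columns at most as high. With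
  -- equal heights, the right box is in the arm of the left one but not conversely; all other
  -- columns compare alike with both.
  Arm-left : ∀ {k} .(k≤ : k ≤ αᵢ) → Arm (leftBox k k≤) ↭ rightBox k k≤ ∷ Arm (rightBox k k≤)
  Arm-left {k} k≤ = unique-↭ (Arm-unique L)
    (All.tabulate (λ {v} v∈ e → proj₂ (InArm-right-other k≤ {v} (∈-Arm⁻ {u = R} v∈)) (cong col (sym e))) ∷ Arm-unique R)
    to from
    where
    L R : Box α
    L = leftBox k k≤
    R = rightBox k k≤
    to : ∀ {v} → v ∈ Arm L → v ∈ R ∷ Arm R
    to {v} v∈ with InArm-left⁻ k≤ {v} (∈-Arm⁻ {u = L} v∈)
    ... | inj₁ v≡R = here v≡R
    ... | inj₂ v∈R = there (∈-Arm⁺ {u = R} v∈R)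
    from : ∀ {v} → v ∈ R ∷ Arm R → v ∈ Arm L
    from (here refl)    = ∈-Arm⁺ {u = L} {v = R} (inj₂ (refl , l<r , ℕ.≤-reflexive (sym αᵢ≡αᵢ₊₁)))
    from {v} (there v∈) = ∈-Arm⁺ {u = L} (InArm-left⁺ k≤ {v} (∈-Arm⁻ {u = R} v∈))

  lefts rights others : List (Box α)
  lefts  = map (λ k → leftBox (suc (toℕ k)) (Fin.toℕ<n k)) (allFin αᵢ)
  rights = map (λ k → rightBox (suc (toℕ k)) (Fin.toℕ<n k)) (allFin αᵢ)
  others = filter (λ u → ¬? (col u Fin.≟ l) ×-dec ¬? (col u Fin.≟ r)) (dg α)

  others⁻ : ∀ {u} → u ∈ others → col u ≢ l × col u ≢ r
  others⁻ {u} u∈ = proj₂ (∈-filter⁻ (λ u → ¬? (col u Fin.≟ l) ×-dec ¬? (col u Fin.≟ r)) {xs = dg α} u∈)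

  dg-split : dg α ↭ lefts ++ rights ++ others
  dg-split = unique-↭ dg-unique
    (Unique.++⁺ (Unique.map⁺ (λ e → Fin.toℕ-injective (ℕ.suc-injective (cong row e))) (Unique.allFin⁺ αᵢ))
      (Unique.++⁺ (Unique.map⁺ (λ e → Fin.toℕ-injective (ℕ.suc-injective (cong row e))) (Unique.allFin⁺ αᵢ))
        (Unique.filter⁺ _ dg-unique)
        (λ {u} (u∈r , u∈o) → proj₂ (others⁻ {u} u∈o) (rights-col u∈r)))
      (λ {u} (u∈l , u∈ro) → [ (λ u∈r → l≢r (trans (sym (lefts-col u∈l)) (rights-col u∈r)))
                        , (λ u∈o → proj₁ (others⁻ {u} u∈o) (lefts-col u∈l)) ]′ (∈-++⁻ rights u∈ro)))
    (λ {u} u∈ → to u (proj₂ (∈-filter⁻ (λ u → 1 ℕ.≤? row u) {xs = adg α} u∈)) u∈)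
    (λ u∈ → [ from-lefts
            , (λ u∈ → [ from-rights , (λ u∈ → proj₁ (∈-filter⁻ _ {xs = dg α} u∈)) ]′ (∈-++⁻ rights u∈))
            ]′ (∈-++⁻ lefts u∈))
    where
    lefts-col : ∀ {u} → u ∈ lefts → col u ≡ l
    lefts-col u∈ with _ , _ , refl ← ∈-map⁻ _ u∈ = refl
    rights-col : ∀ {u} → u ∈ rights → col u ≡ r
    rights-col u∈ with _ , _ , refl ← ∈-map⁻ _ u∈ = refl
    ∈-dg : ∀ {u} → 1 ≤ row u → u ∈ dg α
    ∈-dg {u} 1≤ = ∈-filter⁺ (λ u → 1 ℕ.≤? row u) (∈-adg α u) 1≤
    from-lefts : ∀ {u} → u ∈ lefts → u ∈ dg α
    from-lefts u∈ with k , _ , refl ← ∈-map⁻ _ u∈ = ∈-dg {leftBox (suc (toℕ k)) (Fin.toℕ<n k)} (s≤s z≤n)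
    from-rights : ∀ {u} → u ∈ rights → u ∈ dg α
    from-rights u∈ with k , _ , refl ← ∈-map⁻ _ u∈ = ∈-dg {rightBox (suc (toℕ k)) (Fin.toℕ<n k)} (s≤s z≤n)
    to : ∀ u → 1 ≤ row u → u ∈ dg α → u ∈ lefts ++ rights ++ others
    to u@(box j (suc k) k<) 1≤ u∈ with view j
    ... | left = ∈-++⁺ˡ
      (subst (_∈ lefts) (box-≡ refl (cong suc (Fin.toℕ-fromℕ< k<′))) (∈-map⁺ _ (∈-allFin (fromℕ< k<′))))
      where
      k<′ : k < αᵢ
      k<′ = recompute (_ ℕ.≤? _) k<
    ... | right = ∈-++⁺ʳ lefts (∈-++⁺ˡ
      (subst (_∈ rights) (box-≡ refl (cong suc (Fin.toℕ-fromℕ< k<′))) (∈-map⁺ _ (∈-allFin (fromℕ< k<′)))))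
      where
      k<′ : k < αᵢ
      k<′ = recompute (_ ℕ.≤? _) (ℕ.≤-trans k< (ℕ.≤-reflexive (sym αᵢ≡αᵢ₊₁)))
    ... | other j≢l j≢r = ∈-++⁺ʳ lefts (∈-++⁺ʳ rights (∈-filter⁺ _ u∈ (j≢l , j≢r)))

-- The balance equation

module StopProbability {c ℓ} (R : CommutativeRing c ℓ) where

  open CommutativeRing R renaming (refl to ≈-refl; sym to ≈-sym; trans to ≈-trans)
  open RingProperties ring using (-0#≈0#)
  module Π = Fold *-commutativeMonoid

  -- The probability that a process which survives step k with probability f k
  -- stops exactly at step h.
  stopAt : (ℕ → Carrier) → ℕ → Carrier
  stopAt f h = Π.⨁ (upTo h) f * (1# - f h)

  -- The share of step k in `stopAt f h`. The recursion shifts f, as the induction in `∏-factors`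
  -- does.
  factor : (ℕ → Carrier) → ℕ → ℕ → Carrier
  factor f zero    zero    = 1# - f 0
  factor f zero    (suc k) = 1#
  factor f (suc h) zero    = f 0
  factor f (suc h) (suc k) = factor (f ∘ suc) h k

  factor-< : ∀ f {h k} → k < h → factor f h k ≡ f k
  factor-< f {suc h} {zero}  _         = refl
  factor-< f {suc h} {suc k} (s≤s k<h) = factor-< (f ∘ suc) k<h

  factor-≡ : ∀ f h → factor f h h ≡ 1# - f h
  factor-≡ f zero    = refl
  factor-≡ f (suc h) = factor-≡ (f ∘ suc) h

  factor-> : ∀ f {h k} → h < k → factor f h k ≡ 1#
  factor-> f {zero}  {suc k} _         = refl
  factor-> f {suc h} {suc k} (s≤s h<k) = factor-> (f ∘ suc) h<k

  private
    ∏ᴿ : List Carrier → Carrier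
    ∏ᴿ = foldr _*_ 1#

    ∏-1 : ∀ H → ∏ᴿ (List.tabulate {n = H} (λ _ → 1#)) ≈ 1#
    ∏-1 zero    = ≈-refl
    ∏-1 (suc H) = ≈-trans (*-identityˡ _) (∏-1 H)

    ∏-factors : ∀ f h H → h ≤ H → f H ≈ 0# →
      ∏ᴿ (applyUpTo f h) * (1# - f h) ≈ ∏ᴿ (List.tabulate {n = H} (λ k → factor f h (toℕ k)))
    -- Stopping at h = H leaves 1 - f H without a step of its own; it equals 1 because f H is 0.
    ∏-factors f zero zero _ e =
      ≈-trans (*-identityˡ _) (≈-trans (+-congˡ (≈-trans (-‿cong e) -0#≈0#)) (+-identityʳ 1#))
    ∏-factors f zero (suc H) _ e = ≈-trans (*-comm _ _) (*-congˡ (≈-sym (∏-1 H)))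
    ∏-factors f (suc h) (suc H) (s≤s h≤H) e = ≈-trans (*-assoc _ _ _) (*-congˡ (∏-factors (f ∘ suc) h H h≤H e))

  stopAt-factors : ∀ f h H → h ≤ H → f H ≈ 0# → stopAt f h ≈ Π.⨁ (allFin H) (λ k → factor f h (toℕ k))
  stopAt-factors f h H h≤H e = ≈-trans (*-congʳ (reflexive (cong ∏ᴿ (List.map-upTo f h))))
    (≈-trans (∏-factors f h H h≤H e)
      (reflexive (cong ∏ᴿ (sym (List.map-tabulate {n = H} (λ k → k) (λ k → factor f h (toℕ k)))))))

-- The weight as a product over boxes

module Weight {c ℓ} {R : CommutativeRing c ℓ} (W : Rates R) where

  open CommutativeRing R renaming (refl to ≈-refl; sym to ≈-sym; trans to ≈-trans)
  open Exp semiring using (_^_; ^-homo-*; ^-congʳ)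
  open Rates W
  open LocalBalance W
  open StopProbability R using (module Π)
  open SetoidReasoning setoid

  ^-⨁ : {A : Set} (x : Carrier) (us : List A) (f : A → ℕ) → x ^ ℕ+.⨁ us f ≈ Π.⨁ us (λ u → x ^ f u)
  ^-⨁ x []       f = ≈-refl
  ^-⨁ x (u ∷ us) f = ≈-trans (^-homo-* x (f u) (ℕ+.⨁ us f)) (*-congˡ (^-⨁ x us f))

  module _ {n : ℕ} {α : Vec ℕ n} where

    coAt : Filling α → Box α → ℕ
    coAt T u = ℕ+.⨁ (Arm u) (λ v → co (T ⟦ u ⟧) (T ⟦ v ⟧) (T ⟦ south u ⟧))

    boxWt : Filling α → Box α → Carrier
    boxWt T u = monomial (leg u) (χ (T ⟦ u ⟧) (T ⟦ south u ⟧)) (coAt T u) * φ (T ⟦ u ⟧) (T ⟦ south u ⟧) (leg u) (arm u)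

    -- Over `𝕂-rates` this is `wt` by definition, so that results on an abstract ring apply to `wt`
    -- directly.
    weight : Filling α → Carrier
    weight T = q ^ maj T * t ^ coinv T *
      Π.⨁ (filter (λ u → ¬? (T ⟦ u ⟧ Fin.≟ T ⟦ south u ⟧)) (dg α)) (λ u → fac (leg u) (arm u))

    maj-boxes : ∀ T → maj T ≡ ℕ+.⨁ (dg α) (λ u → χ (T ⟦ u ⟧) (T ⟦ south u ⟧) ℕ.* suc (leg u))
    maj-boxes T = trans (ℕ+.⨁-filter (λ u → T ⟦ south u ⟧ Fin.<? T ⟦ u ⟧) (dg α) (λ u → leg u ℕ.+ 1))
      (ℕ+.⨁-cong (dg α) (λ u → indicator (does (T ⟦ south u ⟧ Fin.<? T ⟦ u ⟧)) (leg u)))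
      where
      indicator : ∀ b x → (if b then x ℕ.+ 1 else 0) ≡ (if b then 1 else 0) ℕ.* suc x
      indicator true  x = trans (ℕ.+-comm x 1) (sym (ℕ.*-identityˡ (suc x)))
      indicator false x = refl

    coinversions : ∀ (T : Filling α) u vs →
      length (filter (λ v → ¬? (χ₃ (T ⟦ u ⟧) (T ⟦ v ⟧) (T ⟦ south u ⟧) ℕ.≟ 1)) vs)
      ≡ ℕ+.⨁ vs (λ v → co (T ⟦ u ⟧) (T ⟦ v ⟧) (T ⟦ south u ⟧))
    coinversions T u [] = refl
    coinversions T u (v ∷ vs) with χ₃ (T ⟦ u ⟧) (T ⟦ v ⟧) (T ⟦ south u ⟧) | χ₃≤1 (T ⟦ u ⟧) (T ⟦ v ⟧) (T ⟦ south u ⟧)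
    ... | zero        | _ = cong suc (coinversions T u vs)
    ... | suc zero    | _ = coinversions T u vs
    ... | suc (suc _) | s≤s ()

    coinv-boxes : ∀ T → coinv T ≡ ℕ+.⨁ (dg α) (coAt T)
    coinv-boxes T = ℕ+.⨁-cong (dg α) (λ u → coinversions T u (Arm u))

    weight-boxes : ∀ T → weight T ≈ Π.⨁ (dg α) (boxWt T)
    weight-boxes T = begin
      weight T
        ≈⟨ *-cong (*-cong
             (≈-trans (^-congʳ q (maj-boxes T)) (^-⨁ q (dg α) _))
             (≈-trans (^-congʳ t (coinv-boxes T)) (^-⨁ t (dg α) _)))
             (Π.⨁-filter (λ u → ¬? (T ⟦ u ⟧ Fin.≟ T ⟦ south u ⟧)) (dg α) (λ u → fac (leg u) (arm u))) ⟩
      Π.⨁ (dg α) (λ u → q ^ (χ (T ⟦ u ⟧) (T ⟦ south u ⟧) ℕ.* suc (leg u))) * Π.⨁ (dg α) (λ u → t ^ coAt T u)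
        * Π.⨁ (dg α) (λ u → φ (T ⟦ u ⟧) (T ⟦ south u ⟧) (leg u) (arm u))
        ≈⟨ *-congʳ (Π.⨁-∙ (dg α) _ _) ⟨
      Π.⨁ (dg α) (λ u → monomial (leg u) (χ (T ⟦ u ⟧) (T ⟦ south u ⟧)) (coAt T u))
        * Π.⨁ (dg α) (λ u → φ (T ⟦ u ⟧) (T ⟦ south u ⟧) (leg u) (arm u))
        ≈⟨ Π.⨁-∙ (dg α) _ _ ⟨
      Π.⨁ (dg α) (boxWt T) ∎

-- The balance equation row by row

module Balance {ℓ₁ ℓ₂} {R : CommutativeRing ℓ₁ ℓ₂} (W : Rates R)
  {m : ℕ} (α : Vec ℕ (suc m)) (i : Fin m)
  (αᵢ≡αᵢ₊₁ : lookup α (inject₁ i) ≡ lookup α (Fin.suc i)) where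

  open CommutativeRing R renaming (refl to ≈-refl; sym to ≈-sym; trans to ≈-trans)
  open Rates W
  open LocalBalance W
  open StopProbability R
  open Weight W
  open Swapping α i αᵢ≡αᵢ₊₁ using (αᵢ; Ω₀; leftBox; rightBox)
  open SwapGeometry α i αᵢ≡αᵢ₊₁
  open ArmGeometry α i αᵢ≡αᵢ₊₁ renaming (φ to φᴮ)
  open SetoidReasoning setoid
  open NaturalSolver commutativeSemiring using (solve; _:*_; _:=_)

  -- The entries read along the arm are permuted by `Arm-φ`, while those of the box and of the box
  -- south of it stay.
  coAt-other : ∀ h T u → col u ≢ l → col u ≢ r → coAt (Ω₀ h T) u ≡ coAt T u
  coAt-other h T u u≢l u≢r = trans
    (ℕ+.⨁-cong (Arm u) (λ v → trans
      (cong₂ (λ x y → co x y (Ω₀ h T ⟦ south u ⟧)) (Ω-other h T u u≢l u≢r) (Ω-φ h T v))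
      (cong (co (T ⟦ u ⟧) (T ⟦ φᴮ h v ⟧)) (Ω-other h T (south u) u≢l u≢r))))
    (trans (sym (ℕ+.⨁-map (φᴮ h) (Arm u) (λ v → co (T ⟦ u ⟧) (T ⟦ v ⟧) (T ⟦ south u ⟧))))
      (ℕ+.⨁-↭ _ (Arm-φ h u u≢l u≢r)))

  boxWt-other : ∀ h T u → col u ≢ l → col u ≢ r → boxWt (Ω₀ h T) u ≡ boxWt T u
  boxWt-other h T u u≢l u≢r
    rewrite coAt-other h T u u≢l u≢r | Ω-other h T u u≢l u≢r | Ω-other h T (south u) u≢l u≢r = refl

  armEntries : Filling α → ∀ {k} → .(k < αᵢ) → List (Fin (suc m))
  armEntries T {k} k< = map (T ⟦_⟧) (Arm (rightBox (suc k) k<))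

  armEntries-Ω : ∀ h T {k} .(k< : k < αᵢ) → armEntries (Ω₀ h T) k< ≡ armEntries T k<
  armEntries-Ω h T {k} k< = List.map-cong-local (All.tabulate (λ {v} v∈ →
    let v≢l , v≢r = InArm-right-other k< {v} (∈-Arm⁻ {u = rb} v∈) in Ω-other h T v v≢l v≢r))
    where
    rb : Box α
    rb = rightBox (suc k) k<

  rowWt : Filling α → ∀ {k} → .(k < αᵢ) → Carrier
  rowWt T {k} k< = boxWt T (leftBox (suc k) k<) * boxWt T (rightBox (suc k) k<)

  rowWt-pairWt : ∀ T {k} .(k< : k < αᵢ) → rowWt T k< ≈
    pairWt (armEntries T k<) (leg (rightBox (suc k) k<))
      (T ⟦ leftBox k (ℕ.<⇒≤ k<) ⟧) (T ⟦ rightBox k (ℕ.<⇒≤ k<) ⟧) (T ⟦ leftBox (suc k) k< ⟧) (T ⟦ rightBox (suc k) k< ⟧)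
  rowWt-pairWt T {k} k< = begin
    boxWt T lb * boxWt T rb
      ≈⟨ *-congʳ (*-cong (reflexive (cong₂ (λ x → monomial x (χ c a)) leg≡ coL)) (reflexive (cong₂ (φ c a) leg≡ armL))) ⟩
    (monomial ℓ′ (χ c a) (co c d a ℕ.+ NL) * φ c a ℓ′ (suc (arm rb))) * (monomial ℓ′ (χ d b) NR * φ d b ℓ′ (arm rb))
      ≈⟨ solve 4 (λ x f y g → (x :* f) :* (y :* g) := (x :* y) :* (f :* g)) ≈-refl _ _ _ _ ⟩
    (monomial ℓ′ (χ c a) (co c d a ℕ.+ NL) * monomial ℓ′ (χ d b) NR) * (φ c a ℓ′ (suc (arm rb)) * φ d b ℓ′ (arm rb))
      ≈⟨ *-congʳ (monomial-+ ℓ′ (χ c a) (co c d a ℕ.+ NL) (χ d b) NR) ⟨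
    monomial ℓ′ (χ c a ℕ.+ χ d b) (co c d a ℕ.+ NL ℕ.+ NR) * (φ c a ℓ′ (suc (arm rb)) * φ d b ℓ′ (arm rb))
      ≈⟨ *-cong (reflexive (cong (monomial ℓ′ (χ c a ℕ.+ χ d b)) (trans (ℕ.+-assoc (co c d a) NL NR) (cong (co c d a ℕ.+_) N≡))))
           (reflexive (cong (λ x → φ c a ℓ′ (suc x) * φ d b ℓ′ x) (sym (List.length-map (T ⟦_⟧) (Arm rb))))) ⟩
    pairWt (armEntries T k<) ℓ′ a b c d ∎
    where
    lb rb : Box α
    lb = leftBox (suc k) k<
    rb = rightBox (suc k) k<
    a b c d : Fin (suc m)
    a = T ⟦ leftBox k (ℕ.<⇒≤ k<) ⟧
    b = T ⟦ rightBox k (ℕ.<⇒≤ k<) ⟧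
    c = T ⟦ lb ⟧
    d = T ⟦ rb ⟧
    ℓ′ NL NR : ℕ
    ℓ′ = leg rb
    NL = ℕ+.⨁ (Arm rb) (λ v → co c (T ⟦ v ⟧) a)
    NR = ℕ+.⨁ (Arm rb) (λ v → co d (T ⟦ v ⟧) b)
    leg≡ : leg lb ≡ ℓ′
    leg≡ = cong (_∸ suc k) αᵢ≡αᵢ₊₁
    armL : arm lb ≡ suc (arm rb)
    armL = ↭-length (Arm-left k<)
    coL : coAt T lb ≡ co c d a ℕ.+ NL
    coL = ℕ+.⨁-↭ (λ v → co c (T ⟦ v ⟧) a) (Arm-left k<)
    N≡ : NL ℕ.+ NR ≡ ∑co (armEntries T k<) a b c d
    N≡ = trans (sym (ℕ+.⨁-∙ (Arm rb) _ _)) (sym (ℕ+.⨁-map (T ⟦_⟧) (Arm rb) (λ v → co c v a ℕ.+ co d v b)))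

  weight-rows : ∀ T → weight T ≈
    Π.⨁ (allFin αᵢ) (λ k → rowWt T (Fin.toℕ<n k)) * Π.⨁ others (boxWt T)
  weight-rows T = begin
    weight T
      ≈⟨ weight-boxes T ⟩
    Π.⨁ (dg α) (boxWt T)
      ≈⟨ Π.⨁-↭ (boxWt T) dg-split ⟩
    Π.⨁ (lefts ++ rights ++ others) (boxWt T)
      ≈⟨ ≈-trans (Π.⨁-++ lefts (rights ++ others) (boxWt T)) (*-congˡ (Π.⨁-++ rights others (boxWt T))) ⟩
    Π.⨁ lefts (boxWt T) * (Π.⨁ rights (boxWt T) * Π.⨁ others (boxWt T))
      ≈⟨ *-assoc _ _ _ ⟨
    Π.⨁ lefts (boxWt T) * Π.⨁ rights (boxWt T) * Π.⨁ others (boxWt T)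
      ≈⟨ *-congʳ (*-cong (reflexive (Π.⨁-map _ (allFin αᵢ) (boxWt T))) (reflexive (Π.⨁-map _ (allFin αᵢ) (boxWt T)))) ⟩
    Π.⨁ (allFin αᵢ) (λ k → boxWt T (leftBox (suc (toℕ k)) (Fin.toℕ<n k)))
      * Π.⨁ (allFin αᵢ) (λ k → boxWt T (rightBox (suc (toℕ k)) (Fin.toℕ<n k))) * Π.⨁ others (boxWt T)
      ≈⟨ *-congʳ (Π.⨁-∙ (allFin αᵢ) _ _) ⟨
    Π.⨁ (allFin αᵢ) (λ k → rowWt T (Fin.toℕ<n k)) * Π.⨁ others (boxWt T) ∎

  rateAt : Filling α → ∀ {k} → .(k < αᵢ) → Carrier
  rateAt T {k} k< = rate
    (T ⟦ leftBox k (ℕ.<⇒≤ k<) ⟧) (T ⟦ rightBox k (ℕ.<⇒≤ k<) ⟧) (T ⟦ leftBox (suc k) k< ⟧) (T ⟦ rightBox (suc k) k< ⟧)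
    (arm (rightBox (suc k) k<)) (leg (rightBox (suc k) k<))

  module _ (ρ : Filling α → ℕ → Carrier)
    (ρ-rate : ∀ T {k} (k< : k < αᵢ) → ρ T k ≈ rateAt T k<)
    (ρ-top : ∀ T → ρ T αᵢ ≈ 0#) where

    module _ {h : ℕ} {T : Filling α} (naf : NonAttacking T) (nafΩ : NonAttacking (Ω₀ h T)) where

      private
        U : Filling α
        U = Ω₀ h T

        length≡ : ∀ T {k} .(k< : k < αᵢ) → length (armEntries T k<) ≡ arm (rightBox (suc k) k<)
        length≡ T {k} k< = List.length-map (T ⟦_⟧) (Arm (rightBox (suc k) k<))

        rateAt-length : ∀ T {k} .(k< : k < αᵢ) → rateAt T k< ≡ rate
          (T ⟦ leftBox k (ℕ.<⇒≤ k<) ⟧) (T ⟦ rightBox k (ℕ.<⇒≤ k<) ⟧) (T ⟦ leftBox (suc k) k< ⟧) (T ⟦ rightBox (suc k) k< ⟧)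
          (length (armEntries T k<)) (leg (rightBox (suc k) k<))
        rateAt-length T {k} k< = cong (λ A → rate
          (T ⟦ leftBox k (ℕ.<⇒≤ k<) ⟧) (T ⟦ rightBox k (ℕ.<⇒≤ k<) ⟧) (T ⟦ leftBox (suc k) k< ⟧) (T ⟦ rightBox (suc k) k< ⟧)
          A (leg (rightBox (suc k) k<))) (sym (length≡ T k<))

        U-left : ∀ {k} .(k≤ : k ≤ αᵢ) → k ≤ h → U ⟦ leftBox k k≤ ⟧ ≡ T ⟦ rightBox k k≤ ⟧
        U-left k≤ k≤h = trans (Ω-≤ h T (leftBox _ k≤) k≤h) (cong (T ⟦_⟧) (flip-left k≤))

        U-right : ∀ {k} .(k≤ : k ≤ αᵢ) → k ≤ h → U ⟦ rightBox k k≤ ⟧ ≡ T ⟦ leftBox k k≤ ⟧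
        U-right k≤ k≤h = trans (Ω-≤ h T (rightBox _ k≤) k≤h) (cong (T ⟦_⟧) (flip-right k≤))

      row-below : ∀ {k} (k< : k < αᵢ) → k < h → rowWt T k< * rateAt T k< ≈ rowWt U k< * rateAt U k<
      row-below {k} k< k<h = begin
        rowWt T k< * rateAt T k<
          ≈⟨ *-cong (rowWt-pairWt T k<) (reflexive (rateAt-length T k<)) ⟩
        _
          ≈⟨ swapBoth vs ℓ′ (left≢right {T} naf (ℕ.<⇒≤ k<)) (left≢right {T} naf k<) (left≢upperRight {T} naf k<)
               -- In U the left box of row k carries b and the right box of row k + 1 carries c.
               -- They attack each other, so b and c differ.
               (λ e → left≢upperRight {U} nafΩ k< (trans (U-left (ℕ.<⇒≤ k<) (ℕ.<⇒≤ k<h)) (trans e (sym (U-right k< k<h))))) ⟩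
        pairWt vs ℓ′ b a d c * rate b a d c (length vs) ℓ′
          ≡⟨ cong₅ (λ vs a b c d → pairWt vs ℓ′ a b c d * rate a b c d (length vs) ℓ′) (armEntries-Ω h T k<)
                (U-left (ℕ.<⇒≤ k<) (ℕ.<⇒≤ k<h)) (U-right (ℕ.<⇒≤ k<) (ℕ.<⇒≤ k<h)) (U-left k< k<h) (U-right k< k<h) ⟨
        _
          ≈⟨ *-cong (rowWt-pairWt U k<) (reflexive (rateAt-length U k<)) ⟨
        rowWt U k< * rateAt U k< ∎
        where
        vs : List (Fin (suc m))
        vs = armEntries T k<
        ℓ′ : ℕ
        ℓ′ = leg (rightBox (suc k) k<)
        a b c d : Fin (suc m)
        a = T ⟦ leftBox k (ℕ.<⇒≤ k<) ⟧
        b = T ⟦ rightBox k (ℕ.<⇒≤ k<) ⟧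
        c = T ⟦ leftBox (suc k) k< ⟧
        d = T ⟦ rightBox (suc k) k< ⟧

      row-at : (h< : h < αᵢ) → rowWt T h< * (1# - rateAt T h<) ≈ rowWt U h< * (1# - rateAt U h<)
      row-at h< = begin
        rowWt T h< * (1# - rateAt T h<)
          ≈⟨ *-cong (rowWt-pairWt T h<) (reflexive (cong (λ x → 1# - x) (rateAt-length T h<))) ⟩
        _
          ≈⟨ swapLower vs ℓ′ (left≢right {T} naf (ℕ.<⇒≤ h<)) (left≢right {T} naf h<) (left≢upperRight {T} naf h<)
               -- In U the left box of row h carries b, and the right box of the unexchanged row
               -- above still carries d, so b and d differ.
               (λ e → left≢upperRight {U} nafΩ h< (trans (U-left (ℕ.<⇒≤ h<) ℕ.≤-refl)
                 (trans e (sym (Ω-> h T (rightBox (suc h) h<) ℕ.≤-refl))))) ⟩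
        pairWt vs ℓ′ b a c d * (1# - rate b a c d (length vs) ℓ′)
          ≡⟨ cong₅ (λ vs a b c d → pairWt vs ℓ′ a b c d * (1# - rate a b c d (length vs) ℓ′)) (armEntries-Ω h T h<)
                (U-left (ℕ.<⇒≤ h<) ℕ.≤-refl) (U-right (ℕ.<⇒≤ h<) ℕ.≤-refl)
               (Ω-> h T (leftBox (suc h) h<) ℕ.≤-refl) (Ω-> h T (rightBox (suc h) h<) ℕ.≤-refl) ⟨
        _
          ≈⟨ *-cong (rowWt-pairWt U h<) (reflexive (cong (λ x → 1# - x) (rateAt-length U h<))) ⟨
        rowWt U h< * (1# - rateAt U h<) ∎
        where
        vs : List (Fin (suc m))
        vs = armEntries T h<
        ℓ′ : ℕ
        ℓ′ = leg (rightBox (suc h) h<)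
        a b c d : Fin (suc m)
        a = T ⟦ leftBox h (ℕ.<⇒≤ h<) ⟧
        b = T ⟦ rightBox h (ℕ.<⇒≤ h<) ⟧
        c = T ⟦ leftBox (suc h) h< ⟧
        d = T ⟦ rightBox (suc h) h< ⟧

      row-above : ∀ {k} (k< : k < αᵢ) → h < k → rowWt T k< ≈ rowWt U k<
      row-above {k} k< h<k = ≈-trans (rowWt-pairWt T k<) (≈-trans (reflexive (sym (cong₅ (λ vs → pairWt vs ℓ′)
        (armEntries-Ω h T k<) (Ω-> h T (leftBox k (ℕ.<⇒≤ k<)) h<k) (Ω-> h T (rightBox k (ℕ.<⇒≤ k<)) h<k)
        (Ω-> h T (leftBox (suc k) k<) (ℕ.m<n⇒m<1+n h<k)) (Ω-> h T (rightBox (suc k) k<) (ℕ.m<n⇒m<1+n h<k)))))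
        (≈-sym (rowWt-pairWt U k<)))
        where
        ℓ′ : ℕ
        ℓ′ = leg (rightBox (suc k) k<)

      row-factor : ∀ {k} (k< : k < αᵢ) → rowWt T k< * factor (ρ T) h k ≈ rowWt U k< * factor (ρ U) h k
      row-factor {k} k< with ℕ.<-cmp k h
      ... | tri< k<h _ _ = ≈-trans (*-congˡ (≈-trans (reflexive (factor-< (ρ T) k<h)) (ρ-rate T k<)))
        (≈-trans (row-below k< k<h) (≈-sym (*-congˡ (≈-trans (reflexive (factor-< (ρ U) k<h)) (ρ-rate U k<)))))
      ... | tri≈ _ refl _ = ≈-trans (*-congˡ (≈-trans (reflexive (factor-≡ (ρ T) k)) (+-congˡ (-‿cong (ρ-rate T k<)))))
        (≈-trans (row-at k<) (≈-sym (*-congˡ (≈-trans (reflexive (factor-≡ (ρ U) k)) (+-congˡ (-‿cong (ρ-rate U k<)))))))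
      ... | tri> _ _ h<k = *-cong (row-above k< h<k) (reflexive (trans (factor-> (ρ T) h<k) (sym (factor-> (ρ U) h<k))))

      balance : h ≤ αᵢ → weight T * stopAt (ρ T) h ≈ weight U * stopAt (ρ U) h
      balance h≤ = begin
        weight T * stopAt (ρ T) h
          ≈⟨ *-cong (weight-rows T) (stopAt-factors (ρ T) h αᵢ h≤ (ρ-top T)) ⟩
        Π.⨁ (allFin αᵢ) (λ k → rowWt T (Fin.toℕ<n k)) * Π.⨁ others (boxWt T) * Π.⨁ (allFin αᵢ) (λ k → factor (ρ T) h (toℕ k))
          ≈⟨ regroup T ⟩
        Π.⨁ (allFin αᵢ) (λ k → rowWt T (Fin.toℕ<n k) * factor (ρ T) h (toℕ k)) * Π.⨁ others (boxWt T)
          ≈⟨ *-cong (Π.⨁-cong (allFin αᵢ) (λ k → row-factor (Fin.toℕ<n k)))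
               (Π.⨁-cong-∈ others (λ {u} u∈ → let u≢l , u≢r = others⁻ {u} u∈ in reflexive (sym (boxWt-other h T u u≢l u≢r)))) ⟩
        Π.⨁ (allFin αᵢ) (λ k → rowWt U (Fin.toℕ<n k) * factor (ρ U) h (toℕ k)) * Π.⨁ others (boxWt U)
          ≈⟨ regroup U ⟨
        Π.⨁ (allFin αᵢ) (λ k → rowWt U (Fin.toℕ<n k)) * Π.⨁ others (boxWt U) * Π.⨁ (allFin αᵢ) (λ k → factor (ρ U) h (toℕ k))
          ≈⟨ *-cong (weight-rows U) (stopAt-factors (ρ U) h αᵢ h≤ (ρ-top U)) ⟨
        weight U * stopAt (ρ U) h ∎
        where
        regroup : ∀ T →
          Π.⨁ (allFin αᵢ) (λ k → rowWt T (Fin.toℕ<n k)) * Π.⨁ others (boxWt T) * Π.⨁ (allFin αᵢ) (λ k → factor (ρ T) h (toℕ k))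
          ≈ Π.⨁ (allFin αᵢ) (λ k → rowWt T (Fin.toℕ<n k) * factor (ρ T) h (toℕ k)) * Π.⨁ others (boxWt T)
        regroup T = ≈-trans (solve 3 (λ x y z → x :* y :* z := (x :* z) :* y) ≈-refl _ _ _)
          (*-congʳ (≈-sym (Π.⨁-∙ (allFin αᵢ) _ _)))

-- Total probability

module StopSum {c ℓ} (R : CommutativeRing c ℓ) where

  open CommutativeRing R renaming (refl to ≈-refl; sym to ≈-sym; trans to ≈-trans)
  open RingIdentities R using (x-y+y≈x)
  open RingProperties ring using (-0#≈0#)
  open StopProbability R
  open SetoidReasoning setoid
  module Σ′ = Fold +-commutativeMonoid

  stopAt-suc : ∀ f h → stopAt f (suc h) ≈ f 0 * stopAt (f ∘ suc) h
  stopAt-suc f h = ≈-trans (*-assoc _ _ _) (*-congˡ (*-congʳ (reflexive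
    (cong (foldr _*_ 1#) (trans (List.map-applyUpTo suc f h) (sym (List.map-upTo (f ∘ suc) h)))))))

  -- By the first step: the process stops at once with probability 1 - f 0, and otherwise continues
  -- as the shifted process. As f H is 0, it stops at step H at the latest.
  ∑-stopAt : ∀ f H → f H ≈ 0# → Σ′.⨁ (upTo (suc H)) (stopAt f) ≈ 1#
  ∑-stopAt f zero e = begin
    1# * (1# - f 0) + 0#   ≈⟨ ≈-trans (+-identityʳ _) (*-identityˡ _) ⟩
    1# - f 0               ≈⟨ +-congˡ (≈-trans (-‿cong e) -0#≈0#) ⟩
    1# + 0#                ≈⟨ +-identityʳ 1# ⟩
    1#                     ∎
  ∑-stopAt f (suc H) e = begin
    stopAt f 0 + foldr _+_ 0# (map (stopAt f) (applyUpTo suc (suc H)))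
      ≡⟨ cong (λ xs → stopAt f 0 + foldr _+_ 0# xs)
           (trans (List.map-applyUpTo suc (stopAt f) (suc H)) (sym (List.map-upTo (stopAt f ∘ suc) (suc H)))) ⟩
    stopAt f 0 + Σ′.⨁ (upTo (suc H)) (λ h → stopAt f (suc h))
      ≈⟨ +-cong (*-identityˡ _) (≈-trans (Σ′.⨁-cong (upTo (suc H)) (stopAt-suc f)) (distrib-⨁ (upTo (suc H)))) ⟩
    (1# - f 0) + f 0 * Σ′.⨁ (upTo (suc H)) (stopAt (f ∘ suc))
      ≈⟨ +-congˡ (≈-trans (*-congˡ (∑-stopAt (f ∘ suc) H e)) (*-identityʳ _)) ⟩
    (1# - f 0) + f 0
      ≈⟨ x-y+y≈x 1# (f 0) ⟩
    1# ∎
    where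
    distrib-⨁ : ∀ hs → Σ′.⨁ hs (λ h → f 0 * stopAt (f ∘ suc) h) ≈ f 0 * Σ′.⨁ hs (stopAt (f ∘ suc))
    distrib-⨁ []       = ≈-sym (zeroʳ _)
    distrib-⨁ (h ∷ hs) = ≈-trans (+-congˡ (distrib-⨁ hs)) (≈-sym (distribˡ _ _ _))

  ∏-zero : ∀ {A : Set} {xs : List A} {x f} → x ∈ xs → f x ≈ 0# → Π.⨁ xs f ≈ 0#
  ∏-zero (here refl) e = ≈-trans (*-congʳ e) (zeroˡ _)
  ∏-zero (there x∈)  e = ≈-trans (*-congˡ (∏-zero x∈ e)) (zeroʳ _)

module Stochastic {ℓ₁ ℓ₂} {R : CommutativeRing ℓ₁ ℓ₂} (W : Rates R)
  {m : ℕ} (α : Vec ℕ (suc m)) (i : Fin m)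
  (αᵢ≡αᵢ₊₁ : lookup α (inject₁ i) ≡ lookup α (Fin.suc i)) where

  open CommutativeRing R renaming (refl to ≈-refl; sym to ≈-sym; trans to ≈-trans)
  open Rates W
  open LocalBalance W using (1-1≈0)
  open StopProbability R
  open StopSum R
  open Swapping α i αᵢ≡αᵢ₊₁ using (αᵢ; Ω₀; leftBox; rightBox)
  open SwapGeometry α i αᵢ≡αᵢ₊₁
  open Balance W α i αᵢ≡αᵢ₊₁ using (rateAt)

  module _ (f : ℕ → Carrier) {T : Filling α}
    (f-rate : ∀ {k} (k< : k < αᵢ) → f k ≈ rateAt T k<)
    (f-top : f αᵢ ≈ 0#) (naf : NonAttacking T) where

    stopAt-attacking : ∀ {h} → h ≤ αᵢ → ¬ NonAttacking (Ω₀ h T) → stopAt f h ≈ 0#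
    stopAt-attacking {h} h≤ att with ℕ.anyUpTo? crossing? h
      where
      crossing? : ∀ k → Dec (∃ λ (k< : k < αᵢ) → T ⟦ rightBox k (ℕ.<⇒≤ k<) ⟧ ≡ T ⟦ leftBox (suc k) k< ⟧)
      crossing? k with k ℕ.<? αᵢ
      ... | yes k< = map′ (k< ,_) proj₂ (T ⟦ rightBox k (ℕ.<⇒≤ k<) ⟧ Fin.≟ T ⟦ leftBox (suc k) k< ⟧)
      ... | no k≮  = no (λ (k< , _) → k≮ k<)
    ... | yes (k , k<h , k< , b≡c) = ≈-trans (*-congʳ (∏-zero (∈-upTo⁺ k<h) (≈-trans (f-rate k<) (rate-b≡c
      -- Given b = c, the equality a = c would force a = b, and b = d would force c = d.
      (λ a≡c → left≢right {T} naf (ℕ.<⇒≤ k<) (trans a≡c (sym b≡c)))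
      (λ b≡d → left≢right {T} naf k< (trans (sym b≡c) b≡d)) b≡c)))) (zeroˡ _)
    ... | no none with h ℕ.<? αᵢ
    -- At h = αᵢ there is no row above that could be attacked.
    ...   | no h≮ = ⊥-elim (att (Ω-nonAttacking {T} {h} naf (λ {k} k< k<h e → none (k , k<h , k< , e)) (λ h< → ⊥-elim (h≮ h<))))
    ...   | yes h< with T ⟦ rightBox h (ℕ.<⇒≤ h<) ⟧ Fin.≟ T ⟦ rightBox (suc h) h< ⟧
    ...     | yes b≡d = ≈-trans (*-congˡ (1-1≈0 (≈-trans (f-rate h<) (rate-b≡d b≡d)))) (zeroʳ _)
    ...     | no  b≢d = ⊥-elim (att (Ω-nonAttacking {T} {h} naf (λ {k} k< k<h e → none (k , k<h , k< , e)) (λ _ → b≢d)))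

    module _ {τ τ′ : Permutation′ (suc m)} (τ′≡τs : ∀ j → τ′ ⟨$⟩ʳ j ≡ τ ⟨$⟩ʳ s j) (base : HasBasement τ T)
      (P : NAF α τ′ → Carrier)
      (P-Ω : ∀ U {h} → h ≤ αᵢ → value U ≡ Ω₀ h T → P U ≈ stopAt f h)
      (P-none : ∀ U → (∀ {h} → h ≤ αᵢ → value U ≢ Ω₀ h T) → P U ≈ 0#) where

      private
        -- Writing `P U` as a sum over h, with at most one stopping row matching U, allows the sums
        -- over U and over h to be interchanged.
        δ : NAF α τ′ → ℕ → Carrier
        δ U h = if does (value U ≟ᶠ Ω₀ h T) then stopAt f h else 0#

        δ-≡ : ∀ U {h} → value U ≡ Ω₀ h T → δ U h ≈ stopAt f h
        δ-≡ U {h} e = reflexive (cong (λ b → if b then stopAt f h else 0#) (dec-true (value U ≟ᶠ Ω₀ h T) e))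

        δ-≢ : ∀ U {h} → value U ≢ Ω₀ h T → δ U h ≈ 0#
        δ-≢ U {h} ne = reflexive (cong (λ b → if b then stopAt f h else 0#) (dec-false (value U ≟ᶠ Ω₀ h T) ne))

        P-δ : ∀ U → P U ≈ Σ′.⨁ (upTo (suc αᵢ)) (δ U)
        P-δ U with ℕ.anyUpTo? (λ h → value U ≟ᶠ Ω₀ h T) (suc αᵢ)
        ... | yes (h , h< , e) = ≈-trans (P-Ω U (ℕ.≤-pred h<) e) (≈-sym (≈-trans
          (Σ′.⨁-unique (Unique.upTo⁺ (suc αᵢ)) (∈-upTo⁺ h<) (λ h′∈ h′≢h → δ-≢ U (λ e′ → h′≢h
            (Ω-injective {T} naf (ℕ.≤-pred (∈-upTo⁻ h′∈)) (ℕ.≤-pred h<) (trans (sym e′) e)))))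
          (δ-≡ U e)))
        ... | no none = ≈-trans (P-none U (λ {h} h≤ e → none (h , s≤s h≤ , e)))
          (≈-sym (Σ′.⨁-ε (upTo (suc αᵢ)) (λ {h} h∈ → δ-≢ U (λ e → none (h , ∈-upTo⁻ h∈ , e)))))

      ∑P≈1 : (𝐔 : Enumeration (NAF α τ′)) → Σ′.⨁ (elements 𝐔) P ≈ 1#
      ∑P≈1 𝐔 = ≈-trans (Σ′.⨁-cong (elements 𝐔) P-δ)
        (≈-trans (Σ′.⨁-comm (elements 𝐔) (upTo (suc αᵢ)) δ)
        (≈-trans (Σ′.⨁-cong-∈ (upTo (suc αᵢ)) (λ h∈ → ∑δ (ℕ.≤-pred (∈-upTo⁻ h∈)))) (∑-stopAt f αᵢ f-top)))
        where
        ∑δ : ∀ {h} → h ≤ αᵢ → Σ′.⨁ (elements 𝐔) (λ U → δ U h) ≈ stopAt f h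
        ∑δ {h} h≤ with nonAttacking? (Ω₀ h T)
        ... | yes nafΩ = ≈-trans
          -- Equal fillings give equal elements of `NAF`, since the membership proofs are
          -- irrelevant.
          (Σ′.⨁-unique (unique 𝐔) (complete 𝐔 Uₕ) (λ {U} _ U≢Uₕ → δ-≢ U (λ { refl → U≢Uₕ refl }))) (δ-≡ Uₕ refl)
          where
          Uₕ : NAF α τ′
          Uₕ = Ω₀ h T Refinement., [ (Ω-basement {τ} {τ′} {T} h τ′≡τs base , nafΩ) ]
        ... | no att = ≈-trans (Σ′.⨁-ε (elements 𝐔) (λ {U} _ → δ-≢ U (λ e → att (subst NonAttacking e (nonAttacking τ′ U)))))
          (≈-sym (stopAt-attacking h≤ att))

-- The field of rational functions

module 𝕂-Weights = FractionWeights ℚ[q,t].polynomialDomain qₚ tₚ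

module _ {n : ℕ} (a b c d : Fin n) (A ℓ : ℕ) where

  rate-b≡d : b ≡ d → Defs.rate a b c d A ℓ ≡ 𝕂.1#
  rate-b≡d e with a Fin.≟ c | b Fin.≟ d | b Fin.≟ c
  ... | yes _ | yes _ | _ = refl
  ... | yes _ | no ne | _ = ⊥-elim (ne e)
  ... | no  _ | yes _ | _ = refl
  ... | no  _ | no ne | _ = ⊥-elim (ne e)

  rate-a≡c : a ≡ c → b ≢ d → Defs.rate a b c d A ℓ ≡ Defs.t Defs.^ (1 ∸ χ₃ d a b) 𝕂.* armLegRatio A ℓ
  rate-a≡c e b≢d with a Fin.≟ c | b Fin.≟ d | b Fin.≟ c
  ... | yes _ | yes b≡d | _ = ⊥-elim (b≢d b≡d)
  ... | yes _ | no  _   | _ = refl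
  ... | no ne | _       | _ = ⊥-elim (ne e)

  rate-b≡c : a ≢ c → b ≢ d → b ≡ c → Defs.rate a b c d A ℓ ≡ 𝕂.0#
  rate-b≡c a≢c b≢d e with a Fin.≟ c | b Fin.≟ d | b Fin.≟ c
  ... | yes a≡c | _       | _     = ⊥-elim (a≢c a≡c)
  ... | no  _   | yes b≡d | _     = ⊥-elim (b≢d b≡d)
  ... | no  _   | no  _   | yes _ = refl
  ... | no  _   | no  _   | no ne = ⊥-elim (ne e)

  rate-distinct : a ≢ c → b ≢ d → b ≢ c →
    Defs.rate a b c d A ℓ ≡ (if does (χ₃ c d a ℕ.≟ χ₃ c d b) then 𝕂.0# else 𝕂.1#)
  rate-distinct a≢c b≢d b≢c with a Fin.≟ c | b Fin.≟ d | b Fin.≟ c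
  ... | yes a≡c | _       | _       = ⊥-elim (a≢c a≡c)
  ... | no  _   | yes b≡d | _       = ⊥-elim (b≢d b≡d)
  ... | no  _   | no  _   | yes b≡c = ⊥-elim (b≢c b≡c)
  ... | no  _   | no  _   | no  _   = refl

  rate-χ₃≡ : a ≢ c → b ≢ d → b ≢ c → χ₃ c d a ≡ χ₃ c d b → Defs.rate a b c d A ℓ ≡ 𝕂.0#
  rate-χ₃≡ a≢c b≢d b≢c e = trans (rate-distinct a≢c b≢d b≢c)
    (cong (λ x → if x then 𝕂.0# else 𝕂.1#) (dec-true (χ₃ c d a ℕ.≟ χ₃ c d b) e))

  rate-χ₃≢ : a ≢ c → b ≢ d → b ≢ c → χ₃ c d a ≢ χ₃ c d b → Defs.rate a b c d A ℓ ≡ 𝕂.1#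
  rate-χ₃≢ a≢c b≢d b≢c ne = trans (rate-distinct a≢c b≢d b≢c)
    (cong (λ x → if x then 𝕂.0# else 𝕂.1#) (dec-false (χ₃ c d a ℕ.≟ χ₃ c d b) ne))

𝕂-rates : Rates ℚ⟨q,t⟩-field
𝕂-rates = record
  { q = Defs.q ; t = Defs.t
  ; fac = 𝕂-Weights.fac Defs.1-q^t^≉0 ; ratio = armLegRatio
  ; fac*ratio = 𝕂-Weights.fac*ratio Defs.1-q^t^≉0
  ; 1-t*ratio = 𝕂-Weights.1-t*ratio Defs.1-q^t^≉0
  ; 1-ratio = 𝕂-Weights.1-ratio Defs.1-q^t^≉0
  ; rate = Defs.rate
  ; rate-b≡d = λ {n} {a} {b} {c} {d} {A} {ℓ} e → 𝕂.reflexive (rate-b≡d a b c d A ℓ e)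
  ; rate-a≡c = λ {n} {a} {b} {c} {d} {A} {ℓ} e ne → 𝕂.reflexive (rate-a≡c a b c d A ℓ e ne)
  ; rate-b≡c = λ {n} {a} {b} {c} {d} {A} {ℓ} a≢c b≢d e → 𝕂.reflexive (rate-b≡c a b c d A ℓ a≢c b≢d e)
  ; rate-χ₃≡ = λ {n} {a} {b} {c} {d} {A} {ℓ} a≢c b≢d b≢c e → 𝕂.reflexive (rate-χ₃≡ a b c d A ℓ a≢c b≢d b≢c e)
  ; rate-χ₃≢ = λ {n} {a} {b} {c} {d} {A} {ℓ} a≢c b≢d b≢c ne → 𝕂.reflexive (rate-χ₃≢ a b c d A ℓ a≢c b≢d b≢c ne)
  }

-- Assembling the probabilistic bijection

module SwapBijection {m : ℕ} (α : Vec ℕ (suc m)) (i : Fin m)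
  (αᵢ≡αᵢ₊₁ : lookup α (inject₁ i) ≡ lookup α (Fin.suc i)) where

  open Swapping α i αᵢ≡αᵢ₊₁
  open SwapGeometry α i αᵢ≡αᵢ₊₁ using (s; s-involutive; Ω-involutive; Ω-injective)
  open StopProbability ℚ⟨q,t⟩-field using (stopAt)
  open Balance 𝕂-rates α i αᵢ≡αᵢ₊₁ using (rateAt; balance)
  open Stochastic 𝕂-rates α i αᵢ≡αᵢ₊₁ using (∑P≈1)

  ρ-rate : ∀ T {k} (k< : k < αᵢ) → ρ T k ≡ rateAt T k<
  ρ-rate T {k} k< with k ℕ.<? αᵢ
  ... | yes _  = refl
  ... | no k≮ = ⊥-elim (k≮ k<)

  ρ-top : ∀ T → ρ T αᵢ ≡ 𝕂.0#
  ρ-top T with αᵢ ℕ.<? αᵢ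
  ... | yes αᵢ<αᵢ = ⊥-elim (ℕ.<-irrefl refl αᵢ<αᵢ)
  ... | no  _     = refl

  module _ (τ : Permutation′ (suc m)) where

    P-Ω : ∀ (T : NAF α τ) U {h} → h ≤ αᵢ → U ≡ Ω₀ h (value T) → P {τ} T U ≡ stopAt (ρ (value T)) h
    P-Ω T U {h} h≤ e with ℕ.anyUpTo? (λ h → U ≟ᶠ Ω₀ h (value T)) (suc αᵢ)
    -- The search may return another row h′, which `Ω-injective` identifies with h.
    ... | yes (h′ , h′< , e′) = cong (stopAt (ρ (value T)))
      (Ω-injective {value T} (nonAttacking τ T) (ℕ.≤-pred h′<) h≤ (trans (sym e′) e))
    ... | no none             = ⊥-elim (none (h , s≤s h≤ , e))

    P-none : ∀ (T : NAF α τ) U → (∀ {h} → h ≤ αᵢ → U ≢ Ω₀ h (value T)) → P {τ} T U ≡ 𝕂.0#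
    P-none T U none with ℕ.anyUpTo? (λ h → U ≟ᶠ Ω₀ h (value T)) (suc αᵢ)
    ... | yes (h , h< , e) = ⊥-elim (none (ℕ.≤-pred h<) e)
    ... | no _             = refl

  P-stochastic : ∀ {τ τ′ : Permutation′ (suc m)} → (∀ j → τ′ ⟨$⟩ʳ j ≡ τ ⟨$⟩ʳ s j) → (T : NAF α τ) →
                 ∑[ enumerateNAF α τ′ ] (λ U → P {τ} T (value U)) 𝕂.≈ 𝕂.1#
  P-stochastic {τ} {τ′} e T = ∑P≈1 (ρ (value T)) {value T}
    (λ k< → 𝕂.reflexive (ρ-rate (value T) k<)) (𝕂.reflexive (ρ-top (value T)))
    (nonAttacking τ T) {τ} {τ′} e (hasBasement τ T) (λ U → P {τ} T (value U))
    (λ U h≤ U≡ → 𝕂.reflexive (P-Ω τ T (value U) h≤ U≡))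
    (λ U none → 𝕂.reflexive (P-none τ T (value U) none))
    (enumerateNAF α τ′)

  Ω-symmetric : ∀ h {T U} → U ≡ Ω₀ h T → T ≡ Ω₀ h U
  Ω-symmetric h {T} e = trans (sym (Ω-involutive h T)) (cong (Ω₀ h) (sym e))

  P-balanced : ∀ {τ τ′ : Permutation′ (suc m)} (T : NAF α τ) (U : NAF α τ′) →
               wt (value T) 𝕂.* P {τ} T (value U) 𝕂.≈ wt (value U) 𝕂.* P {τ′} U (value T)
  P-balanced {τ} {τ′} T U = by-cases (ℕ.anyUpTo? (λ h → value U ≟ᶠ Ω₀ h (value T)) (suc αᵢ))
    where
    balance-Ω : ∀ {h V} → h ≤ αᵢ → V ≡ Ω₀ h (value T) → NonAttacking V →
      wt (value T) 𝕂.* stopAt (ρ (value T)) h 𝕂.≈ wt V 𝕂.* stopAt (ρ V) h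
    balance-Ω {h} h≤ refl nafΩ = balance ρ (λ T k< → 𝕂.reflexive (ρ-rate T k<)) (λ T → 𝕂.reflexive (ρ-top T))
      {h} {value T} (nonAttacking τ T) nafΩ h≤
    by-cases : Dec (∃ λ h → h < suc αᵢ × value U ≡ Ω₀ h (value T)) →
      wt (value T) 𝕂.* P {τ} T (value U) 𝕂.≈ wt (value U) 𝕂.* P {τ′} U (value T)
    by-cases (yes (h , h< , e)) = ≡.subst₂ (λ x y → wt (value T) 𝕂.* x 𝕂.≈ wt (value U) 𝕂.* y)
      (sym (P-Ω τ T (value U) (ℕ.≤-pred h<) e)) (sym (P-Ω τ′ U (value T) (ℕ.≤-pred h<) (Ω-symmetric h e)))
      (balance-Ω (ℕ.≤-pred h<) e (nonAttacking τ′ U))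
    by-cases (no none) = ≡.subst₂ (λ x y → wt (value T) 𝕂.* x 𝕂.≈ wt (value U) 𝕂.* y)
      (sym (P-none τ T (value U) (λ {h} h≤ e → none (h , s≤s h≤ , e))))
      (sym (P-none τ′ U (value T) (λ {h} h≤ e → none (h , s≤s h≤ , Ω-symmetric h e))))
      (𝕂.trans (𝕂.zeroʳ (wt (value T))) (𝕂.sym (𝕂.zeroʳ (wt (value U)))))

theorem3p8 : {m : ℕ} (α : Vec ℕ (suc m)) (σ : Permutation′ (suc m)) (i : Fin m)
    (αᵢ≡αᵢ₊₁ : lookup α (inject₁ i) ≡ lookup α (Fin.suc i)) →
    IsProbabilisticBijection
    (enumerateNAF α σ) (enumerateNAF α (σ ·s i))
    (λ T → wt (value T)) (λ U → wt (value U))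
    (λ T U → Swapping.P α i αᵢ≡αᵢ₊₁ {σ} T (value U))
    (λ U T → Swapping.P α i αᵢ≡αᵢ₊₁ {σ ·s i} U (value T))
theorem3p8 α σ i αᵢ≡αᵢ₊₁ = record
  { ∑P𝐓≈1    = P-stochastic {σ} {σ ·s i} (λ j → refl)
  -- Exchanging the two positions twice restores σ pointwise, and the basements are compared only
  -- pointwise.
  ; ∑P𝐔≈1    = P-stochastic {σ ·s i} {σ} (λ j → cong (σ ⟨$⟩ʳ_) (sym (s-involutive j)))
  ; balanced = P-balanced {σ} {σ ·s i} }
  where
  open SwapGeometry α i αᵢ≡αᵢ₊₁ using (s-involutive)
  open SwapBijection α i αᵢ≡αᵢ₊₁
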